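{- The determinant of the square matrix over $\mathbb Z/2$ represented by a finite directed graph is not computable in $\tilde{C}$PTime. That is, no polynomial time bounded BGS program (without the cardinality function) decides, for every finite directed graph $\langle I,E\rangle$ with $E\subseteq I\times I$, whether the $I$-square matrix $M$ over $\mathbb Z/2$ with $M(i,j)=1\iff(i,j)\in E$ has determinant $1$.
   Context: The determinant of an $I$-square matrix $M:I\times I\to\mathbb Z/2$ is that of the ordinary matrix obtained by choosing any linear ordering of $I$ for both rows and columns (independent of the ordering). $\tilde{C}$PTime is the class of Boolean queries decidable by polynomial time bounded BGS programs: abstract state machine programs operating on the hereditarily finite sets over the input's elements (as atoms), with the input relations, logical operations, set functions $\in,\emptyset,$ Atoms, $\bigcup$, TheUnique, Pair, comprehension terms $\{t(v):v\in r:\varphi(v)\}$, dynamic functions updated by rules built from updates, conditionals and parallel "do forall" rules (all updates of a step executed simultaneously unless conflicting), run for at most polynomially many steps with at most polynomially many active elements in the input size; the answer is the value of Output when Halt first becomes true. -}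

module Defs where

open import Data.Nat using (ℕ; zero; suc; _+_; _*_; _≤_; _<_)
open import Data.Fin using (Fin; zero; suc; punchIn)
import Data.Fin as F
open import Data.Bool using (Bool; true; false; _∧_; _∨_; not; _xor_; if_then_else_)
open import Data.List using (List; []; _∷_; _++_; length; map; concatMap; allFin)
open import Data.Vec using (Vec)
import Data.Vec as V
open import Data.Product using (Σ; _×_; _,_; ∃-syntax)
open import Function.Bundles using (_⇔_)
open import Relation.Nullary.Decidable using (⌊_⌋)
open import Relation.Binary.PropositionalEquality using (_≡_)

-- Z/2 is represented by Bool (xor = addition, ∧ = multiplication).
-- Determinant of an n×n matrix over Z/2 by Laplace expansion along the
-- first row (cofactor signs are 1 in Z/2).

sumZ2 : {m : ℕ} → (Fin m → Bool) → Bool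
sumZ2 {zero}  f = false
sumZ2 {suc m} f = f zero xor sumZ2 (λ i → f (suc i))

det : (n : ℕ) → (Fin n → Fin n → Bool) → Bool
det zero    M = true
det (suc n) M = sumZ2 (λ j → M zero j ∧ det n (λ r c → M (suc r) (punchIn j c)))

record Graph : Set where
  field
    size  : ℕ
    edges : Fin size → Fin size → Bool
open Graph public

-- Hereditarily finite sets over the atoms Fin n (extensional equality).

data HF (n : ℕ) : Set where
  atom : Fin n → HF n
  set  : List (HF n) → HF n

mutual
  eqHF : {n : ℕ} → HF n → HF n → Bool
  eqHF (atom a) (atom b) = ⌊ a F.≟ b ⌋
  eqHF (atom _) (set _)  = false
  eqHF (set _)  (atom _) = false
  eqHF (set xs) (set ys) = subHF xs ys ∧ subHF ys xs

  subHF : {n : ℕ} → List (HF n) → List (HF n) → Bool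
  subHF []       ys = true
  subHF (x ∷ xs) ys = memHF x ys ∧ subHF xs ys

  memHF : {n : ℕ} → HF n → List (HF n) → Bool
  memHF x []       = false
  memHF x (y ∷ ys) = eqHF x y ∨ memHF x ys

elems : {n : ℕ} → HF n → List (HF n)
elems (atom _) = []
elems (set xs) = xs

dedup : {n : ℕ} → List (HF n) → List (HF n)
dedup []       = []
dedup (x ∷ xs) = if memHF x xs then dedup xs else x ∷ dedup xs

emptyS trueS : {n : ℕ} → HF n
emptyS = set []
trueS  = set (emptyS ∷ [])

toHF : {n : ℕ} → Bool → HF n
toHF b = if b then trueS else emptyS

truthy : {n : ℕ} → HF n → Bool
truthy v = eqHF v trueS

atomSet : {n : ℕ} → HF n
atomSet {n} = set (map atom (allFin n))

record Sig : Set where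
  field
    k  : ℕ
    ar : Fin k → ℕ

data Dyn (k : ℕ) : Set where
  halt output : Dyn k
  fn : Fin k → Dyn k

arity : (S : Sig) → Dyn (Sig.k S) → ℕ
arity S halt   = 0
arity S output = 0
arity S (fn i) = Sig.ar S i

eqDyn : {k : ℕ} → Dyn k → Dyn k → Bool
eqDyn halt   halt   = true
eqDyn output output = true
eqDyn (fn i) (fn j) = ⌊ i F.≟ j ⌋
eqDyn _      _      = false

LocK : ℕ → ℕ → Set
LocK k n = Dyn k × List (HF n)

UpdK : ℕ → ℕ → Set
UpdK k n = LocK k n × HF n

data Term (S : Sig) (V : ℕ) : Set where
  var       : Fin V → Term S V
  dyn       : (f : Dyn (Sig.k S)) → Vec (Term S V) (arity S f) → Term S V
  edge      : Term S V → Term S V → Term S V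
  tt ff     : Term S V
  and or    : Term S V → Term S V → Term S V
  neg       : Term S V → Term S V
  eq mem    : Term S V → Term S V → Term S V
  empty     : Term S V
  atoms     : Term S V
  bigUnion  : Term S V → Term S V
  theUnique : Term S V → Term S V
  pair      : Term S V → Term S V → Term S V
  -- compr t r φ  is  { t(v) : v ∈ r : φ(v) }
  compr     : Term S (suc V) → Term S V → Term S (suc V) → Term S V

data Rule (S : Sig) (V : ℕ) : Set where
  skip   : Rule S V
  upd    : (f : Dyn (Sig.k S)) → Vec (Term S V) (arity S f) → Term S V → Rule S V
  ite    : Term S V → Rule S V → Rule S V → Rule S V
  par    : Rule S V → Rule S V → Rule S V
  forAll : Term S V → Rule S (suc V) → Rule S V

Loc : Sig → ℕ → Set
Loc S n = LocK (Sig.k S) n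

Update : Sig → ℕ → Set
Update S n = UpdK (Sig.k S) n

-- a state: list of updates, most recent first; default value ∅
State : Sig → ℕ → Set
State S n = List (UpdK (Sig.k S) n)

eqArgs : {n : ℕ} → List (HF n) → List (HF n) → Bool
eqArgs []       []       = true
eqArgs (x ∷ xs) (y ∷ ys) = eqHF x y ∧ eqArgs xs ys
eqArgs _        _        = false

eqLoc : {k n : ℕ} → LocK k n → LocK k n → Bool
eqLoc (f , as) (g , bs) = eqDyn f g ∧ eqArgs as bs

lookupSt : {k n : ℕ} → LocK k n → List (UpdK k n) → HF n
lookupSt l []              = emptyS
lookupSt l ((l' , v) ∷ st) = if eqLoc l l' then v else lookupSt l st

module Eval (S : Sig) {n : ℕ} (E : Fin n → Fin n → Bool) (st : State S n) where

  edgeVal : HF n → HF n → HF n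
  edgeVal (atom a) (atom b) = toHF (E a b)
  edgeVal _        _        = emptyS

  unique : List (HF n) → HF n
  unique xs with dedup xs
  ... | x ∷ [] = x
  ... | _      = emptyS

  mutual
    eval : {V : ℕ} → Vec (HF n) V → Term S V → HF n
    eval ρ (var i)       = V.lookup ρ i
    eval ρ (dyn f ts)    = lookupSt (f , evalArgs ρ ts) st
    eval ρ (edge a b)    = edgeVal (eval ρ a) (eval ρ b)
    eval ρ tt            = trueS
    eval ρ ff            = emptyS
    eval ρ (and a b)     = toHF (truthy (eval ρ a) ∧ truthy (eval ρ b))
    eval ρ (or a b)      = toHF (truthy (eval ρ a) ∨ truthy (eval ρ b))
    eval ρ (neg a)       = toHF (not (truthy (eval ρ a)))
    eval ρ (eq a b)      = toHF (eqHF (eval ρ a) (eval ρ b))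
    eval ρ (mem a b)     = toHF (memHF (eval ρ a) (elems (eval ρ b)))
    eval ρ empty         = emptyS
    eval ρ atoms         = atomSet
    eval ρ (bigUnion a)  = set (concatMap elems (elems (eval ρ a)))
    eval ρ (theUnique a) = unique (elems (eval ρ a))
    eval ρ (pair a b)    = set (eval ρ a ∷ eval ρ b ∷ [])
    eval ρ (compr t r φ) = set (evalC ρ t φ (elems (eval ρ r)))

    evalArgs : {V m : ℕ} → Vec (HF n) V → Vec (Term S V) m → List (HF n)
    evalArgs ρ V.[]       = []
    evalArgs ρ (t V.∷ ts) = eval ρ t ∷ evalArgs ρ ts

    evalC : {V : ℕ} → Vec (HF n) V → Term S (suc V) → Term S (suc V) → List (HF n) → List (HF n)
    evalC ρ t φ []       = []
    evalC ρ t φ (x ∷ xs) =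
      if truthy (eval (x V.∷ ρ) φ) then eval (x V.∷ ρ) t ∷ evalC ρ t φ xs else evalC ρ t φ xs

  mutual
    exec : {V : ℕ} → Vec (HF n) V → Rule S V → List (Update S n)
    exec ρ skip         = []
    exec ρ (upd f ts t) = ((f , evalArgs ρ ts) , eval ρ t) ∷ []
    exec ρ (ite φ R R') = if truthy (eval ρ φ) then exec ρ R else exec ρ R'
    exec ρ (par R R')   = exec ρ R ++ exec ρ R'
    exec ρ (forAll r R) = execF ρ R (elems (eval ρ r))

    execF : {V : ℕ} → Vec (HF n) V → Rule S (suc V) → List (HF n) → List (Update S n)
    execF ρ R []       = []
    execF ρ R (x ∷ xs) = exec (x V.∷ ρ) R ++ execF ρ R xs

allB : {A : Set} → (A → Bool) → List A → Bool
allB p []       = true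
allB p (x ∷ xs) = p x ∧ allB p xs

consistent : {k n : ℕ} → List (UpdK k n) → Bool
consistent U = allB (λ { (l , v) → allB (λ { (l' , v') → not (eqLoc l l') ∨ eqHF v v' }) U }) U

step : (S : Sig) {n : ℕ} → (Fin n → Fin n → Bool) → Rule S 0 → State S n → State S n
step S E Π st with Eval.exec S E st V.[] Π
... | U = if consistent U then U ++ st else st

run : (S : Sig) (G : Graph) → Rule S 0 → ℕ → State S (size G)
run S G Π zero    = []
run S G Π (suc m) = step S (edges G) Π (run S G Π m)

halted : {k n : ℕ} → List (UpdK k n) → Bool
halted st = truthy (lookupSt (halt , []) st)

outputVal : {k n : ℕ} → List (UpdK k n) → HF n
outputVal st = lookupSt (output , []) st

removeLoc : {k n : ℕ} → LocK k n → List (UpdK k n) → List (UpdK k n)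
removeLoc l []              = []
removeLoc l ((l' , v) ∷ st) = if eqLoc l l' then removeLoc l st else (l' , v) ∷ removeLoc l st

current : {k n : ℕ} → List (UpdK k n) → List (UpdK k n)
current []             = []
current ((l , v) ∷ st) = (l , v) ∷ removeLoc l (current st)

critical : {k n : ℕ} → List (UpdK k n) → List (HF n)
critical {k} {n} st =
  emptyS ∷ trueS ∷ atomSet ∷ map atom (allFin n) ++
  concatMap (λ { ((f , args) , v) → if eqHF v emptyS then [] else v ∷ args }) (current st)

mutual
  tc : {n : ℕ} → HF n → List (HF n)
  tc (atom a) = atom a ∷ []
  tc (set xs) = set xs ∷ tcL xs

  tcL : {n : ℕ} → List (HF n) → List (HF n)
  tcL []       = []
  tcL (x ∷ xs) = tc x ++ tcL xs

activeCount : {k n : ℕ} → List (UpdK k n) → ℕ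
activeCount st = length (dedup (concatMap tc (critical st)))

Poly : Set
Poly = List ℕ

evalPoly : Poly → ℕ → ℕ
evalPoly []       x = 0
evalPoly (c ∷ cs) x = c + x * evalPoly cs x

-- The PTime bounded program (Π, p, q) accepts G: Halt first becomes true
-- at some step m ≤ p(|I|), every state up to m has ≤ q(|I|) active
-- elements, and Output = true there.  Otherwise the answer is false.
Accepts : (S : Sig) → Rule S 0 → Poly → Poly → Graph → Set
Accepts S Π p q G =
  ∃[ m ] ( m ≤ evalPoly p (size G)
         × halted (run S G Π m) ≡ true
         × (∀ j → j < m → halted (run S G Π j) ≡ false)
         × (∀ j → j ≤ m → activeCount (run S G Π j) ≤ evalPoly q (size G))
         × eqHF (outputVal (run S G Π m)) trueS ≡ true )

InCPTime : (Graph → Set) → Set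
InCPTime Q = Σ Sig λ S → Σ (Rule S 0) λ Π → Σ Poly λ p → Σ Poly λ q →
  (G : Graph) → Accepts S Π p q G ⇔ Q G

module Submission where

-- The graphs are the complete graphs K_n without loops, whose adjacency matrix has determinant 1 over Z/2
-- exactly when n is even.
--
-- An object built over K_n is denoted by a "form", a finite description not mentioning n, together with a
-- tuple of distinct atoms: the set denoted by a form consists of all instances of its element forms, obtained
-- by choosing further atoms freely.  Evaluating a term at such objects gives an object denoted by a form that
-- is the same for all large n, because the truth of equations between forms depends only on the equality
-- pattern of the atoms (a back-and-forth argument).  If the tuple of an active object could not be shortened
-- to at most d atoms, its images under renaming would be too many for the space bound, which is a
-- polynomial of degree less than d in n; so forms of bounded size suffice, and the run over a single large
-- even n determines the runs over all larger n.  In particular they all halt at the same step.  The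
-- number of active elements at each step is then a polynomial in n that respects the space bound for all
-- even n, hence for all large n, and a large odd n is accepted too.

open import Defs
open import Data.Nat using (ℕ; zero; suc; _+_; _*_; _^_; _≤_; _<_; z≤n; s≤s)
open import Data.Nat.Properties
  using (≤-refl; ≤-trans; ≤-reflexive; +-mono-≤; m≤m+n; m≤n+m; n≤1+n; +-suc; +-comm; +-assoc; m≤n⇒m≤1+n;
         *-monoˡ-≤; _≤?_; ≰⇒>; <⇒≱; <⇒≢; ≤-antisym; +-identityʳ;
         *-mono-≤; *-assoc; *-comm; *-identityʳ; *-distribʳ-+; *-distribˡ-+; ≮⇒≥; <⇒≤; <-cmp; ≤∧≢⇒<; *-monoˡ-<; ^-monoʳ-≤; m^n≢0;
         module ≤-Reasoning) renaming (_≟_ to _≟ℕ_)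
open import Data.Fin using (Fin; zero; suc; _↑ˡ_; _↑ʳ_)
import Data.Fin as F
import Data.Fin.Properties as F
import Data.Fin.Permutation as Perm
open import Data.Fin.Permutation using (Permutation′; _⟨$⟩ʳ_; transpose; _∘ₚ_; remove; punchIn-permute)
open import Data.Bool using (Bool; true; false; _∧_; _∨_; not; _xor_; if_then_else_)
open import Data.Bool.Properties using (∨-zeroʳ; ∨-identityʳ; ∧-zeroʳ; not-involutive; xor-∧-commutativeRing)
open import Data.List using (List; []; _∷_; _++_; length; map; concatMap; filter; allFin)
open import Data.Nat.ListAction using (sum)
open import Data.List.Properties using (length-map; length-++; map-∘; map-cong)
open import Data.List.Membership.Propositional using (_∈_)
open import Data.List.Membership.Propositional.Properties
import Data.List
open import Data.List.Relation.Unary.Any using (here; there; index)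
open import Data.List.Relation.Unary.Any.Properties using (lookup-index)
open import Data.Vec using (Vec; []; _∷_) renaming (lookup to infixl 9 _!_)
import Data.Vec as V
import Data.Vec.Properties as V
open import Data.Product using (Σ; _×_; _,_; ∃-syntax; proj₁; proj₂)
open import Data.Sum using (_⊎_; inj₁; inj₂)
open import Data.Empty using (⊥; ⊥-elim)
open import Relation.Binary.Definitions using (tri<; tri≈; tri>)
open import Function using (_∘_; id; case_of_)
open import Function.Bundles using (_⇔_; Equivalence; Injection)
open import Function.Properties.Inverse using (↔⇒↣)
open import Algebra.Bundles using (CommutativeRing)
import Algebra.Properties.CommutativeMonoid.Sum
open import Relation.Nullary using (¬_; Dec; yes; no)
open import Relation.Nullary.Decidable using (⌊_⌋; map′; _→-dec_; _×-dec_; ¬?; decidable-stable)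
open import Relation.Binary.PropositionalEquality

-- The size `N` of the graph whose run is followed must be fixed before the length of that run is
-- known, since the length may grow with `N`. Bounds on forms therefore must not accumulate: one
-- step takes a bound `b₀` to at most `K`, and after every step the state is brought back to `b₀`,
-- which depends only on the arities and on the length of `q`. Activity is assumed only over `N`,
-- yet the reduction is valid for every larger size, because "this position may be dropped" is
-- itself an equation between forms. Agreement of all runs in halting and output is not yet a
-- contradiction: a program may also reject by exceeding its space bound, and about space at odd
-- sizes the hypothesis says nothing. Hence the count of active elements. It is handled by finite
-- differences, with classical case distinctions made under double negation, which suffices as the
-- goal is `⊥`.

private variable
  n n' m k l c : ℕ

-- Extensional equality of hereditarily finite sets

infix 4 _≈_ _∈ₛ_

-- A record rather than the bare Boolean equation: `eqHF x y` reduces, after which `x` and `y` could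
-- no longer be inferred from the type.
record _≈_ {n : ℕ} (x y : HF n) : Set where
  constructor eqv
  field holds : eqHF x y ≡ true
open _≈_

_∈ₛ_ : HF n → List (HF n) → Set
x ∈ₛ xs = ∃[ y ] (y ∈ xs × x ≈ y)

∧-true : ∀ {a b} → a ∧ b ≡ true → a ≡ true × b ≡ true
∧-true {true} {true} refl = refl , refl

true-∧ : ∀ {a b} → a ≡ true → b ≡ true → a ∧ b ≡ true
true-∧ refl refl = refl

iff⇒≡ : ∀ {a b} → (a ≡ true → b ≡ true) → (b ≡ true → a ≡ true) → a ≡ b
iff⇒≡ {true}  {b}     f g = sym (f refl)
iff⇒≡ {false} {true}  f g = g refl
iff⇒≡ {false} {false} f g = refl

false≢true : ∀ {a} {A : Set} → a ≡ false → a ≡ true → A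
false≢true refl ()

mem⇒∈ₛ : {x : HF n} {ys : List (HF n)} → memHF x ys ≡ true → x ∈ₛ ys
mem⇒∈ₛ {x = x} {y ∷ ys} p with eqHF x y in e
... | true  = y , here refl , eqv e
... | false = let z , z∈ , x≈z = mem⇒∈ₛ p in z , there z∈ , x≈z

∈ₛ⇒mem : {x : HF n} {ys : List (HF n)} → x ∈ₛ ys → memHF x ys ≡ true
∈ₛ⇒mem (y , here refl , eqv e) rewrite e = refl
∈ₛ⇒mem {x = x} {y' ∷ _} (y , there y∈ , e) = trans (cong (eqHF x y' ∨_) (∈ₛ⇒mem (y , y∈ , e))) (∨-zeroʳ _)

sub⇒ : (xs ys : List (HF n)) → subHF xs ys ≡ true → ∀ {x} → x ∈ xs → x ∈ₛ ys
sub⇒ (x ∷ xs) ys p (here refl) = mem⇒∈ₛ (proj₁ (∧-true p))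
sub⇒ (x ∷ xs) ys p (there x∈)  = sub⇒ xs ys (proj₂ (∧-true {memHF x ys} p)) x∈

⇒sub : (xs ys : List (HF n)) → (∀ {x} → x ∈ xs → x ∈ₛ ys) → subHF xs ys ≡ true
⇒sub []       ys h = refl
⇒sub (x ∷ xs) ys h = true-∧ (∈ₛ⇒mem (h (here refl))) (⇒sub xs ys (h ∘ there))

set≈ : {xs ys : List (HF n)} → (∀ {x} → x ∈ xs → x ∈ₛ ys) → (∀ {y} → y ∈ ys → y ∈ₛ xs) → set xs ≈ set ys
set≈ f g = eqv (true-∧ (⇒sub _ _ f) (⇒sub _ _ g))

set≈→ : {xs ys : List (HF n)} → set xs ≈ set ys → ∀ {x} → x ∈ xs → x ∈ₛ ys
set≈→ {xs = xs} {ys} (eqv p) = sub⇒ xs ys (proj₁ (∧-true p))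

set≈← : {xs ys : List (HF n)} → set xs ≈ set ys → ∀ {y} → y ∈ ys → y ∈ₛ xs
set≈← {xs = xs} {ys} (eqv p) = sub⇒ ys xs (proj₂ (∧-true {subHF xs ys} p))

atom≈ : {a b : Fin n} → atom a ≈ atom b → a ≡ b
atom≈ {a = a} {b} (eqv p) with a F.≟ b
... | yes e = e

mutual
  HF-ind : {P : HF n → Set} → (∀ a → P (atom a)) → (∀ xs → (∀ {x} → x ∈ xs → P x) → P (set xs)) → ∀ x → P x
  HF-ind     f g (atom a) = f a
  HF-ind {P = P} f g (set xs) = g xs (HF-ind* {P = P} f g xs)

  HF-ind* : {P : HF n → Set} → (∀ a → P (atom a)) → (∀ xs → (∀ {x} → x ∈ xs → P x) → P (set xs)) →
            ∀ xs → ∀ {x} → x ∈ xs → P x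
  HF-ind* {P = P} f g (x ∷ xs) (here refl) = HF-ind {P = P} f g x
  HF-ind* {P = P} f g (x ∷ xs) (there x∈)  = HF-ind* {P = P} f g xs x∈

≈-refl : (x : HF n) → x ≈ x
≈-refl {n} = HF-ind atom-refl (λ xs ih → set≈ (λ x∈ → _ , x∈ , ih x∈) (λ x∈ → _ , x∈ , ih x∈))
  where
  atom-refl : (a : Fin n) → atom a ≈ atom a
  atom-refl a with a F.≟ a in e
  ... | yes _ = eqv (cong ⌊_⌋ e)
  ... | no ¬e = ⊥-elim (¬e refl)

≡⇒≈ : {x y : HF n} → x ≡ y → x ≈ y
≡⇒≈ {x = x} refl = ≈-refl x

≈-sym : {x y : HF n} → x ≈ y → y ≈ x
≈-sym {x = atom a} {atom b} p = ≡⇒≈ (cong atom (sym (atom≈ p)))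
≈-sym {x = atom a} {set ys} (eqv ())
≈-sym {x = set xs} {atom b} (eqv ())
≈-sym {x = set xs} {set ys} (eqv p) =
  eqv (true-∧ (proj₂ (∧-true {subHF xs ys} p)) (proj₁ (∧-true p)))

-- By induction on the middle set, whose elements mediate in both inclusions.
≈-trans : {x y z : HF n} → x ≈ y → y ≈ z → x ≈ z
≈-trans {x = x} {y} {z} = HF-ind {P = P} base sets y x z
  where
  P : HF _ → Set
  P y = ∀ x z → x ≈ y → y ≈ z → x ≈ z
  base : ∀ a → P (atom a)
  base a x (atom b) p q with atom≈ q
  ... | refl = p
  base a x (set zs) p (eqv ())
  sets : ∀ ys → (∀ {y} → y ∈ ys → P y) → P (set ys)
  sets ys ih (atom a) z (eqv ()) q
  sets ys ih (set xs) (atom a) p (eqv ())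
  sets ys ih (set xs) (set zs) p q = set≈
    (λ x∈ → let y , y∈ , e = set≈→ p x∈ ; z , z∈ , e' = set≈→ q y∈ in z , z∈ , ih y∈ _ _ e e')
    (λ z∈ → let y , y∈ , e = set≈← q z∈ ; x , x∈ , e' = set≈← p y∈ in x , x∈ , ih y∈ _ _ e e')

eqHF-cong : {x x' y y' : HF n} → x ≈ x' → y ≈ y' → eqHF x y ≡ eqHF x' y'
eqHF-cong p q = iff⇒≡ (λ e → holds (≈-trans (≈-sym p) (≈-trans (eqv e) q)))
                      (λ e → holds (≈-trans p (≈-trans (eqv e) (≈-sym q))))

∈⇒∈ₛ : {x : HF n} {xs : List (HF n)} → x ∈ xs → x ∈ₛ xs
∈⇒∈ₛ x∈ = _ , x∈ , ≈-refl _

∈ₛ-resp : {x y : HF n} {xs : List (HF n)} → x ≈ y → y ∈ₛ xs → x ∈ₛ xs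
∈ₛ-resp p (z , z∈ , q) = z , z∈ , ≈-trans p q

elems≈ : {x y z : HF n} → x ≈ y → z ∈ₛ elems x → z ∈ₛ elems y
elems≈ {x = set xs} {set ys} p (w , w∈ , e) = ∈ₛ-resp e (set≈→ p w∈)
elems≈ {x = set xs} {atom a} (eqv ()) _

-- Tuples of atoms and their patterns

Tup : ℕ → ℕ → Set
Tup n m = Vec (Fin n) m

infixl 8 _⟨_⟩

opaque

  -- The entries of `θ` are positions in `α`. A `Tup m k` thus serves both as a tuple of atoms and
  -- as a map between contexts, and `⟨⟩-assoc` is associativity of composition.
  _⟨_⟩ : {A : Set} → Vec A m → Tup m k → Vec A k
  α ⟨ θ ⟩ = V.map (α !_) θ

  lookup-⟨⟩ : {A : Set} (α : Vec A m) (θ : Tup m k) (i : Fin k) →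
              (α ⟨ θ ⟩) ! i ≡ α ! (θ ! i)
  lookup-⟨⟩ α θ i = V.lookup-map i (α !_) θ

vec-ext : {A : Set} {α β : Vec A m} → (∀ i → α ! i ≡ β ! i) → α ≡ β
vec-ext {α = []}    {[]}    h = refl
vec-ext {α = a ∷ α} {b ∷ β} h = cong₂ _∷_ (h zero) (vec-ext (h ∘ suc))

⟨⟩-assoc : {A : Set} (α : Vec A m) (θ : Tup m k) (σ : Tup k l) → α ⟨ θ ⟨ σ ⟩ ⟩ ≡ α ⟨ θ ⟩ ⟨ σ ⟩
⟨⟩-assoc α θ σ = vec-ext λ i → begin
  (α ⟨ θ ⟨ σ ⟩ ⟩) ! i                ≡⟨ lookup-⟨⟩ α _ i ⟩
  α ! ((θ ⟨ σ ⟩) ! i)         ≡⟨ cong (α !_) (lookup-⟨⟩ θ σ i) ⟩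
  α ! (θ ! (σ ! i))    ≡⟨ lookup-⟨⟩ α θ _ ⟨
  (α ⟨ θ ⟩) ! (σ ! i)         ≡⟨ lookup-⟨⟩ (α ⟨ θ ⟩) σ i ⟨
  (α ⟨ θ ⟩ ⟨ σ ⟩) ! i                ∎
  where open ≡-Reasoning

idV : Tup m m
idV = V.tabulate id

lookup-tab : {A : Set} (f : Fin m → A) (i : Fin m) → (V.tabulate f) ! i ≡ f i
lookup-tab f zero    = refl
lookup-tab f (suc i) = lookup-tab (f ∘ suc) i

⟨id⟩ : {A : Set} (α : Vec A m) → α ⟨ idV ⟩ ≡ α
⟨id⟩ α = vec-ext λ i → trans (lookup-⟨⟩ α idV i) (cong (α !_) (lookup-tab id i))

id⟨⟩ : (θ : Tup m k) → idV ⟨ θ ⟩ ≡ θ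
id⟨⟩ θ = vec-ext λ i → trans (lookup-⟨⟩ idV θ i) (lookup-tab id _)

record Inj {n m : ℕ} (α : Tup n m) : Set where
  constructor mkInj
  field inj : ∀ i j → α ! i ≡ α ! j → i ≡ j
open Inj

Inj-⟨⟩ : {α : Tup n m} {θ : Tup m k} → Inj α → Inj θ → Inj (α ⟨ θ ⟩)
Inj-⟨⟩ {α = α} {θ} (mkInj p) (mkInj q) =
  mkInj λ i j e → q i j (p _ _ (trans (sym (lookup-⟨⟩ α θ i)) (trans e (lookup-⟨⟩ α θ j))))

Inj-id : Inj (idV {m})
Inj-id = mkInj λ i j e → trans (sym (lookup-tab id i)) (trans e (lookup-tab id j))

Inj-[] : {α : Tup n 0} → Inj α
Inj-[] = mkInj λ ()

Inj? : (α : Tup n m) → Dec (Inj α)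
Inj? α = map′ mkInj inj (F.all? λ i → F.all? λ j → (α ! i F.≟ α ! j) →-dec (i F.≟ j))

∷-Inj : {γ : Tup n m} {b : Fin n} → Inj γ → (∀ j → γ ! j ≢ b) → Inj (b ∷ γ)
∷-Inj iγ h = mkInj λ { zero zero _ → refl ; zero (suc j) e → ⊥-elim (h j (sym e))
                     ; (suc j) zero e → ⊥-elim (h j e) ; (suc i) (suc j) e → cong suc (inj iγ i j e) }

update-inj : {γ : Tup n m} (i : Fin m) {a : Fin n} → Inj γ → (∀ j → γ ! j ≢ a) → Inj (γ V.[ i ]≔ a)
update-inj {γ = γ} i {a} iγ a∉ = mkInj λ x y q → lem x y q (x F.≟ i) (y F.≟ i)
  where
  lem : ∀ x y → (γ V.[ i ]≔ a) ! x ≡ (γ V.[ i ]≔ a) ! y → Dec (x ≡ i) → Dec (y ≡ i) → x ≡ y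
  lem x y q (yes refl) (yes refl) = refl
  lem x y q (yes refl) (no y≢) = ⊥-elim (a∉ y
    (trans (sym (V.lookup∘updateAt′ y x y≢ γ)) (trans (sym q) (V.lookup∘updateAt x γ))))
  lem x y q (no x≢) (yes refl) = ⊥-elim (a∉ x
    (trans (sym (V.lookup∘updateAt′ x y x≢ γ)) (trans q (V.lookup∘updateAt y γ))))
  lem x y q (no x≢) (no y≢) = inj iγ x y
    (trans (sym (V.lookup∘updateAt′ x i x≢ γ)) (trans q (V.lookup∘updateAt′ y i y≢ γ)))

find : (γ : Tup n m) (a : Fin n) → (∃[ i ] γ ! i ≡ a) ⊎ (∀ i → γ ! i ≢ a)
find []      a = inj₂ λ ()
find (b ∷ γ) a with b F.≟ a | find γ a
... | yes e | _             = inj₁ (zero , e)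
... | no ¬e | inj₁ (i , e)  = inj₁ (suc i , e)
... | no ¬e | inj₂ h        = inj₂ λ { zero → ¬e ; (suc i) → h i }

-- If every atom occurred in `γ`, sending each to a position of it would inject `Fin n` into
-- `Fin m`.
fresh : (γ : Tup n m) → m < n → ∃[ a ] (∀ i → γ ! i ≢ a)
fresh {n} {m} γ m<n with F.any? (λ a → dec a)
  where
  dec : ∀ a → Dec (∀ i → γ ! i ≢ a)
  dec a with find γ a
  ... | inj₁ (i , e) = no λ h → h i e
  ... | inj₂ h       = yes h
... | yes r = r
... | no ¬r = ⊥-elim (F.<⇒≢ i<j (sames e))
  where
  ix : Fin n → Fin m
  ix a with find γ a
  ... | inj₁ (i , e) = i
  ... | inj₂ h       = ⊥-elim (¬r (a , h))
  ix-spec : ∀ a → γ ! (ix a) ≡ a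
  ix-spec a with find γ a
  ... | inj₁ (i , e) = e
  ... | inj₂ h       = ⊥-elim (¬r (a , h))
  php = F.pigeonhole m<n ix
  i<j = proj₁ (proj₂ (proj₂ php))
  e = proj₂ (proj₂ (proj₂ php))
  sames : ∀ {a b} → ix a ≡ ix b → a ≡ b
  sames {a} {b} e = trans (sym (ix-spec a)) (trans (cong (γ !_) e) (ix-spec b))

record Same {n n' m : ℕ} (γ : Tup n m) (γ' : Tup n' m) : Set where
  constructor mkSame
  field
    same→ : ∀ i j → γ ! i ≡ γ ! j → γ' ! i ≡ γ' ! j
    same← : ∀ i j → γ' ! i ≡ γ' ! j → γ ! i ≡ γ ! j
open Same

Same-sym : {γ : Tup n m} {γ' : Tup n' m} → Same γ γ' → Same γ' γ
Same-sym (mkSame f g) = mkSame g f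

Inj⇒Same : {γ : Tup n m} {γ' : Tup n' m} → Inj γ → Inj γ' → Same γ γ'
Inj⇒Same {γ = γ} {γ'} p q =
  mkSame (λ i j e → cong (γ' !_) (inj p i j e)) (λ i j e → cong (γ !_) (inj q i j e))

-- The forth step of the back-and-forth argument. An atom already on the board is answered by its
-- counterpart, a new one by a fresh atom; the size hypothesis guarantees that a fresh one is left
-- at every move.
extend : {γ : Tup n m} {γ' : Tup n' m} → Same γ γ' → (β : Tup n l) → l + m ≤ n' →
         ∃[ β' ] Same (β V.++ γ) (β' V.++ γ')
extend s [] _ = [] , s
extend {γ = γ} {γ'} s (b ∷ β) le with extend s β (≤-trans (n≤1+n _) le)
... | β' , s' with find (β V.++ γ) b
... | inj₁ (i , e) = (β' V.++ γ') ! i ∷ β' , mkSame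
  (λ { zero zero _ → refl
     ; zero (suc j) e' → same→ s' i j (trans e e')
     ; (suc j) zero e' → same→ s' j i (trans e' (sym e))
     ; (suc i) (suc j) → same→ s' i j })
  (λ { zero zero _ → refl
     ; zero (suc j) e' → trans (sym e) (same← s' i j e')
     ; (suc j) zero e' → trans (same← s' j i e') e
     ; (suc i) (suc j) → same← s' i j })
... | inj₂ h with fresh (β' V.++ γ') le
... | b' , h' = b' ∷ β' , mkSame
  (λ { zero zero _ → refl
     ; zero (suc j) e' → ⊥-elim (h j (sym e'))
     ; (suc j) zero e' → ⊥-elim (h j e')
     ; (suc i) (suc j) → same→ s' i j })
  (λ { zero zero _ → refl
     ; zero (suc j) e' → ⊥-elim (h' j (sym e'))
     ; (suc j) zero e' → ⊥-elim (h' j e')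
     ; (suc i) (suc j) → same← s' i j })

-- When `γ` and `γ'` have the same pattern, they define a partial bijection between two sets of
-- atoms, possibly of different size; linked tuples are those that correspond under it. Keeping `γ`
-- as a common board lets several tuples be compared at once.
record Linked {n n' m k : ℕ} (γ : Tup n m) (γ' : Tup n' m)
              (α : Tup n k) (α' : Tup n' k) : Set where
  constructor mkLinked
  field link : ∀ i → ∃[ j ] (α ! i ≡ γ ! j × α' ! i ≡ γ' ! j)
open Linked

module _ {γ : Tup n m} {γ' : Tup n' m} where

  Linked-sym : {α : Tup n k} {α' : Tup n' k} → Linked γ γ' α α' → Linked γ' γ α' α
  Linked-sym h = mkLinked λ i → let j , e , e' = link h i in j , e' , e

  Linked-self : Linked γ γ' γ γ'
  Linked-self = mkLinked λ i → i , refl , refl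

  Linked-⟨⟩ : {α : Tup n k} {α' : Tup n' k} → Linked γ γ' α α' → (θ : Tup k l) →
              Linked γ γ' (α ⟨ θ ⟩) (α' ⟨ θ ⟩)
  Linked-⟨⟩ {α = α} {α'} h θ = mkLinked λ i → let j , e , e' = link h (θ ! i) in
    j , trans (lookup-⟨⟩ α θ i) e , trans (lookup-⟨⟩ α' θ i) e'

  Linked-++ : {α : Tup n k} {α' : Tup n' k} {β : Tup n l} {β' : Tup n' l} →
              Linked γ γ' α α' → Linked γ γ' β β' → Linked γ γ' (α V.++ β) (α' V.++ β')
  Linked-++ {α = []}    {[]}     h g = g
  Linked-++ {α = a ∷ α} {a' ∷ α'} h g = mkLinked
    λ { zero → link h zero ; (suc i) → link (Linked-++ {α = α} {α'} (mkLinked (link h ∘ suc)) g) i }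

  Linked-ʳ : (β : Tup n l) (β' : Tup n' l) {α : Tup n k} {α' : Tup n' k} →
             Linked γ γ' α α' → Linked (β V.++ γ) (β' V.++ γ') α α'
  Linked-ʳ []      []        h = h
  Linked-ʳ (b ∷ β) (b' ∷ β') h =
    mkLinked λ i → let j , e , e' = link (Linked-ʳ β β' h) i in suc j , e , e'

  Linked-ˡ : (β : Tup n l) (β' : Tup n' l) → Linked (β V.++ γ) (β' V.++ γ') β β'
  Linked-ˡ []      []        = mkLinked λ ()
  Linked-ˡ (b ∷ β) (b' ∷ β') = mkLinked
    λ { zero → zero , refl , refl ; (suc i) → let j , e , e' = link (Linked-ˡ β β') i in suc j , e , e' }

  Linked-cross : Same γ γ' → {α : Tup n k} {α' : Tup n' k} {β : Tup n l} {β' : Tup n' l} →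
                 Linked γ γ' α α' → Linked γ γ' β β' →
                 ∀ i j → α ! i ≡ β ! j → α' ! i ≡ β' ! j
  Linked-cross s h g i j e = let a , p , p' = link h i ; b , q , q' = link g j in
    trans p' (trans (same→ s a b (trans (sym p) (trans e q))) (sym q'))

  Linked-≡ : Same γ γ' → {α β : Tup n k} {α' β' : Tup n' k} →
             Linked γ γ' α α' → Linked γ γ' β β' → α ≡ β → α' ≡ β'
  Linked-≡ s h g e = vec-ext λ i → Linked-cross s h g i i (cong (λ v → v ! i) e)

Linked-Same : {γ : Tup n m} {γ' : Tup n' m} {α : Tup n k} {α' : Tup n' k} →
              Same γ γ' → Linked γ γ' α α' → Same α α'
Linked-Same s h = mkSame (Linked-cross s h h) (Linked-cross (Same-sym s) (Linked-sym h) (Linked-sym h))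

Linked-Inj : {γ : Tup n m} {γ' : Tup n' m} {α : Tup n k} {α' : Tup n' k} →
             Same γ γ' → Linked γ γ' α α' → Inj α → Inj α'
Linked-Inj s h p = mkInj λ i j e → inj p i j (same← (Linked-Same s h) i j e)

Linked-++ˡ : {γ : Tup n m} {γ' : Tup n' m} {α : Tup n k} {α' : Tup n' k}
             {β : Tup n l} {β' : Tup n' l} →
             Linked γ γ' (α V.++ β) (α' V.++ β') → Linked γ γ' α α'
Linked-++ˡ {α = []} {[]} h = mkLinked λ ()
Linked-++ˡ {γ = γ} {γ'} {α = a ∷ α} {a' ∷ α'} h = mkLinked
  λ { zero → link h zero ; (suc i) → link (Linked-++ˡ {γ = γ} {γ'} {α = α} {α'} (mkLinked (link h ∘ suc))) i }

Linked-++ʳ : {γ : Tup n m} {γ' : Tup n' m} (α : Tup n k) (α' : Tup n' k)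
             {β : Tup n l} {β' : Tup n' l} →
             Linked γ γ' (α V.++ β) (α' V.++ β') → Linked γ γ' β β'
Linked-++ʳ []      []        h = h
Linked-++ʳ {γ = γ} {γ'} (a ∷ α) (a' ∷ α') h = Linked-++ʳ {γ = γ} {γ'} α α' (mkLinked (link h ∘ suc))

-- Symbolic sets

-- el κ x over a context α stands for all x read at an injective vector extending α along κ.
data El (X : ℕ → Set) (k : ℕ) : Set where
  el : ∀ {c} → Tup c k → X c → El X k

-- A closure keeps the selection `θ` outside a body with a context of its own, so renaming composes
-- with `θ` and never enters the elements.
data Form (m : ℕ) : Set where
  at  : Fin m → Form m
  clo : ∀ {k} → Tup m k → List (El Form k) → Form m

allVecs : (n c : ℕ) → List (Tup n c)
allVecs n zero    = [] ∷ []
allVecs n (suc c) = concatMap (λ a → map (a ∷_) (allVecs n c)) (allFin n)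

∈-allVecs : (β : Tup n c) → β ∈ allVecs n c
∈-allVecs []      = here refl
∈-allVecs (b ∷ β) = ∈-concat⁺′ (∈-map⁺ (b ∷_) (∈-allVecs β)) (∈-map⁺ _ (∈-allFin b))

ext? : (κ : Tup c k) (α : Tup n k) (β : Tup n c) → Dec (Inj β × β ⟨ κ ⟩ ≡ α)
ext? κ α β = Inj? β ×-dec V.≡-dec F._≟_ (β ⟨ κ ⟩) α

exts : Tup c k → Tup n k → List (Tup n c)
exts {c} {n = n} κ α = filter (ext? κ α) (allVecs n c)

mutual
  ⟦_⟧ : Form m → Tup n m → HF n
  ⟦ at i ⟧    α = atom (α ! i)
  ⟦ clo θ L ⟧ α = set (⟦ L ⟧* (α ⟨ θ ⟩))

  ⟦_⟧* : List (El Form k) → Tup n k → List (HF n)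
  ⟦ [] ⟧*           α = []
  ⟦ (el κ φ) ∷ L ⟧* α = map ⟦ φ ⟧ (exts κ α) ++ ⟦ L ⟧* α

-- Relational reading of the elements of a symbolic set, which keeps enumeration and filtering out
-- of the later arguments. It is generic in `X` because symbolic updates are instantiated in the
-- same way.
data Inst {X : ℕ → Set} {k n : ℕ} (L : List (El X k)) (α : Tup n k) {c : ℕ} :
          X c → Tup n c → Set where
  inst : ∀ {κ x β} → el κ x ∈ L → Inj β → β ⟨ κ ⟩ ≡ α → Inst L α x β

inst⁺ : {L : List (El Form k)} {α : Tup n k} {φ : Form c} {β : Tup n c} →
        Inst L α φ β → ⟦ φ ⟧ β ∈ ⟦ L ⟧* α
inst⁺ {L = el κ φ ∷ L} {α} {β = β} (inst (here refl) i e) =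
  ∈-++⁺ˡ (∈-map⁺ ⟦ φ ⟧ (∈-filter⁺ (ext? κ α) (∈-allVecs β) (i , e)))
inst⁺ {L = el κ φ ∷ L} (inst (there p) i e) = ∈-++⁺ʳ (map ⟦ φ ⟧ (exts κ _)) (inst⁺ (inst p i e))

inst⁻ : {L : List (El Form k)} {α : Tup n k} {x : HF n} → x ∈ ⟦ L ⟧* α →
        ∃[ c ] Σ (Form c) λ φ → ∃[ β ] (Inst L α φ β × x ≡ ⟦ φ ⟧ β)
inst⁻ {L = el {c} κ φ ∷ L} {α} x∈ with ∈-++⁻ (map ⟦ φ ⟧ (exts κ α)) x∈
... | inj₁ p = let β , β∈ , e = ∈-map⁻ ⟦ φ ⟧ p ; _ , i , e' = ∈-filter⁻ (ext? κ α) {xs = allVecs _ c} β∈ in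
  c , φ , β , inst (here refl) i e' , e
... | inj₂ p with inst⁻ p
... | c' , φ' , β , inst q i e , e' = c' , φ' , β , inst (there q) i e , e'

mutual
  Form-ind : (P : ∀ {m} → Form m → Set) → (∀ {m} (i : Fin m) → P (at i)) →
             (∀ {m k} (θ : Tup m k) L → (∀ {c κ} {φ : Form c} → el κ φ ∈ L → P φ) → P (clo θ L)) →
             (φ : Form m) → P φ
  Form-ind P f g (at i)    = f i
  Form-ind P f g (clo θ L) = g θ L (Form-ind* P f g L)

  Form-ind* : (P : ∀ {m} → Form m → Set) → (∀ {m} (i : Fin m) → P (at i)) →
              (∀ {m k} (θ : Tup m k) L → (∀ {c κ} {φ : Form c} → el κ φ ∈ L → P φ) → P (clo θ L)) →
              (L : List (El Form k)) → ∀ {c κ} {φ : Form c} → el κ φ ∈ L → P φ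
  Form-ind* P f g (el κ φ ∷ L) (here refl) = Form-ind P f g φ
  Form-ind* P f g (_ ∷ L)      (there p)   = Form-ind* P f g L p

ren : Tup m k → Form k → Form m
ren σ (at i)    = at (σ ! i)
ren σ (clo θ L) = clo (σ ⟨ θ ⟩) L

⟦ren⟧ : (σ : Tup m k) (φ : Form k) (α : Tup n m) → ⟦ ren σ φ ⟧ α ≡ ⟦ φ ⟧ (α ⟨ σ ⟩)
⟦ren⟧ σ (at i)    α = cong atom (sym (lookup-⟨⟩ α σ i))
⟦ren⟧ σ (clo θ L) α = cong (λ δ → set (⟦ L ⟧* δ)) (⟨⟩-assoc α σ θ)

-- Bounded forms and the transfer of equations

Good : {X : ℕ → Set} → ℕ → (∀ {c} → X c → Set) → List (El X k) → Set
Good b P L = ∀ {c κ x} → el {c = c} κ x ∈ L → c ≤ b × Inj κ × P x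

-- The bound concerns the closures and elements inside the form, not its own context `m`, whose size
-- is always bounded separately. Injective selections ensure that different positions name different
-- atoms.
data Nm (b : ℕ) {m : ℕ} : Form m → Set where
  at  : ∀ {i} → Nm b (at i)
  clo : ∀ {k} {θ : Tup m k} {L} → k ≤ b → Inj θ → Good b (Nm b) L → Nm b (clo θ L)

Nm-mono : ∀ {b b'} → b ≤ b' → (φ : Form m) → Nm b φ → Nm b' φ
Nm-mono {b = b} {b'} le = Form-ind (λ φ → Nm b φ → Nm b' φ) (λ _ _ → at)
  λ { θ L ih (clo k≤ i g) → clo (≤-trans k≤ le) i λ p → let c≤ , j , nm = g p in ≤-trans c≤ le , j , ih p nm }

Nm-ren : ∀ {b} {σ : Tup m k} {φ : Form k} → Inj σ → Nm b φ → Nm b (ren σ φ)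
Nm-ren i at            = at
Nm-ren i (clo k≤ j g) = clo k≤ (Inj-⟨⟩ i j) g

-- Four tuples of length at most `b` can be on the board of `game` at once: the contexts of the two
-- sets and one instance chosen from each.
quad : ℕ → ℕ
quad b = b + (b + (b + b))

-- Truth of equations depends only on the pattern of the contexts: a back-and-forth argument, in
-- which each atom chosen on one side is answered on the other, b being small against n and n'.
game : ∀ {b} → quad b ≤ n → quad b ≤ n' → {m₁ m₂ : ℕ} (φ : Form m₁) (ψ : Form m₂) → Nm b φ → Nm b ψ →
       {γ : Tup n m} {γ' : Tup n' m} → Same γ γ' →
       ∀ {α₁ α₁' α₂ α₂'} → Linked γ γ' α₁ α₁' → Linked γ γ' α₂ α₂' →
       ⟦ φ ⟧ α₁ ≈ ⟦ ψ ⟧ α₂ → ⟦ φ ⟧ α₁' ≈ ⟦ ψ ⟧ α₂'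
game {n} {n'} {b = b} hn hn' φ₀ ψ₀ nm₁ nm₂ s = Form-ind P atoms-case sets-case φ₀ ψ₀ nm₁ nm₂ s
  where
  P : ∀ {m₁} → Form m₁ → Set
  P {m₁} φ = ∀ {m₂} (ψ : Form m₂) → Nm b φ → Nm b ψ →
    ∀ {m} {γ : Tup n m} {γ' : Tup n' m} → Same γ γ' →
    ∀ {α₁ α₁' α₂ α₂'} → Linked γ γ' α₁ α₁' → Linked γ γ' α₂ α₂' →
    ⟦ φ ⟧ α₁ ≈ ⟦ ψ ⟧ α₂ → ⟦ φ ⟧ α₁' ≈ ⟦ ψ ⟧ α₂'
  atoms-case : ∀ {m₁} (i : Fin m₁) → P (at i)
  atoms-case i (at j) _ _ s h g e = ≡⇒≈ (cong atom (Linked-cross s h g i j (atom≈ e)))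
  atoms-case i (clo θ L) _ _ s h g (eqv ())
  -- An instance on the primed side is pulled back to the unprimed side, where the assumed inclusion
  -- supplies a matching instance; this one is pushed forward again, and the induction hypothesis
  -- transfers the equation along the enlarged pattern.
  half : ∀ {k₁ k₂} (L₁ : List (El Form k₁)) (L₂ : List (El Form k₂)) → k₁ ≤ b → k₂ ≤ b →
    Good b (Nm b) L₁ → Good b (Nm b) L₂ →
    (∀ {c₁ c₂ κ₁ κ₂} {φ₁ : Form c₁} {φ₂ : Form c₂} → el κ₁ φ₁ ∈ L₁ → el κ₂ φ₂ ∈ L₂ →
      ∀ {m} {γ : Tup n m} {γ' : Tup n' m} → Same γ γ' →
      ∀ {β₁ β₁' β₂ β₂'} → Linked γ γ' β₁ β₁' → Linked γ γ' β₂ β₂' →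
      ⟦ φ₁ ⟧ β₁ ≈ ⟦ φ₂ ⟧ β₂ → ⟦ φ₁ ⟧ β₁' ≈ ⟦ φ₂ ⟧ β₂') →
    ∀ {m} {γ : Tup n m} {γ' : Tup n' m} → Same γ γ' →
    ∀ {α₁ α₁' α₂ α₂'} → Linked γ γ' α₁ α₁' → Linked γ γ' α₂ α₂' →
    (∀ {x} → x ∈ ⟦ L₁ ⟧* α₁ → x ∈ₛ ⟦ L₂ ⟧* α₂) → ∀ {x} → x ∈ ⟦ L₁ ⟧* α₁' → x ∈ₛ ⟦ L₂ ⟧* α₂'
  half L₁ L₂ k₁≤ k₂≤ g₁ g₂ ih {γ = γ} {γ'} s {α₁} {α₁'} {α₂} {α₂'} l₁ l₂ sub x'∈ with inst⁻ x'∈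
  ... | c₁ , φ₁ , β₁' , inst p₁ i₁' e₁' , refl
    with extend (Linked-Same (Same-sym s) (Linked-sym (Linked-++ l₁ l₂))) β₁'
           (≤-trans (+-mono-≤ (proj₁ (g₁ p₁)) (≤-trans (+-mono-≤ k₁≤ k₂≤) (m≤n+m _ b))) hn)
  ... | β₁ , s₁ with sub (inst⁺ (inst p₁ (Linked-Inj s₁ (Linked-ˡ β₁' β₁) i₁')
                     (Linked-≡ s₁ (Linked-⟨⟩ (Linked-ˡ β₁' β₁) _)
                        (Linked-ʳ β₁' β₁ (Linked-++ˡ (Linked-self {γ = α₁' V.++ α₂'} {α₁ V.++ α₂}))) e₁')))
  ... | y , y∈ , e with inst⁻ y∈
  ... | c₂ , φ₂ , β₂ , inst p₂ i₂ e₂ , refl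
    with extend (Same-sym s₁) β₂ (≤-trans (+-mono-≤ (proj₁ (g₂ p₂)) (+-mono-≤ (proj₁ (g₁ p₁)) (+-mono-≤ k₁≤ k₂≤))) hn')
  ... | β₂' , s₂ =
    ⟦ φ₂ ⟧ β₂' , inst⁺ (inst p₂ (Linked-Inj s₂ (Linked-ˡ β₂ β₂') i₂)
                     (Linked-≡ s₂ (Linked-⟨⟩ (Linked-ˡ β₂ β₂') _)
                        (Linked-ʳ β₂ β₂' (Linked-ʳ β₁ β₁' (Linked-++ʳ α₁ α₁' Linked-self))) e₂)) ,
    ih p₁ p₂ s₂ (Linked-ʳ β₂ β₂' (Linked-ˡ β₁ β₁')) (Linked-ˡ β₂ β₂') e
  sets-case : ∀ {m k} (θ : Tup m k) L → (∀ {c κ} {φ : Form c} → el κ φ ∈ L → P φ) → P (clo θ L)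
  sets-case θ L ih (at j) _ _ s h g (eqv ())
  sets-case θ L ih (clo θ' L') (clo k≤ i nL) (clo k≤' i' nL') s h g e = set≈
    (half L L' k≤ k≤' nL nL'
      (λ {_} {_} {_} {_} {φ₁} {φ₂} p₁ p₂ s → ih p₁ φ₂ (proj₂ (proj₂ (nL p₁))) (proj₂ (proj₂ (nL' p₂))) s)
      s (Linked-⟨⟩ h θ) (Linked-⟨⟩ g θ') (set≈→ e))
    (half L' L k≤' k≤ nL' nL
      (λ {_} {_} {_} {_} {φ₁} {φ₂} p₁ p₂ s l₁ l₂ e →
        ≈-sym (ih p₂ φ₁ (proj₂ (proj₂ (nL p₂))) (proj₂ (proj₂ (nL' p₁))) s l₂ l₁ (≈-sym e)))
      s (Linked-⟨⟩ g θ') (Linked-⟨⟩ h θ) (set≈← e))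

-- Changing the context of a symbolic set

-- Extending the correspondence between `κ` and `α` by `idV` names all `c` positions: those in `κ`
-- receive the atoms of `α`, the others fresh atoms.
leaf : (κ : Tup c m) (α : Tup n m) → Inj κ → Inj α → c + m ≤ n →
       ∃[ β ] (Inj β × β ⟨ κ ⟩ ≡ α)
leaf κ α iκ iα le with extend (Inj⇒Same iκ iα) idV le
... | β , s = β , Linked-Inj s (Linked-ˡ idV β) Inj-id ,
  Linked-≡ s (Linked-⟨⟩ (Linked-ˡ idV β) κ) (Linked-ʳ idV β Linked-self) (id⟨⟩ κ)

opaque

  inrV : ∀ c m → Tup (c + m) m
  inrV c m = V.tabulate (c ↑ʳ_)

  Inj-inrV : Inj (inrV c m)
  Inj-inrV {c} = mkInj λ i j e → F.↑ʳ-injective c i j (trans (sym (lookup-tab _ i)) (trans e (lookup-tab _ j)))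

canon : m ≤ n → Tup n m
canon le = V.tabulate λ i → F.inject≤ i le

Inj-canon : (le : m ≤ n) → Inj (canon le)
Inj-canon le = mkInj λ i j e →
  F.inject≤-injective le le i j (trans (sym (lookup-tab _ i)) (trans e (lookup-tab _ j)))

module Context {X : ℕ → Set} (renX : ∀ {k m} → Tup m k → X k → X m) where

  data Expanded (L : List (El X k)) (θ : Tup m k) : El X m → Set where
    expanded : ∀ {c} {κ : Tup c k} {x : X c} {ι : Tup (c + m) c} → el κ x ∈ L → Inj ι →
               ι ⟨ κ ⟩ ≡ inrV c m ⟨ θ ⟩ → Expanded L θ (el (inrV c m) (renX ι x))

  opaque

    -- Over the larger context an instance may or may not use the atoms outside `θ`, and a symbolic
    -- element has to say which. So there is one element for each injective placement `ι` of the `c`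
    -- positions among `c + m`, the last `m` of which are the context.
    expandEl : Tup m k → El X k → List (El X m)
    expandEl {m} θ (el {c} κ x) = map (λ ι → el (inrV c m) (renX ι x)) (exts κ (inrV c m ⟨ θ ⟩))

    expand : Tup m k → List (El X k) → List (El X m)
    expand θ = concatMap (expandEl θ)

    ∈-expand⁻ : {θ : Tup m k} {L : List (El X k)} {A : El X m} → A ∈ expand θ L → Expanded L θ A
    ∈-expand⁻ {θ = θ} {L} p with ∈-concat⁻′ (map (expandEl θ) L) p
    ... | As , A∈ , As∈ with ∈-map⁻ (expandEl θ) As∈
    ... | el {c} κ x , B∈ , refl with ∈-map⁻ _ A∈
    ... | ι , ι∈ , refl = let _ , i , e = ∈-filter⁻ (ext? κ _) {xs = allVecs _ c} ι∈ in expanded B∈ i e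

    ∈-expand⁺ : {θ : Tup m k} {L : List (El X k)} {κ : Tup c k} {x : X c} {ι : Tup (c + m) c} →
                el κ x ∈ L → Inj ι → ι ⟨ κ ⟩ ≡ inrV c m ⟨ θ ⟩ → el (inrV c m) (renX ι x) ∈ expand θ L
    ∈-expand⁺ {θ = θ} {κ = κ} {ι = ι} p i e =
      ∈-concat⁺′ (∈-map⁺ _ (∈-filter⁺ (ext? κ _) (∈-allVecs ι) (i , e))) (∈-map⁺ (expandEl θ) p)

  expand⁻ : {θ : Tup m k} {L : List (El X k)} {α : Tup n m} {y : X c} {γ : Tup n c} →
            Inst (expand θ L) α y γ →
            Σ ℕ λ c' → Σ (X c') λ x → Σ (Tup c c') λ ι → Inst L (α ⟨ θ ⟩) x (γ ⟨ ι ⟩) × Inj ι × y ≡ renX ι x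
  expand⁻ {θ = θ} {γ = γ} (inst p i refl) with ∈-expand⁻ p
  ... | expanded {c} {κ} {x} {ι} q iι e = c , x , ι ,
    inst q (Inj-⟨⟩ i iι) (trans (sym (⟨⟩-assoc γ ι κ)) (trans (cong (γ ⟨_⟩) e) (⟨⟩-assoc γ _ θ))) , iι , refl

  expand⁺ : {θ : Tup m k} {L : List (El X k)} {α : Tup n m} {x : X c} {β : Tup n c} →
            Inj α → (c + m) + (c + m) ≤ n → Inst L (α ⟨ θ ⟩) x β →
            Σ (Tup (c + m) c) λ ι → Σ (Tup n (c + m)) λ γ →
              Inst (expand θ L) α (renX ι x) γ × γ ⟨ ι ⟩ ≡ β
  expand⁺ {m = m} {c = c} {θ = θ} {L} {α} {x} {β} iα le (inst {κ = κ} p i e)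
    -- The pattern of `β` beside `α` is copied into `Fin (c + m)`, which is just large enough, to
    -- find the placement `ι`. The second extension then assigns atoms to all `c + m` positions,
    -- used or not; it is what needs twice `c + m` atoms.
    with extend (Inj⇒Same iα (Inj-inrV {c})) β ≤-refl
  ... | ι , s with extend (Same-sym s) (idV {c + m}) le
  ... | γ , s' = ι , γ , inst (∈-expand⁺ p iι eι) (Linked-Inj s' (Linked-ˡ idV γ) Inj-id)
                   (Linked-≡ s' (Linked-⟨⟩ (Linked-ˡ idV γ) _) (Linked-ʳ idV γ (Linked-++ʳ ι β Linked-self)) (id⟨⟩ _)) ,
                   Linked-≡ s' (Linked-⟨⟩ (Linked-ˡ idV γ) _) (Linked-ʳ idV γ (Linked-++ˡ (Linked-self {γ = ι V.++ inrV c m} {β V.++ α}))) (id⟨⟩ _)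
    where
    iι = Linked-Inj s (Linked-ˡ β ι) i
    eι : ι ⟨ κ ⟩ ≡ inrV c m ⟨ θ ⟩
    eι = Linked-≡ s (Linked-⟨⟩ (Linked-ˡ β ι) κ) (Linked-ʳ β ι (Linked-⟨⟩ Linked-self θ)) e

  opaque

    -- Composing the selections quantifies the intermediate context away: the result collects the
    -- instances over all `β` that extend the given tuple along `κ`.
    graft : Tup c m → List (El X c) → List (El X m)
    graft κ = map λ { (el κ' x) → el (κ' ⟨ κ ⟩) x }

    ∈-graft⁻ : {κ : Tup c m} {L : List (El X c)} {κ'' : Tup l m} {x : X l} → el κ'' x ∈ graft κ L →
               Σ (Tup l c) λ κ' → el κ' x ∈ L × κ'' ≡ κ' ⟨ κ ⟩
    ∈-graft⁻ p with ∈-map⁻ _ p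
    ... | el κ' x , q , refl = κ' , q , refl

    ∈-graft⁺ : {κ : Tup c m} {L : List (El X c)} {κ' : Tup l c} {x : X l} → el κ' x ∈ L →
               el (κ' ⟨ κ ⟩) x ∈ graft κ L
    ∈-graft⁺ p = ∈-map⁺ _ p

  graft⁺ : {κ : Tup c m} {L : List (El X c)} {α : Tup n m} {β : Tup n c} →
           β ⟨ κ ⟩ ≡ α → ∀ {l} {x : X l} {γ} → Inst L β x γ → Inst (graft κ L) α x γ
  graft⁺ {κ = κ} refl {γ = γ} (inst p i refl) = inst (∈-graft⁺ p) i (⟨⟩-assoc γ _ κ)

  graft⁻ : ∀ {b} {P : ∀ {c} → X c → Set} {κ : Tup c m} {L : List (El X c)} {α : Tup n m} →
           Good b P L → ∀ {l} {x : X l} {γ} → Inst (graft κ L) α x γ →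
           ∃[ β ] (Inj β × β ⟨ κ ⟩ ≡ α × Inst L β x γ)
  graft⁻ {κ = κ} g {γ = γ} (inst p i refl) with ∈-graft⁻ p
  ... | κ' , q , refl = γ ⟨ κ' ⟩ , Inj-⟨⟩ i (proj₁ (proj₂ (g q))) , sym (⟨⟩-assoc γ κ' κ) , inst q i refl

  Good-graft : ∀ {b} {P : ∀ {c} → X c → Set} {κ : Tup c m} {L : List (El X c)} → Inj κ →
               Good b P L → Good b P (graft κ L)
  Good-graft i g p with ∈-graft⁻ p
  ... | κ' , q , refl = let c≤ , j , r = g q in c≤ , Inj-⟨⟩ j i , r

  Good-expand : ∀ {b} {P : ∀ {c} → X c → Set} → (∀ {c k} {σ : Tup c k} {x} → Inj σ → P x → P (renX σ x)) →
                {θ : Tup m k} {L : List (El X k)} → Good b P L → Good (b + m) P (expand θ L)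
  Good-expand {m = m} hP g p with ∈-expand⁻ p
  ... | expanded {c} q iι e = let c≤ , _ , r = g q in +-mono-≤ c≤ ≤-refl , Inj-inrV {c} , hP iι r

open Context {Form} ren public

Good-mono : ∀ {X : ℕ → Set} {b b'} {P Q : ∀ {c} → X c → Set} {L : List (El X k)} → b ≤ b' →
            (∀ {c} {x : X c} → P x → Q x) → Good b P L → Good b' Q L
Good-mono le f g p = let c≤ , i , r = g p in ≤-trans c≤ le , i , f r

⟦clo-id⟧ : (L : List (El Form m)) (α : Tup n m) → ⟦ clo idV L ⟧ α ≡ set (⟦ L ⟧* α)
⟦clo-id⟧ L α = cong (λ δ → set (⟦ L ⟧* δ)) (⟨id⟩ α)

Inst-++ˡ : {X : ℕ → Set} {L M : List (El X k)} {α : Tup n k} {x : X c} {β : Tup n c} →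
           Inst L α x β → Inst (L ++ M) α x β
Inst-++ˡ (inst p i e) = inst (∈-++⁺ˡ p) i e

Inst-++ʳ : {X : ℕ → Set} (L : List (El X k)) {M : List (El X k)} {α : Tup n k} {x : X c} {β : Tup n c} →
           Inst M α x β → Inst (L ++ M) α x β
Inst-++ʳ L (inst p i e) = inst (∈-++⁺ʳ L p) i e

Inst-++⁻ : {X : ℕ → Set} (L : List (El X k)) {M : List (El X k)} {α : Tup n k} {x : X c} {β : Tup n c} →
           Inst (L ++ M) α x β → Inst L α x β ⊎ Inst M α x β
Inst-++⁻ L (inst p i e) with ∈-++⁻ L p
... | inj₁ q = inj₁ (inst q i e)
... | inj₂ q = inj₂ (inst q i e)

Good-++ : ∀ {X : ℕ → Set} {b} {P : ∀ {c} → X c → Set} {L M : List (El X k)} → Good b P L → Good b P M → Good b P (L ++ M)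
Good-++ {L = L} g h p with ∈-++⁻ L p
... | inj₁ q = g q
... | inj₂ q = h q

∈-⋃⁻ : {xs : List (HF n)} {z : HF n} → z ∈ concatMap elems xs → ∃[ w ] (w ∈ xs × z ∈ elems w)
∈-⋃⁻ {xs = x ∷ xs} p with ∈-++⁻ (elems x) p
... | inj₁ q = x , here refl , q
... | inj₂ q = let w , w∈ , z∈ = ∈-⋃⁻ q in w , there w∈ , z∈

∈-⋃⁺ : {xs : List (HF n)} {w z : HF n} → w ∈ xs → z ∈ elems w → z ∈ concatMap elems xs
∈-⋃⁺ (here refl) q = ∈-++⁺ˡ q
∈-⋃⁺ {xs = x ∷ _} (there p) q = ∈-++⁺ʳ (elems x) (∈-⋃⁺ p q)

bigUnion-cong : {x y : HF n} → x ≈ y → set (concatMap elems (elems x)) ≈ set (concatMap elems (elems y))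
bigUnion-cong {n} p = set≈ (half p) (half (≈-sym p))
  where
  half : {x y : HF n} → x ≈ y → ∀ {z} → z ∈ concatMap elems (elems x) → z ∈ₛ concatMap elems (elems y)
  half {x} p z∈ =
    let w  , w∈  , z∈w = ∈-⋃⁻ {xs = elems x} z∈
        w' , w'∈ , e   = elems≈ p (∈⇒∈ₛ w∈)
        z' , z'∈ , e'  = elems≈ e (∈⇒∈ₛ z∈w)
    in z' , ∈-⋃⁺ w'∈ z'∈ , e'

-- Symbolic set operations

-- `K` bounds the forms that are compared, and from `N` atoms on the truth of such comparisons no
-- longer depends on the number of atoms.
module World (K N : ℕ) (hN : quad K ≤ N) (hK : suc K ≤ N) where

  K≤N : K ≤ N
  K≤N = ≤-trans (n≤1+n K) hK

  uni-eq : (φ ψ : Form m) → Nm K φ → Nm K ψ → N ≤ n → N ≤ n' → {α : Tup n m} {α' : Tup n' m} →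
           Inj α → Inj α' → eqHF (⟦ φ ⟧ α) (⟦ ψ ⟧ α) ≡ eqHF (⟦ φ ⟧ α') (⟦ ψ ⟧ α')
  uni-eq φ ψ p q hn hn' i i' = iff⇒≡
    (λ e → holds (game (≤-trans hN hn) (≤-trans hN hn') φ ψ p q (Inj⇒Same i i') Linked-self Linked-self (eqv e)))
    (λ e → holds (game (≤-trans hN hn') (≤-trans hN hn) φ ψ p q (Inj⇒Same i' i) Linked-self Linked-self (eqv e)))

  -- The common truth value is read off over `Fin N`, at the canonical tuple.
  eq-bool : m ≤ K → (φ ψ : Form m) → Nm K φ → Nm K ψ →
            Σ Bool λ b → ∀ {n} → N ≤ n → {α : Tup n m} → Inj α → eqHF (⟦ φ ⟧ α) (⟦ ψ ⟧ α) ≡ b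
  eq-bool m≤ φ ψ p q = _ , λ hn i → uni-eq φ ψ p q hn ≤-refl i (Inj-canon (≤-trans m≤ K≤N))

  module _ {θ : Tup m k} {L : List (El Form k)} where

    expand-∈⁻ : ∀ {n} {α : Tup n m} → Inj α → ∀ {c} {φ : Form c} {γ} → Inst (expand θ L) α φ γ →
                ⟦ φ ⟧ γ ∈ ⟦ L ⟧* (α ⟨ θ ⟩)
    expand-∈⁻ iα {γ = γ} p with expand⁻ p
    ... | c' , x , ι , q , _ , refl = subst (_∈ _) (sym (⟦ren⟧ ι x γ)) (inst⁺ q)

    expand-∈⁺ : ∀ {n} {α : Tup n m} → Inj α → (∀ {c κ} {φ : Form c} → el κ φ ∈ L → (c + m) + (c + m) ≤ n) →
                ∀ {x} → x ∈ ⟦ L ⟧* (α ⟨ θ ⟩) →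
                Σ ℕ λ c → Σ (Form c) λ φ → ∃[ γ ] (Inst (expand θ L) α φ γ × x ≡ ⟦ φ ⟧ γ)
    expand-∈⁺ iα le x∈ with inst⁻ x∈
    ... | c , φ , β , r@(inst p _ _) , refl with expand⁺ iα (le p) r
    ... | ι , γ , s , refl = _ , ren ι φ , γ , s , sym (⟦ren⟧ ι φ γ)

  double : ∀ {b} → b + b ≤ K → ∀ {c m n} → N ≤ n → c ≤ b → m ≤ b → (c + m) + (c + m) ≤ n
  double h hn c≤ m≤ = ≤-trans (+-mono-≤ c+m≤ c+m≤)
    (≤-trans (+-mono-≤ ≤-refl (m≤m+n K (K + K))) (≤-trans hN hn))
    where c+m≤ = ≤-trans (+-mono-≤ c≤ m≤) h

-- Duplicates and the value of `unique`

data Distinct {n : ℕ} : List (HF n) → Set where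
  []  : Distinct []
  _∷_ : ∀ {x xs} → (∀ {y} → y ∈ xs → ¬ x ≈ y) → Distinct xs → Distinct (x ∷ xs)

dedup⊆ : {xs : List (HF n)} {y : HF n} → y ∈ dedup xs → y ∈ xs
dedup⊆ {xs = x ∷ xs} p with memHF x xs
dedup⊆ {xs = x ∷ xs} p           | true  = there (dedup⊆ p)
dedup⊆ {xs = x ∷ xs} (here refl) | false = here refl
dedup⊆ {xs = x ∷ xs} (there p)   | false = there (dedup⊆ p)

dedup⊇ : {xs : List (HF n)} {y : HF n} → y ∈ xs → y ∈ₛ dedup xs
dedup⊇ {xs = x ∷ xs} p with memHF x xs in e
dedup⊇ {xs = x ∷ xs} (there p)   | true  = dedup⊇ p
dedup⊇ {xs = x ∷ xs} (here refl) | true  =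
  let z , z∈ , x≈z = mem⇒∈ₛ {ys = xs} e in ∈ₛ-resp x≈z (dedup⊇ {xs = xs} z∈)
dedup⊇ {xs = x ∷ xs} (here refl) | false = ∈⇒∈ₛ (here refl)
dedup⊇ {xs = x ∷ xs} (there p)   | false = let z , z∈ , q = dedup⊇ p in z , there z∈ , q

dedup-distinct : (xs : List (HF n)) → Distinct (dedup xs)
dedup-distinct []       = []
dedup-distinct (x ∷ xs) with memHF x xs in e
... | true  = dedup-distinct xs
... | false = (λ y∈ x≈y → false≢true e (∈ₛ⇒mem {ys = xs} (_ , dedup⊆ y∈ , x≈y))) ∷ dedup-distinct xs

module _ (S : Sig) {n : ℕ} (E : Fin n → Fin n → Bool) (st : State S n) where

  open Eval S E st using (unique)

  unique-single : {xs : List (HF n)} {x : HF n} → set xs ≈ set (x ∷ []) → unique xs ≈ x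
  unique-single {xs} {x} p with dedup xs in e
  ... | [] = let z , z∈ , _ = set≈← p (here refl)
                 w , w∈ , _ = dedup⊇ z∈ in case subst (w ∈_) e w∈ of λ ()
  ... | z ∷ [] with set≈→ p (dedup⊆ (subst (z ∈_) (sym e) (here refl)))
  ... | _ , here refl , q = q
  unique-single {xs} {x} p | z ∷ w ∷ zs
    with subst Distinct e (dedup-distinct xs)
       | set≈→ p (dedup⊆ (subst (z ∈_) (sym e) (here refl)))
       | set≈→ p (dedup⊆ (subst (w ∈_) (sym e) (there (here refl))))
  ... | d ∷ _ | _ , here refl , q | _ , here refl , r = ⊥-elim (d (here refl) (≈-trans q (≈-sym r)))

  unique-none : {xs : List (HF n)} → (∀ x → ¬ set xs ≈ set (x ∷ [])) → unique xs ≡ emptyS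
  unique-none {xs} h with dedup xs in e
  ... | []         = refl
  ... | x ∷ []     = ⊥-elim (h x (set≈ (λ p → subst (_ ∈ₛ_) e (dedup⊇ p))
                       λ { (here refl) → ∈⇒∈ₛ (dedup⊆ (subst (x ∈_) (sym e) (here refl))) }))
  ... | _ ∷ _ ∷ _  = refl

els : Form m → List (El Form m)
els (at i)    = []
els (clo θ L) = expand θ L

coll : List (El Form m) → Form m
coll = clo idV

coll⁺ : (M : List (El Form m)) {α : Tup n m} {φ : Form c} {β : Tup n c} →
        Inst M α φ β → ⟦ φ ⟧ β ∈ elems (⟦ coll M ⟧ α)
coll⁺ M {α} p = subst (_ ∈_) (sym (cong elems (⟦clo-id⟧ M α))) (inst⁺ p)

coll⁻ : (M : List (El Form m)) {α : Tup n m} {x : HF n} → x ∈ elems (⟦ coll M ⟧ α) →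
        ∃[ c ] Σ (Form c) λ φ → ∃[ β ] (Inst M α φ β × x ≡ ⟦ φ ⟧ β)
coll⁻ M {α} p = inst⁻ (subst (_ ∈_) (cong elems (⟦clo-id⟧ M α)) p)

∈ₛ-single : {x y : HF n} → x ∈ₛ (y ∷ []) → x ≈ y
∈ₛ-single (_ , here refl , q) = q

single-cong : {x y : HF n} → x ≈ y → set (x ∷ []) ≈ set (y ∷ [])
single-cong q = set≈ (λ { (here refl) → _ , here refl , q }) (λ { (here refl) → _ , here refl , ≈-sym q })

≤quad : ∀ b → b ≤ quad b
≤quad b = m≤m+n b _

2≤quad : ∀ b → b + b ≤ quad b
2≤quad b = +-mono-≤ (≤-refl {b}) (m≤m+n b _)

Good-els : ∀ {b} {φ : Form m} → Nm b φ → Good (b + m) (Nm b) (els φ)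
Good-els at              = λ ()
Good-els (clo _ _ g) = Good-expand Nm-ren g

Nm-coll : ∀ {b b'} {M : List (El Form m)} → m ≤ b → b' ≤ b → Good b (Nm b') M → Nm b (coll M)
Nm-coll m≤ b'≤ g = clo m≤ Inj-id (Good-mono ≤-refl (Nm-mono b'≤ _) g)

flat : List (El Form m) → List (El Form m)
flat []             = []
flat (el κ ψ ∷ M) = graft κ (els ψ) ++ flat M

∈-flat⁻ : {M : List (El Form m)} {κ : Tup c m} {χ : Form c} → el κ χ ∈ flat M →
          Σ ℕ λ d → Σ (Tup d m) λ κ' → Σ (Form d) λ ψ → el κ' ψ ∈ M × el κ χ ∈ graft κ' (els ψ)
∈-flat⁻ {M = el κ' ψ ∷ M} p with ∈-++⁻ (graft κ' (els ψ)) p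
... | inj₁ q = _ , κ' , ψ , here refl , q
... | inj₂ q with ∈-flat⁻ q
... | d , κ'' , ψ' , r , s = d , κ'' , ψ' , there r , s

∈-flat⁺ : {M : List (El Form m)} {A : El Form m} {κ : Tup c m} {ψ : Form c} → el κ ψ ∈ M →
          A ∈ graft κ (els ψ) → A ∈ flat M
∈-flat⁺ (here refl) q = ∈-++⁺ˡ q
∈-flat⁺ {M = el κ' ψ' ∷ M} (there p) q = ∈-++⁺ʳ (graft κ' (els ψ')) (∈-flat⁺ p q)

module Ops (K N : ℕ) (hN : quad K ≤ N) (hK : suc K ≤ N) where

  open World K N hN hK public

  els⁻ : {φ : Form m} {α : Tup n m} → Inj α → {ψ : Form c} {γ : Tup n c} → Inst (els φ) α ψ γ →
         ⟦ ψ ⟧ γ ∈ elems (⟦ φ ⟧ α)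
  els⁻ {φ = at i} iα (inst () _ _)
  els⁻ {φ = clo θ L} iα p = expand-∈⁻ iα p

  els⁺ : ∀ {b b'} → b + b ≤ K → N ≤ n → m ≤ b → {φ : Form m} → Nm b' φ → b' ≤ b → {α : Tup n m} → Inj α →
         ∀ {x} → x ∈ elems (⟦ φ ⟧ α) →
         Σ ℕ λ c → Σ (Form c) λ ψ → ∃[ γ ] (Inst (els φ) α ψ γ × x ≡ ⟦ ψ ⟧ γ)
  els⁺ h hn m≤ (clo k≤ iθ g) b'≤ iα x∈ =
    expand-∈⁺ iα (λ p → double h hn (≤-trans (proj₁ (g p)) b'≤) m≤) x∈

  leafK : ∀ {b} → b + b ≤ K → N ≤ n → c ≤ b → m ≤ b → (κ : Tup c m) (α : Tup n m) → Inj κ → Inj α →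
          ∃[ β ] (Inj β × β ⟨ κ ⟩ ≡ α)
  leafK h hn c≤ m≤ κ α iκ iα = leaf κ α iκ iα
    (≤-trans (+-mono-≤ c≤ m≤) (≤-trans h (≤-trans (≤quad K) (≤-trans hN hn))))

  module _ {m b : ℕ} (hb : quad b ≤ K) (m≤ : m ≤ b) where

    private
      2b≤K : b + b ≤ K
      2b≤K = ≤-trans (2≤quad b) hb

      4b≤K : (b + b) + (b + b) ≤ K
      4b≤K = ≤-trans (≤-reflexive (+-assoc b b (b + b))) hb

      b≤K : b ≤ K
      b≤K = ≤-trans (≤quad b) hb

      b≤2b : b ≤ b + b
      b≤2b = m≤m+n b b

      els-bound : ∀ {φ : Form m} → Nm b φ → Good (b + b) (Nm b) (els φ)
      els-bound p = Good-mono (+-mono-≤ ≤-refl m≤) id (Good-els p)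

      graft-bound : ∀ {c} {κ : Tup c m} {ψ : Form c} → Inj κ → c ≤ b + b → Nm b ψ →
                    Good (quad b) (Nm b) (graft κ (els ψ))
      graft-bound iκ c≤ p = Good-graft iκ (Good-mono (+-mono-≤ ≤-refl (≤-trans c≤ (+-mono-≤ ≤-refl b≤2b))) id (Good-els p))

    -- Elements of `φ` live in contexts of at most `2b` positions, and their elements in contexts of
    -- at most `3b`, which `quad b` covers.
    bigUnion-form : (φ : Form m) → Nm b φ → Σ (Form m) λ ψ → Nm (quad b) ψ × (∀ {n} → N ≤ n →
      {α : Tup n m} → Inj α → set (concatMap elems (elems (⟦ φ ⟧ α))) ≈ ⟦ ψ ⟧ α)
    bigUnion-form φ p = coll (flat (els φ)) ,
      Nm-coll (≤-trans m≤ (≤quad b)) (≤quad b) good ,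
      λ hn iα → set≈ (to hn iα) (from hn iα)
      where
      good : Good (quad b) (Nm b) (flat (els φ))
      good q with ∈-flat⁻ q
      ... | d , κ , ψ , r , s = let c≤ , iκ , nm = els-bound p r in graft-bound iκ c≤ nm s
      to : ∀ {n} → N ≤ n → {α : Tup n m} → Inj α → ∀ {x} → x ∈ concatMap elems (elems (⟦ φ ⟧ α)) →
           x ∈ₛ elems (⟦ coll (flat (els φ)) ⟧ α)
      to hn iα x∈ with ∈-⋃⁻ {xs = elems (⟦ φ ⟧ _)} x∈
      ... | w , w∈ , x∈w with els⁺ 2b≤K hn m≤ p ≤-refl iα w∈
      ... | c , ψ , γ , inst q iγ e , refl
        with els⁺ 4b≤K hn (proj₁ (els-bound p q)) (proj₂ (proj₂ (els-bound p q))) b≤2b iγ x∈w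
      ... | c' , χ , δ , r , refl with graft⁺ e r
      ... | inst s i e' = ∈⇒∈ₛ (coll⁺ (flat (els φ)) (inst (∈-flat⁺ q s) i e'))
      from : ∀ {n} → N ≤ n → {α : Tup n m} → Inj α → ∀ {x} → x ∈ elems (⟦ coll (flat (els φ)) ⟧ α) →
             x ∈ₛ concatMap elems (elems (⟦ φ ⟧ α))
      from hn iα x∈ with coll⁻ (flat (els φ)) x∈
      ... | c , χ , δ , inst q iδ e , refl with ∈-flat⁻ q
      ... | d , κ' , ψ , r , s
        with graft⁻ {L = els ψ} (Good-els (proj₂ (proj₂ (els-bound p r)))) (inst s iδ e)
      ... | γ , iγ , e' , t = ∈⇒∈ₛ (∈-⋃⁺ (els⁻ {φ = φ} iα (inst r iγ e')) (els⁻ {φ = ψ} iγ t))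

    -- An element none of whose instances depends on the extra atoms has a form in the smaller context:
    -- for sets, the union of the instances.
    unbind : ∀ {c} (κ : Tup c m) → Inj κ → c ≤ b + b → (ψ : Form c) → Nm b ψ →
      (∀ {n} → N ≤ n → {α : Tup n m} → Inj α → ∀ {β β'} → Inj β → Inj β' → β ⟨ κ ⟩ ≡ α → β' ⟨ κ ⟩ ≡ α →
        ⟦ ψ ⟧ β ≈ ⟦ ψ ⟧ β') →
      Σ (Form m) λ φ → Nm (quad b) φ × (∀ {n} → N ≤ n → {α : Tup n m} → Inj α →
        ∀ {β} → Inj β → β ⟨ κ ⟩ ≡ α → ⟦ φ ⟧ α ≈ ⟦ ψ ⟧ β)
    unbind {c} κ iκ c≤ (at i) p const with find κ i
    ... | inj₁ (j , refl) = at j , at , λ { hn iα {β} iβ refl → ≡⇒≈ (cong atom (lookup-⟨⟩ β κ j)) }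
    -- The atom lies outside `κ`, so moving position `i` to a fresh atom changes the value but not
    -- the restriction to `κ`, against `const`.
    ... | inj₂ i∉κ with leafK 4b≤K (≤-refl {N}) c≤ (≤-trans m≤ b≤2b) κ _ iκ (Inj-canon (≤-trans m≤ (≤-trans b≤K K≤N)))
    ... | β , iβ , e with fresh β (≤-trans (s≤s (≤-trans c≤ 2b≤K)) hK)
    ... | a , a∉β = ⊥-elim (a∉β i (trans (atom≈ (const ≤-refl (Inj-canon (≤-trans m≤ (≤-trans b≤K K≤N))) iβ iβ' e e')) (V.lookup∘updateAt i β)))
      where
      β' = β V.[ i ]≔ a
      iβ' = update-inj i iβ a∉β
      e' : β' ⟨ κ ⟩ ≡ canon (≤-trans m≤ (≤-trans b≤K K≤N))
      e' = trans (vec-ext λ j → trans (lookup-⟨⟩ β' κ j)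
             (trans (V.lookup∘updateAt′ _ i (i∉κ j) β) (sym (lookup-⟨⟩ β κ j)))) e
    unbind κ iκ c≤ ψ@(clo θ L) p const = coll (graft κ (els ψ)) ,
      Nm-coll (≤-trans m≤ (≤quad b)) (≤quad b) (graft-bound iκ c≤ p) ,
      λ {n} hn {α} iα {β} iβ e → set≈
        (λ x∈ → to hn iα iβ e x∈)
        (λ x∈ → let c' , χ , γ , q , e' = els⁺ 4b≤K hn c≤ p b≤2b iβ x∈ in
                 subst (_∈ₛ _) (sym e') (∈⇒∈ₛ (coll⁺ (graft κ (els ψ)) (graft⁺ e q))))
      where
      to : ∀ {n} → N ≤ n → {α : Tup n m} → Inj α → ∀ {β} → Inj β → β ⟨ κ ⟩ ≡ α →
           ∀ {x} → x ∈ elems (⟦ coll (graft κ (els ψ)) ⟧ α) → x ∈ₛ elems (⟦ ψ ⟧ β)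
      to hn iα iβ e x∈ with coll⁻ (graft κ (els ψ)) x∈
      ... | c' , χ , γ , q , refl with graft⁻ {L = els ψ} (Good-els p) q
      ... | β' , iβ' , e' , r = elems≈ (const hn iα iβ' iβ e' e) (∈⇒∈ₛ (els⁻ {φ = ψ} iβ' r))

    -- A singleton must consist of the value of any instance of the first listed element, so only
    -- this candidate is tested. A positive test also shows that all instances of the candidate over
    -- one context agree, and `unbind` then gives a form in that context; otherwise the value is the
    -- default `emptyS`.
    unique-form : (S : Sig) (φ : Form m) → Nm b φ → Σ (Form m) λ ψ → Nm (quad b) ψ × (∀ {n} → N ≤ n →
      ∀ E st {α : Tup n m} → Inj α → ∀ {x} → x ≈ ⟦ φ ⟧ α → Eval.unique S E st (elems x) ≈ ⟦ ψ ⟧ α)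
    unique-form S φ p = go (els φ) refl
      where
      set-elems≈ : ∀ {n} {x y : HF n} → x ≈ y → set (elems x) ≈ set (elems y)
      set-elems≈ q = set≈ (λ z∈ → elems≈ q (∈⇒∈ₛ z∈)) (λ z∈ → elems≈ (≈-sym q) (∈⇒∈ₛ z∈))
      Result = Σ (Form m) λ ψ → Nm (quad b) ψ × (∀ {n} → N ≤ n →
        ∀ E st {α : Tup n m} → Inj α → ∀ {x} → x ≈ ⟦ φ ⟧ α → Eval.unique S E st (elems x) ≈ ⟦ ψ ⟧ α)
      none : (∀ {n} → N ≤ n → {α : Tup n m} → Inj α → ∀ x → ¬ set (elems (⟦ φ ⟧ α)) ≈ set (x ∷ [])) → Result
      none h = clo [] [] , clo z≤n Inj-[] (λ ()) , λ hn E st iα q →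
        ≡⇒≈ (unique-none S E st λ x r → h hn iα x (≈-trans (set-elems≈ (≈-sym q)) r))
      no-inst : ∀ {n c} {α : Tup n m} {χ : Form c} {β} {A : Set} → els φ ≡ [] → Inst (els φ) α χ β → A
      no-inst e (inst p _ _) = case subst (_ ∈_) e p of λ ()
      go : ∀ M → els φ ≡ M → Result
      go [] e = none λ {n} hn {α} iα x r →
        let y , y∈ , _ = set≈← {ys = x ∷ []} r (here refl)
            _ , _ , _ , i , _ = els⁺ 2b≤K hn m≤ p ≤-refl iα y∈
        in no-inst e i
      go (el {c} κ ψ ∷ M) e = cases _ (proj₂ test)
        where
        A∈ : el κ ψ ∈ els φ
        A∈ = subst (el κ ψ ∈_) (sym e) (here refl)
        c≤ = proj₁ (els-bound p A∈)
        iκ = proj₁ (proj₂ (els-bound p A∈))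
        nψ = proj₂ (proj₂ (els-bound p A∈))
        one : List (El Form c)
        one = el idV ψ ∷ []
        one≈ : ∀ {n} {β : Tup n c} → Inj β → ⟦ coll one ⟧ β ≈ set (⟦ ψ ⟧ β ∷ [])
        one≈ {β = β} iβ = set≈
          (λ x∈ → case coll⁻ one x∈ of λ { (_ , _ , γ , inst (here refl) _ e , refl) →
             subst (λ δ → ⟦ ψ ⟧ γ ∈ₛ (⟦ ψ ⟧ δ ∷ [])) (trans (sym (⟨id⟩ γ)) e) (∈⇒∈ₛ (here refl)) })
          (λ { (here refl) → ∈⇒∈ₛ (coll⁺ one (inst (here refl) iβ (⟨id⟩ β))) })
        test = eq-bool (≤-trans c≤ 2b≤K) (coll (els (ren κ φ))) (coll one)
          (Nm-coll (≤-trans c≤ 2b≤K) (b≤K)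
             (Good-mono (≤-trans (+-mono-≤ b≤2b c≤) 4b≤K) id (Good-els (Nm-ren iκ p))))
          (Nm-coll (≤-trans c≤ 2b≤K) b≤K λ { (here refl) → ≤-trans c≤ 2b≤K , Inj-id , nψ })
        φ≈ : ∀ {n} → N ≤ n → {β : Tup n c} → Inj β →
             ⟦ coll (els (ren κ φ)) ⟧ β ≈ set (elems (⟦ φ ⟧ (β ⟨ κ ⟩)))
        φ≈ hn {β} iβ = set≈
          (λ x∈ → case coll⁻ (els (ren κ φ)) x∈ of λ { (_ , _ , γ , q , refl) →
             elems≈ (≡⇒≈ (⟦ren⟧ κ φ β)) (∈⇒∈ₛ (els⁻ {φ = ren κ φ} iβ q)) })
          (λ x∈ → case els⁺ 4b≤K hn c≤ (Nm-ren iκ p) b≤2b iβ (subst (λ z → _ ∈ elems z) (sym (⟦ren⟧ κ φ β)) x∈) of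
             λ { (_ , _ , γ , q , refl) → ∈⇒∈ₛ (coll⁺ (els (ren κ φ)) q) })
        cases : ∀ t → (∀ {n} → N ≤ n → {β : Tup n c} → Inj β →
                       eqHF (⟦ coll (els (ren κ φ)) ⟧ β) (⟦ coll one ⟧ β) ≡ t) → Result
        cases true h =
          let ψ' , nm , spec = unbind κ iκ c≤ ψ nψ λ hn _ iβ iβ' e e' →
                ∈ₛ-single (set≈→ (≈-trans (≈-sym (single hn iβ e)) (single hn iβ' e')) (here refl))
          in ψ' , nm , λ {n} hn E st {α} iα q →
               let β , iβ , e' = leafK 4b≤K hn c≤ (≤-trans m≤ b≤2b) κ α iκ iα in
               ≈-trans (unique-single S E st (≈-trans (set-elems≈ q) (single hn iβ e'))) (≈-sym (spec hn iα iβ e'))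
          where
          single : ∀ {n} → N ≤ n → {α : Tup n m} {β : Tup n c} → Inj β → β ⟨ κ ⟩ ≡ α →
                   set (elems (⟦ φ ⟧ α)) ≈ set (⟦ ψ ⟧ β ∷ [])
          single hn iβ refl = ≈-trans (≈-sym (φ≈ hn iβ)) (≈-trans (eqv (h hn iβ)) (one≈ iβ))
        cases false h = none λ {n} hn {α} iα x r →
          case leafK 4b≤K hn c≤ (≤-trans m≤ b≤2b) κ α iκ iα of λ { (β , iβ , refl) →
            let q = ∈ₛ-single (set≈→ r (els⁻ {φ = φ} iα (inst A∈ iβ refl))) in
              false≢true (h hn iβ) (holds (≈-trans (φ≈ hn iβ) (≈-trans r (≈-trans (single-cong (≈-sym q)) (≈-sym (one≈ iβ)))))) }

    -- Membership becomes an equation, to which `eq-bool` applies: x ∈ Y exactly when {x} ∪ Y = Y.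
    mem-bool : (φ ψ : Form m) → Nm b φ → Nm b ψ →
      Σ Bool λ t → ∀ {n} → N ≤ n → {α : Tup n m} → Inj α → memHF (⟦ φ ⟧ α) (elems (⟦ ψ ⟧ α)) ≡ t
    mem-bool φ ψ p q = proj₁ test , λ hn iα → trans (iff⇒≡ (to hn iα) (from hn iα)) (proj₂ test hn iα)
      where
      goodψ : Good K (Nm b) (els ψ)
      goodψ = Good-mono 2b≤K id (els-bound q)
      m≤K = ≤-trans m≤ b≤K
      test = eq-bool m≤K (coll (el idV φ ∷ els ψ)) (coll (els ψ))
        (Nm-coll m≤K b≤K λ { (here refl) → m≤K , Inj-id , p ; (there r) → goodψ r }) (Nm-coll m≤K b≤K goodψ)
      to : ∀ {n} → N ≤ n → {α : Tup n m} → Inj α → memHF (⟦ φ ⟧ α) (elems (⟦ ψ ⟧ α)) ≡ true →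
           eqHF (⟦ coll (el idV φ ∷ els ψ) ⟧ α) (⟦ coll (els ψ) ⟧ α) ≡ true
      to hn {α} iα e = holds (set≈ {xs = elems (⟦ coll (el idV φ ∷ els ψ) ⟧ α)} {ys = elems (⟦ coll (els ψ) ⟧ α)}
        (λ x∈ → case coll⁻ (el idV φ ∷ els ψ) x∈ of λ
          { (_ , _ , γ , inst (here refl) _ e' , refl) →
              let y , y∈ , r = mem⇒∈ₛ e
                  _ , _ , δ , s , e'' = els⁺ 2b≤K hn m≤ q ≤-refl iα y∈
              in _ , coll⁺ (els ψ) s , subst (λ δ' → ⟦ φ ⟧ δ' ≈ _) (trans (sym e') (⟨id⟩ γ)) (≈-trans r (≡⇒≈ e''))
          ; (_ , _ , γ , inst (there r) i e' , refl) → ∈⇒∈ₛ (coll⁺ (els ψ) (inst r i e')) })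
        (λ x∈ → case coll⁻ (els ψ) x∈ of λ { (_ , _ , γ , inst r i e' , refl) → ∈⇒∈ₛ (coll⁺ (el idV φ ∷ els ψ) (inst (there r) i e')) }))
      from : ∀ {n} → N ≤ n → {α : Tup n m} → Inj α →
             eqHF (⟦ coll (el idV φ ∷ els ψ) ⟧ α) (⟦ coll (els ψ) ⟧ α) ≡ true →
             memHF (⟦ φ ⟧ α) (elems (⟦ ψ ⟧ α)) ≡ true
      from hn {α} iα e =
        let y , y∈ , r = set≈→ {xs = elems (⟦ coll (el idV φ ∷ els ψ) ⟧ α)} {ys = elems (⟦ coll (els ψ) ⟧ α)} (eqv e) (coll⁺ (el idV φ ∷ els ψ) (inst (here refl) iα (⟨id⟩ α)))
            _ , _ , δ , s , e' = coll⁻ (els ψ) y∈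
        in ∈ₛ⇒mem (_ , els⁻ {φ = ψ} iα s , ≈-trans r (≡⇒≈ e'))

-- Locations and symbolic updates

infix 4 _≈ᵃ_ _≈ˡ_

record _≈ᵃ_ {n : ℕ} (xs ys : List (HF n)) : Set where
  constructor eqvᵃ
  field holdsᵃ : eqArgs xs ys ≡ true
open _≈ᵃ_

record _≈ˡ_ {k n : ℕ} (l l' : LocK k n) : Set where
  constructor eqvˡ
  field holdsˡ : eqLoc l l' ≡ true
open _≈ˡ_

∷≈ᵃ : {x y : HF n} {xs ys : List (HF n)} → x ≈ y → xs ≈ᵃ ys → (x ∷ xs) ≈ᵃ (y ∷ ys)
∷≈ᵃ (eqv p) (eqvᵃ q) = eqvᵃ (true-∧ p q)

≈ᵃ∷ : {x y : HF n} {xs ys : List (HF n)} → (x ∷ xs) ≈ᵃ (y ∷ ys) → x ≈ y × xs ≈ᵃ ys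
≈ᵃ∷ {x = x} {y} (eqvᵃ p) = let q , r = ∧-true {eqHF x y} p in eqv q , eqvᵃ r

≈ᵃ-refl : (xs : List (HF n)) → xs ≈ᵃ xs
≈ᵃ-refl []       = eqvᵃ refl
≈ᵃ-refl (x ∷ xs) = ∷≈ᵃ (≈-refl x) (≈ᵃ-refl xs)

≈ᵃ-sym : {xs ys : List (HF n)} → xs ≈ᵃ ys → ys ≈ᵃ xs
≈ᵃ-sym {xs = []}     {[]}     p = p
≈ᵃ-sym {xs = []}     {_ ∷ _}  (eqvᵃ ())
≈ᵃ-sym {xs = _ ∷ _}  {[]}     (eqvᵃ ())
≈ᵃ-sym {xs = x ∷ xs} {y ∷ ys} p = let q , r = ≈ᵃ∷ p in ∷≈ᵃ (≈-sym q) (≈ᵃ-sym r)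

≈ᵃ-trans : {xs ys zs : List (HF n)} → xs ≈ᵃ ys → ys ≈ᵃ zs → xs ≈ᵃ zs
≈ᵃ-trans {xs = []}    {[]}    {zs}    p q = q
≈ᵃ-trans {xs = []}    {_ ∷ _} {zs}    (eqvᵃ ()) q
≈ᵃ-trans {xs = _ ∷ _} {[]}    {zs}    (eqvᵃ ()) q
≈ᵃ-trans {xs = _ ∷ _} {_ ∷ _} {[]}    p (eqvᵃ ())
≈ᵃ-trans {xs = _ ∷ _} {_ ∷ _} {_ ∷ _} p q =
  let p₁ , p₂ = ≈ᵃ∷ p ; q₁ , q₂ = ≈ᵃ∷ q in ∷≈ᵃ (≈-trans p₁ q₁) (≈ᵃ-trans p₂ q₂)

eqDyn-refl : (f : Dyn k) → eqDyn f f ≡ true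
eqDyn-refl halt   = refl
eqDyn-refl output = refl
eqDyn-refl (fn i) with i F.≟ i
... | yes _ = refl
... | no ¬e = ⊥-elim (¬e refl)

eqDyn⇒≡ : (f g : Dyn k) → eqDyn f g ≡ true → f ≡ g
eqDyn⇒≡ halt   halt   _ = refl
eqDyn⇒≡ output output _ = refl
eqDyn⇒≡ (fn i) (fn j) p with i F.≟ j
... | yes e = cong fn e

loc≈ : {f : Dyn k} {xs ys : List (HF n)} → xs ≈ᵃ ys → (f , xs) ≈ˡ (f , ys)
loc≈ {f = f} (eqvᵃ p) = eqvˡ (true-∧ (eqDyn-refl f) p)

≈loc : {f g : Dyn k} {xs ys : List (HF n)} → (f , xs) ≈ˡ (g , ys) → f ≡ g × xs ≈ᵃ ys
≈loc {f = f} {g} (eqvˡ p) = let q , r = ∧-true {eqDyn f g} p in eqDyn⇒≡ f g q , eqvᵃ r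

≈ˡ-refl : (l : LocK k n) → l ≈ˡ l
≈ˡ-refl (f , xs) = loc≈ (≈ᵃ-refl xs)

≈ˡ-sym : {l l' : LocK k n} → l ≈ˡ l' → l' ≈ˡ l
≈ˡ-sym {l = f , xs} {g , ys} p with ≈loc p
... | refl , q = loc≈ (≈ᵃ-sym q)

≈ˡ-trans : {l l' l'' : LocK k n} → l ≈ˡ l' → l' ≈ˡ l'' → l ≈ˡ l''
≈ˡ-trans {l = f , xs} {g , ys} {h , zs} p q with ≈loc p | ≈loc q
... | refl , p' | refl , q' = loc≈ (≈ᵃ-trans p' q')

record UpdF (k c : ℕ) : Set where
  constructor upF
  field
    fun  : Dyn k
    args : List (Form c)
    val  : Form c
open UpdF

values : List (Form c) → Tup n c → List (HF n)
values φs β = map (λ φ → ⟦ φ ⟧ β) φs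

locOf : UpdF k c → Tup n c → LocK k n
locOf u β = fun u , values (args u) β

valOf : UpdF k c → Tup n c → HF n
valOf u β = ⟦ val u ⟧ β

renU : Tup m c → UpdF k c → UpdF k m
renU σ u = upF (fun u) (map (ren σ) (args u)) (ren σ (val u))

values-ren : (σ : Tup m c) (φs : List (Form c)) (β : Tup n m) →
             values (map (ren σ) φs) β ≡ values φs (β ⟨ σ ⟩)
values-ren σ []       β = refl
values-ren σ (φ ∷ φs) β = cong₂ _∷_ (⟦ren⟧ σ φ β) (values-ren σ φs β)

locOf-ren : (σ : Tup m c) (u : UpdF k c) (β : Tup n m) → locOf (renU σ u) β ≡ locOf u (β ⟨ σ ⟩)
locOf-ren σ u β = cong (fun u ,_) (values-ren σ (args u) β)

AllNm : ℕ → List (Form c) → Set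
AllNm b φs = ∀ {φ} → φ ∈ φs → Nm b φ

NmU : ℕ → ℕ → UpdF k c → Set
NmU a b u = length (args u) ≤ a × AllNm b (args u) × Nm b (val u)

AllNm-ren : ∀ {b} {σ : Tup m c} {φs : List (Form c)} → Inj σ → AllNm b φs → AllNm b (map (ren σ) φs)
AllNm-ren {φs = φs} i h p with ∈-map⁻ _ p
... | φ , q , refl = Nm-ren i (h q)

NmU-ren : ∀ {a b} {σ : Tup m c} {u : UpdF k c} → Inj σ → NmU a b u → NmU a b (renU σ u)
NmU-ren {σ = σ} {u} i (la , h , p) = subst (_≤ _) (sym (length-map (ren σ) (args u))) la , AllNm-ren i h , Nm-ren i p

NmU-mono : ∀ {a b b'} {u : UpdF k c} → b ≤ b' → NmU a b u → NmU a b' u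
NmU-mono le (la , h , p) = la , (λ q → Nm-mono le _ (h q)) , Nm-mono le _ p

open module ContextU {k : ℕ} = Context {UpdF k} renU using () renaming
  (expand to expandU; expand⁻ to expandU⁻; expand⁺ to expandU⁺; graft to graftU; graft⁺ to graftU⁺;
   graft⁻ to graftU⁻; Good-expand to Good-expandU; Good-graft to Good-graftU) public

-- The replacement of an element may depend on the proof of its membership, so no plain map
-- describes the result. Instead each new element can be traced to its origin, and each old one to
-- its replacements, with the evidence `Q`.
gather : {X Y : ℕ → Set} {Q : ∀ {c} → Tup c m → X c → List (El Y m) → Set} (M : List (El X m)) →
  (∀ {c} {κ : Tup c m} {x : X c} → el κ x ∈ M → Σ (List (El Y m)) (Q κ x)) →
  Σ (List (El Y m)) λ M' →
    (∀ {B} → B ∈ M' → Σ ℕ λ c → Σ (Tup c m) λ κ → Σ (X c) λ x → Σ (List (El Y m)) λ L →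
      el κ x ∈ M × Q κ x L × B ∈ L) ×
    (∀ {c} {κ : Tup c m} {x : X c} → el κ x ∈ M → Σ (List (El Y m)) λ L → Q κ x L × (∀ {B} → B ∈ L → B ∈ M'))
gather [] h = [] , (λ ()) , λ ()
gather {X = X} {Y} {Q} (el κ x ∷ M) h with h (here refl) | gather {X = X} {Y} {Q} M (h ∘ there)
... | L , q | M' , f , g = L ++ M' ,
  (λ p → case ∈-++⁻ L p of λ
    { (inj₁ r) → _ , κ , x , L , here refl , q , r
    ; (inj₂ r) → let c , κ' , x' , L' , s , q' , r' = f r in c , κ' , x' , L' , there s , q' , r' }) ,
  λ { (here refl) → L , q , ∈-++⁺ˡ
    ; (there p) → let L' , q' , s = g p in L' , q' , ∈-++⁺ʳ L ∘ s }

-- The instances of `Γ` are the locations with a value other than ∅. Locations of value ∅ have to be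
-- left out, because their arguments do not count as critical and the space bound would put no limit
-- on their forms.
record Tracks {k n : ℕ} (st : List (UpdK k n)) (Γ : List (El (UpdF k) 0)) : Set where
  field
    sound : ∀ {c} {u : UpdF k c} {β} → Inst Γ [] u β → ∀ {l} → l ≈ˡ locOf u β → lookupSt l st ≈ valOf u β
    complete : ∀ l → lookupSt l st ≈ emptyS ⊎
      (Σ ℕ λ c → Σ (UpdF k c) λ u → ∃[ β ] (Inst Γ [] u β × l ≈ˡ locOf u β))
    nonempty : ∀ {c} {u : UpdF k c} {β : Tup n c} → Inst Γ [] u β → ¬ valOf u β ≈ emptyS
open Tracks

boolF : Bool → Form m
boolF t = clo [] (if t then el {c = 0} [] (clo [] []) ∷ [] else [])

Nm-boolF : ∀ {b} t → Nm b (boolF {m} t)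
Nm-boolF true  = clo z≤n Inj-[] λ { (here refl) → z≤n , Inj-[] , clo z≤n Inj-[] λ () }
Nm-boolF false = clo z≤n Inj-[] λ ()

[]-unique : {A : Set} (α β : Vec A 0) → α ≡ β
[]-unique [] [] = refl

⟦boolF⟧ : ∀ t (α : Tup n m) → toHF t ≈ ⟦ boolF t ⟧ α
⟦boolF⟧ {n} true  α = set≈
  (λ { (here refl) → emptyS , inst⁺ {L = L} {φ = clo [] []} {β = []} (inst (here refl) Inj-[] ([]-unique _ _)) , ≈-refl emptyS })
  (λ y∈ → case inst⁻ {L = L} y∈ of λ { (_ , _ , β , inst (here refl) _ _ , refl) → emptyS , here refl , ≈-refl emptyS })
  where
  L : List (El Form 0)
  L = el {c = 0} [] (clo [] []) ∷ []
⟦boolF⟧ false α = ≈-refl emptyS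

atomsF : Form m
atomsF = clo [] (el {c = 1} [] (at zero) ∷ [])

⟦atomsF⟧ : (α : Tup n m) → atomSet ≈ ⟦ atomsF ⟧ α
⟦atomsF⟧ {n} α = set≈
  (λ x∈ → case ∈-map⁻ atom x∈ of λ { (a , _ , refl) →
    ∈⇒∈ₛ (inst⁺ {L = L} {φ = at zero} {β = a ∷ []} (inst (here refl) (mkInj λ { zero zero _ → refl }) ([]-unique _ _))) })
  (λ y∈ → case inst⁻ {L = L} y∈ of λ { (_ , _ , β , inst (here refl) _ _ , refl) → ∈⇒∈ₛ (∈-map⁺ atom (∈-allFin _)) })
  where
  L : List (El Form 0)
  L = el {c = 1} [] (at zero) ∷ []

complete-graph : ∀ n → Fin n → Fin n → Bool
complete-graph n i j = not ⌊ i F.≟ j ⌋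

⌊≟⌋-inj : {α : Tup n m} → Inj α → ∀ i j → ⌊ α ! i F.≟ α ! j ⌋ ≡ ⌊ i F.≟ j ⌋
⌊≟⌋-inj {α = α} iα i j with α ! i F.≟ α ! j | i F.≟ j
... | yes e | yes _ = refl
... | yes e | no ¬e = ⊥-elim (¬e (inj iα i j e))
... | no ¬e | yes e = ⊥-elim (¬e (cong (α !_) e))
... | no _  | no _  = refl

-- Bounds on the forms that evaluating a term produces

module Bounds {S : Sig} where

  mutual
    Bt : ∀ {V} → Term S V → ℕ → ℕ
    Bt (var i)       b = b
    Bt (dyn f ts)    b = quad (Bts ts b)
    Bt (edge s t)    b = Bt s b + Bt t b
    Bt tt            b = b
    Bt ff            b = b
    Bt (and s t)     b = Bt s b + Bt t b
    Bt (or s t)      b = Bt s b + Bt t b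
    Bt (neg t)       b = Bt t b
    Bt (eq s t)      b = Bt s b + Bt t b
    Bt (mem s t)     b = quad (Bt s b + Bt t b)
    Bt empty         b = b
    -- The form of the set of atoms has an element with one position of its own, so the bound must
    -- be at least 1.
    Bt atoms         b = suc b
    Bt (bigUnion t)  b = quad (Bt t b)
    Bt (theUnique t) b = quad (Bt t b)
    Bt (pair s t)    b = Bt s b + Bt t b
    -- The elements of the range live in contexts of up to twice its bound, and `t` and `φ` are
    -- evaluated there.
    Bt (compr t r φ) b = Bt t (Bt r b + Bt r b) + Bt φ (Bt r b + Bt r b)

    Bts : ∀ {V l} → Vec (Term S V) l → ℕ → ℕ
    Bts []       b = b
    Bts (t ∷ ts) b = Bt t b + Bts ts b

  mutual
    ≤Bt : ∀ {V} (t : Term S V) b → b ≤ Bt t b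
    ≤Bt (var i)       b = ≤-refl
    ≤Bt (dyn f ts)    b = ≤-trans (≤Bts ts b) (≤quad _)
    ≤Bt (edge s t)    b = ≤-trans (≤Bt s b) (m≤m+n _ _)
    ≤Bt tt            b = ≤-refl
    ≤Bt ff            b = ≤-refl
    ≤Bt (and s t)     b = ≤-trans (≤Bt s b) (m≤m+n _ _)
    ≤Bt (or s t)      b = ≤-trans (≤Bt s b) (m≤m+n _ _)
    ≤Bt (neg t)       b = ≤Bt t b
    ≤Bt (eq s t)      b = ≤-trans (≤Bt s b) (m≤m+n _ _)
    ≤Bt (mem s t)     b = ≤-trans (≤Bt s b) (≤-trans (m≤m+n _ _) (≤quad _))
    ≤Bt empty         b = ≤-refl
    ≤Bt atoms         b = n≤1+n b
    ≤Bt (bigUnion t)  b = ≤-trans (≤Bt t b) (≤quad _)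
    ≤Bt (theUnique t) b = ≤-trans (≤Bt t b) (≤quad _)
    ≤Bt (pair s t)    b = ≤-trans (≤Bt s b) (m≤m+n _ _)
    ≤Bt (compr t r φ) b = ≤-trans (≤-trans (≤Bt r b) (m≤m+n _ _)) (≤-trans (≤Bt t _) (m≤m+n _ _))

    ≤Bts : ∀ {V l} (ts : Vec (Term S V) l) b → b ≤ Bts ts b
    ≤Bts []       b = ≤-refl
    ≤Bts (t ∷ ts) b = ≤-trans (≤Bt t b) (m≤m+n _ _)

  Br : ∀ {V} → Rule S V → ℕ → ℕ
  Br skip         b = b
  Br (upd f ts t) b = Bts ts b + Bt t b
  Br (ite φ R R') b = Bt φ b + (Br R b + Br R' b)
  Br (par R R')   b = Br R b + Br R' b
  Br (forAll r R) b = Br R (Bt r b + Bt r b)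

  ≤Br : ∀ {V} (R : Rule S V) b → b ≤ Br R b
  ≤Br skip         b = ≤-refl
  ≤Br (upd f ts t) b = ≤-trans (≤Bts ts b) (m≤m+n _ _)
  ≤Br (ite φ R R') b = ≤-trans (≤Bt φ b) (m≤m+n _ _)
  ≤Br (par R R')   b = ≤-trans (≤Br R b) (m≤m+n _ _)
  ≤Br (forAll r R) b = ≤-trans (≤-trans (≤Bt r b) (m≤m+n _ _)) (≤Br R _)

-- Symbolic evaluation of terms

module EvalRep {S : Sig} (K N : ℕ) (hN : quad K ≤ N) (hK : suc K ≤ N)
  (a : ℕ) (ar≤ : ∀ f → arity S f ≤ a)
  (b₀ : ℕ) (Γ : List (El (UpdF (Sig.k S)) 0)) (goodΓ : Good b₀ (NmU a b₀) Γ)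
  (st : ∀ n → State S n) (tr : ∀ {n} → N ≤ n → Tracks (st n) Γ) where

  open Ops K N hN hK
  open Bounds {S}

  ev : ∀ {n V} → Vec (HF n) V → Term S V → HF n
  ev {n} = Eval.eval S (complete-graph n) (st n)

  evs : ∀ {n V l} → Vec (HF n) V → Vec (Term S V) l → List (HF n)
  evs {n} = Eval.evalArgs S (complete-graph n) (st n)

  ex : ∀ {n V} → Vec (HF n) V → Rule S V → List (Update S n)
  ex {n} = Eval.exec S (complete-graph n) (st n)

  private variable
    V B : ℕ

  EnvOK : Tup n m → Vec (HF n) V → Vec (Form m) V → Set
  EnvOK α ρ env = ∀ i → ρ ! i ≈ ⟦ env ! i ⟧ α

  EnvNm : ℕ → Vec (Form m) V → Set
  EnvNm b env = ∀ i → Nm b (env ! i)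

  record Rep (B : ℕ) (env : Vec (Form m) V) (F : ∀ {n} → Vec (HF n) V → HF n) : Set where
    constructor mkRep
    field
      form : Form m
      nm   : Nm B form
      spec : ∀ {n} → N ≤ n → {α : Tup n m} → Inj α → ∀ ρ → EnvOK α ρ env → F ρ ≈ ⟦ form ⟧ α
  open Rep

  bool-rep : {env : Vec (Form m) V} {F : ∀ {n} → Vec (HF n) V → Bool} →
    (Σ Bool λ t → ∀ {n} → N ≤ n → {α : Tup n m} → Inj α → ∀ ρ → EnvOK α ρ env → F ρ ≡ t) →
    Rep B env (λ ρ → toHF (F ρ))
  bool-rep (t , h) = mkRep (boolF t) (Nm-boolF t) λ hn {α} iα ρ ok → subst (λ t' → toHF t' ≈ _) (sym (h hn iα ρ ok)) (⟦boolF⟧ t α)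

  truthy-bool : m ≤ K → (φ : Form m) → Nm K φ →
    Σ Bool λ t → ∀ {n} → N ≤ n → {α : Tup n m} → Inj α → ∀ {x} → x ≈ ⟦ φ ⟧ α → truthy x ≡ t
  truthy-bool m≤ φ p =
    let t , h = eq-bool m≤ φ (boolF true) p (Nm-boolF true) in
    t , λ hn {α} iα q → trans (eqHF-cong q (⟦boolF⟧ true α)) (h hn iα)

  args-bool : m ≤ K → (φs ψs : List (Form m)) → AllNm K φs → AllNm K ψs →
    Σ Bool λ t → ∀ {n} → N ≤ n → {α : Tup n m} → Inj α → eqArgs (values φs α) (values ψs α) ≡ t
  args-bool m≤ []       []       _ _ = true , λ _ _ → refl
  args-bool m≤ []       (_ ∷ _)  _ _ = false , λ _ _ → refl
  args-bool m≤ (_ ∷ _)  []       _ _ = false , λ _ _ → refl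
  args-bool m≤ (φ ∷ φs) (ψ ∷ ψs) p q =
    let t , h = eq-bool m≤ φ ψ (p (here refl)) (q (here refl))
        t' , h' = args-bool m≤ φs ψs (p ∘ there) (q ∘ there)
    in t ∧ t' , λ hn iα → cong₂ _∧_ (h hn iα) (h' hn iα)

  -- Evaluation consults the edge relation only here. Adjacency in the complete graph is
  -- distinctness of atoms, and for an injective tuple that is distinctness of positions.
  edge-bool : (φ ψ : Form m) → Σ Bool λ t → ∀ {n} {α : Tup n m} → Inj α → ∀ {x y} →
    x ≈ ⟦ φ ⟧ α → y ≈ ⟦ ψ ⟧ α → Eval.edgeVal S (complete-graph n) (st n) x y ≡ toHF t
  edge-bool (at i) (at j) = not ⌊ i F.≟ j ⌋ , λ {n} {α} iα p q → go iα p q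
    where
    go : ∀ {n} {α : Tup n _} → Inj α → ∀ {x y} → x ≈ atom (α ! i) → y ≈ atom (α ! j) →
         Eval.edgeVal S (complete-graph n) (st n) x y ≡ toHF (not ⌊ i F.≟ j ⌋)
    go iα {atom a} {atom b} p q with atom≈ p | atom≈ q
    ... | refl | refl = cong (λ t → toHF (not t)) (⌊≟⌋-inj iα i j)
    go iα {set _} {_} (eqv ()) q
    go iα {atom _} {set _} p (eqv ())
  edge-bool (clo θ L) ψ = false , λ { iα {set _} p q → refl ; iα {atom _} (eqv ()) q }
  edge-bool (at i) (clo θ L) = false , λ { iα {set _} p q → refl ; iα {atom _} {set _} p q → refl ; iα {atom _} {atom _} p (eqv ()) }

  -- Binding a variable to an element enlarges the context along `κ`; the older variables are
  -- renamed accordingly.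
  ev-ren : ∀ {n c} {α : Tup n m} {β : Tup n c} {κ : Tup c m} {ρ : Vec (HF n) V} {env : Vec (Form m) V} {x ψ} →
           β ⟨ κ ⟩ ≡ α → EnvOK α ρ env → x ≈ ⟦ ψ ⟧ β → EnvOK β (x ∷ ρ) (ψ ∷ V.map (ren κ) env)
  ev-ren refl ok q zero = q
  ev-ren {β = β} {κ} {env = env} refl ok q (suc i) =
    ≈-trans (ok i) (≡⇒≈ (sym (trans (cong (λ φ → ⟦ φ ⟧ β) (V.lookup-map i (ren κ) env)) (⟦ren⟧ κ _ β))))

  EnvNm-ren : ∀ {b b' c} {κ : Tup c m} {env : Vec (Form m) V} {ψ} → Inj κ → b ≤ b' → EnvNm b env → Nm b' ψ →
              EnvNm b' (ψ ∷ V.map (ren κ) env)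
  EnvNm-ren iκ le h p zero = p
  EnvNm-ren {κ = κ} {env} iκ le h p (suc i) =
    subst (Nm _) (sym (V.lookup-map i (ren κ) env)) (Nm-ren iκ (Nm-mono le _ (h i)))

  module _ {m b : ℕ} (hb : quad b ≤ K) (m≤ : m ≤ b) (b₀≤ : b₀ ≤ b) where

    private
      2b≤K : b + b ≤ K
      2b≤K = ≤-trans (2≤quad b) hb
      b≤K : b ≤ K
      b≤K = ≤-trans (≤quad b) hb

    -- The entries of the state have no context of their own. Expanding them over `m` lists all ways
    -- in which their atoms can coincide with those of the current context.
    Γᵐ : List (El (UpdF (Sig.k S)) m)
    Γᵐ = expandU [] Γ

    goodᵐ : Good (b + b) (NmU a b) Γᵐ
    goodᵐ = Good-mono (+-mono-≤ b₀≤ m≤) (λ {_} {u} → NmU-mono {u = u} b₀≤) (Good-expandU {P = NmU a b₀} (λ {_} {_} {_} {u} → NmU-ren {u = u}) goodΓ)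

    soundᵐ : N ≤ n → {α : Tup n m} → ∀ {u : UpdF (Sig.k S) c} {β} → Inst Γᵐ α u β →
             ∀ {l} → l ≈ˡ locOf u β → lookupSt l (st n) ≈ valOf u β
    soundᵐ hn {α} {β = β} p q with expandU⁻ p
    ... | c' , x , ι , r , _ , refl = subst (_ ≈_) (sym (⟦ren⟧ ι (val x) β))
      (sound (tr hn) (subst (λ δ → Inst Γ δ x (β ⟨ ι ⟩)) ([]-unique _ _) r) (subst (_ ≈ˡ_) (locOf-ren ι x β) q))

    completeᵐ : N ≤ n → {α : Tup n m} → Inj α → ∀ l → lookupSt l (st n) ≈ emptyS ⊎
      (Σ ℕ λ c → Σ (UpdF (Sig.k S) c) λ u → ∃[ β ] (Inst Γᵐ α u β × l ≈ˡ locOf u β))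
    completeᵐ hn {α} iα l with complete (tr hn) l
    ... | inj₁ p = inj₁ p
    ... | inj₂ (c , u , β , r@(inst p _ _) , q)
      with expandU⁺ {θ = []} {Γ} iα (double 2b≤K hn (≤-trans (proj₁ (goodΓ p)) b₀≤) m≤)
             (subst (λ δ → Inst Γ δ u β) ([]-unique _ _) r)
    ... | ι , γ , s , refl = inj₂ (_ , renU ι u , γ , s , subst (l ≈ˡ_) (sym (locOf-ren ι u γ)) q)

    -- Whether an entry of `Γᵐ` has the requested location is uniform in its instances. If one has,
    -- all its instances over the same context are read at one location and hence carry equal
    -- values, so `unbind` removes the extra positions; if none has, the value is the default ∅.
    lookup-form : (f : Dyn (Sig.k S)) (φs : List (Form m)) → AllNm b φs → Σ (Form m) λ φ → Nm (quad b) φ ×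
      (∀ {n} → N ≤ n → {α : Tup n m} → Inj α → ∀ {l} → l ≈ˡ (f , values φs α) → lookupSt l (st n) ≈ ⟦ φ ⟧ α)
    lookup-form f φs p = search Γᵐ id (λ q → inj₂ q)
      where
      Result = Σ (Form m) λ φ → Nm (quad b) φ ×
        (∀ {n} → N ≤ n → {α : Tup n m} → Inj α → ∀ {l} → l ≈ˡ (f , values φs α) → lookupSt l (st n) ≈ ⟦ φ ⟧ α)
      Fails : El (UpdF (Sig.k S)) m → Set
      Fails (el {c} κ u) = ∀ {n} → N ≤ n → {β : Tup n c} → Inj β → ¬ (f , values φs (β ⟨ κ ⟩)) ≈ˡ locOf u β
      search : ∀ M → (∀ {A} → A ∈ M → A ∈ Γᵐ) → (∀ {A} → A ∈ Γᵐ → Fails A ⊎ A ∈ M) → Result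
      search [] _ h = boolF false , Nm-boolF false , λ hn {α} iα {l} q → case completeᵐ hn iα l of λ
        { (inj₁ e) → e
        ; (inj₂ (c , u , β , inst r iβ refl , s)) → case h r of λ
          { (inj₁ g) → ⊥-elim (g hn iβ (≈ˡ-trans (≈ˡ-sym q) s)) ; (inj₂ ()) } }
      search (el {c} κ u ∷ M) sub h = cases _ (proj₂ test)
        where
        A∈ = sub (here refl)
        c≤ = proj₁ (goodᵐ A∈)
        iκ = proj₁ (proj₂ (goodᵐ A∈))
        nu = proj₂ (proj₂ (goodᵐ A∈))
        test : Σ Bool λ t → ∀ {n} → N ≤ n → {β : Tup n c} → Inj β →
               eqLoc (f , values (map (ren κ) φs) β) (locOf u β) ≡ t
        test = let t , g = args-bool (≤-trans c≤ 2b≤K) (map (ren κ) φs) (args u)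
                             (λ q → Nm-mono b≤K _ (AllNm-ren iκ p q)) (λ q → Nm-mono b≤K _ (proj₁ (proj₂ nu) q))
               in eqDyn f (fun u) ∧ t , λ hn iβ → cong (eqDyn f (fun u) ∧_) (g hn iβ)
        cases : ∀ t → (∀ {n} → N ≤ n → {β : Tup n c} → Inj β →
                  eqLoc (f , values (map (ren κ) φs) β) (locOf u β) ≡ t) → Result
        cases false g = search M (sub ∘ there) λ q → case h q of λ
          { (inj₁ r) → inj₁ r
          ; (inj₂ (here refl)) → inj₁ λ hn {β} iβ r → false≢true (g hn iβ)
              (subst (λ vs → eqLoc (f , vs) (locOf u β) ≡ true) (sym (values-ren κ φs β)) (holdsˡ r))
          ; (inj₂ (there r)) → inj₂ r }
        cases true g =
          let φ , nφ , sp = unbind hb m≤ κ iκ c≤ (val u) (proj₂ (proj₂ nu))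
                (λ hn _ iβ iβ' e e' → ≈-trans (≈-sym (reads hn iβ e (≈ˡ-refl _))) (reads hn iβ' e' (≈ˡ-refl _)))
          in φ , nφ , λ hn {α} iα q →
               let β , iβ , e = leafK (≤-trans (≤-reflexive (+-assoc b b (b + b))) hb) hn c≤ (≤-trans m≤ (m≤m+n b b)) κ α iκ iα
               in ≈-trans (reads hn iβ e q) (≈-sym (sp hn iα iβ e))
          where
          reads : ∀ {n} → N ≤ n → {α : Tup n m} → ∀ {β} → Inj β → β ⟨ κ ⟩ ≡ α →
                  ∀ {l} → l ≈ˡ (f , values φs α) → lookupSt l (st n) ≈ valOf u β
          reads hn {β = β} iβ refl q = soundᵐ hn (inst A∈ iβ refl) (≈ˡ-trans q (eqvˡ
            (subst (λ vs → eqLoc (f , vs) (locOf u β) ≡ true) (values-ren κ φs β) (g hn iβ))))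

  ∈-evalC⁻ : ∀ {n V} {ρ : Vec (HF n) V} {t φ} xs {y} → y ∈ Eval.evalC S (complete-graph n) (st n) ρ t φ xs →
             ∃[ x ] (x ∈ xs × truthy (ev (x ∷ ρ) φ) ≡ true × y ≡ ev (x ∷ ρ) t)
  ∈-evalC⁻ {ρ = ρ} {φ = φ} (x ∷ xs) p with truthy (ev (x ∷ ρ) φ) in e
  ∈-evalC⁻ (x ∷ xs) (here refl) | true  = x , here refl , e , refl
  ∈-evalC⁻ (x ∷ xs) (there p)   | true  = let z , z∈ , r = ∈-evalC⁻ xs p in z , there z∈ , r
  ∈-evalC⁻ (x ∷ xs) p           | false = let z , z∈ , r = ∈-evalC⁻ xs p in z , there z∈ , r

  ∈-evalC⁺ : ∀ {n V} {ρ : Vec (HF n) V} {t φ} {xs x} → x ∈ xs → truthy (ev (x ∷ ρ) φ) ≡ true →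
             ev (x ∷ ρ) t ∈ Eval.evalC S (complete-graph n) (st n) ρ t φ xs
  ∈-evalC⁺ {ρ = ρ} {φ = φ} {x ∷ xs} (here refl) e rewrite e = here refl
  ∈-evalC⁺ {ρ = ρ} {φ = φ} {z ∷ xs} (there p) e with truthy (ev (z ∷ ρ) φ)
  ... | true  = there (∈-evalC⁺ p e)
  ... | false = ∈-evalC⁺ p e

  ∈-execF⁻ : ∀ {n V} {ρ : Vec (HF n) V} {R} xs {u} → u ∈ Eval.execF S (complete-graph n) (st n) ρ R xs →
             ∃[ x ] (x ∈ xs × u ∈ ex (x ∷ ρ) R)
  ∈-execF⁻ {ρ = ρ} {R} (x ∷ xs) p with ∈-++⁻ (ex (x ∷ ρ) R) p
  ... | inj₁ q = x , here refl , q
  ... | inj₂ q = let z , z∈ , r = ∈-execF⁻ xs q in z , there z∈ , r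

  ∈-execF⁺ : ∀ {n V} {ρ : Vec (HF n) V} {R} {xs x u} → x ∈ xs → u ∈ ex (x ∷ ρ) R →
             u ∈ Eval.execF S (complete-graph n) (st n) ρ R xs
  ∈-execF⁺ (here refl) q = ∈-++⁺ˡ q
  ∈-execF⁺ {ρ = ρ} {R} {z ∷ xs} (there p) q = ∈-++⁺ʳ (ex (z ∷ ρ) R) (∈-execF⁺ p q)

  els-bound : ∀ {b} → m ≤ b → {φ : Form m} → Nm b φ → Good (b + b) (Nm b) (els φ)
  els-bound m≤ p = Good-mono (+-mono-≤ ≤-refl m≤) id (Good-els p)

  ˡ≤K : ∀ {x y} → x + y ≤ K → x ≤ K
  ˡ≤K {x} {y} = ≤-trans (m≤m+n x y)

  ʳ≤K : ∀ {x y} → x + y ≤ K → y ≤ K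
  ʳ≤K {x} {y} = ≤-trans (m≤n+m y x)

  ArgsRep : ℕ → ℕ → Vec (Form m) V → (∀ {n} → Vec (HF n) V → List (HF n)) → Set
  ArgsRep {m} l B env F = Σ (List (Form m)) λ φs → length φs ≡ l × AllNm B φs ×
    (∀ {n} → N ≤ n → {α : Tup n m} → Inj α → ∀ ρ → EnvOK α ρ env → F ρ ≈ᵃ values φs α)

  -- The guard has the same truth value at all instances of one element form of the range, so each
  -- such form is kept or dropped as a whole, and the kept ones are replaced by the form of `t`.
  compr-rep : ∀ {b b₁ B} {env : Vec (Form m) V} {t r φ} → b₁ + b₁ ≤ K → m ≤ b₁ → b ≤ b₁ → EnvNm b env →
    Rep b₁ env (λ ρ → ev ρ r) → b₁ + b₁ ≤ B → B ≤ K →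
    (∀ {c} → c ≤ b₁ + b₁ → (env' : Vec (Form c) (suc V)) → EnvNm (b₁ + b₁) env' → Rep B env' (λ ρ → ev ρ t)) →
    (∀ {c} → c ≤ b₁ + b₁ → (env' : Vec (Form c) (suc V)) → EnvNm (b₁ + b₁) env' → Rep B env' (λ ρ → ev ρ φ)) →
    Rep B env (λ ρ → ev ρ (compr t r φ))
  compr-rep {m} {V} {b} {b₁} {B} {env} {t} {r} {φ} 2b₁≤ m≤ b≤ env-nm (mkRep ψr nr sr) 2b₁≤B B≤K T Φ =
    mkRep (coll M') (Nm-coll (≤-trans m≤ (≤-trans (m≤m+n b₁ b₁) 2b₁≤B)) ≤-refl good)
      λ hn iα ρ ok → set≈ (to hn iα ρ ok) (from hn iα ρ ok)
    where
    record Q {c} (κ : Tup c m) (ψ : Form c) (L : List (El Form m)) : Set where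
      field
        good-L : Good B (Nm B) L
        keep : ∀ {n} → N ≤ n → {α : Tup n m} → ∀ ρ → EnvOK α ρ env → ∀ {β} → Inj β → β ⟨ κ ⟩ ≡ α →
               ∀ {x} → x ≈ ⟦ ψ ⟧ β → truthy (ev (x ∷ ρ) φ) ≡ true →
               Σ (Form c) λ χ → Inst L α χ β × ev (x ∷ ρ) t ≈ ⟦ χ ⟧ β
        only : ∀ {n} → N ≤ n → {α : Tup n m} → ∀ ρ → EnvOK α ρ env → ∀ {c'} {χ : Form c'} {γ} → Inst L α χ γ →
               ∃[ β ] (Inj β × β ⟨ κ ⟩ ≡ α × (∀ {x} → x ≈ ⟦ ψ ⟧ β →
                 truthy (ev (x ∷ ρ) φ) ≡ true × ev (x ∷ ρ) t ≈ ⟦ χ ⟧ γ))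
    open Q
    per : ∀ {c} {κ : Tup c m} {ψ} → el κ ψ ∈ els ψr → Σ (List (El Form m)) (Q κ ψ)
    per {c} {κ} {ψ} p = cases _ (proj₂ test)
      where
      gd = els-bound m≤ nr p
      c≤ = proj₁ gd
      iκ = proj₁ (proj₂ gd)
      env' = ψ ∷ V.map (ren κ) env
      env'-nm : EnvNm (b₁ + b₁) env'
      env'-nm = EnvNm-ren iκ (≤-trans b≤ (m≤m+n b₁ b₁)) env-nm (Nm-mono (m≤m+n b₁ b₁) ψ (proj₂ (proj₂ gd)))
      Tr = T c≤ env' env'-nm
      Φr = Φ c≤ env' env'-nm
      test = truthy-bool (≤-trans c≤ 2b₁≤) (form Φr) (Nm-mono B≤K _ (nm Φr))
      cases : ∀ s → (∀ {n} → N ≤ n → {β : Tup n c} → Inj β → ∀ {x} → x ≈ ⟦ form Φr ⟧ β → truthy x ≡ s) →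
              Σ (List (El Form m)) (Q κ ψ)
      cases true h = el κ (form Tr) ∷ [] , record
        { good-L = λ { (here refl) → ≤-trans c≤ 2b₁≤B , iκ , nm Tr }
        ; keep = λ hn ρ ok iβ e q _ → form Tr , inst (here refl) iβ e , spec Tr hn iβ _ (ev-ren e ok q)
        ; only = λ { hn ρ ok {γ = γ} (inst (here refl) iβ e) → γ , iβ , e , λ q →
            h hn iβ (spec Φr hn iβ _ (ev-ren e ok q)) , spec Tr hn iβ _ (ev-ren e ok q) } }
      cases false h = [] , record
        { good-L = λ ()
        ; keep = λ hn ρ ok iβ e q tr → false≢true (h hn iβ (spec Φr hn iβ _ (ev-ren e ok q))) tr
        ; only = λ { hn ρ ok (inst () _ _) } }
    gath = gather {X = Form} {Form} {Q} (els ψr) per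
    M' = proj₁ gath
    good : Good B (Nm B) M'
    good p = let _ , _ , _ , L , _ , q , r = proj₁ (proj₂ gath) p in good-L q r
    to : ∀ {n} → N ≤ n → {α : Tup n m} → Inj α → ∀ ρ → EnvOK α ρ env →
         ∀ {y} → y ∈ elems (ev ρ (compr t r φ)) → y ∈ₛ elems (⟦ coll M' ⟧ α)
    to hn iα ρ ok y∈ with ∈-evalC⁻ (elems (ev ρ r)) y∈
    ... | x , x∈ , tr , refl with elems≈ (sr hn iα ρ ok) (∈⇒∈ₛ x∈)
    ... | x' , x'∈ , e with els⁺ 2b₁≤ hn m≤ nr ≤-refl iα x'∈
    ... | c , ψ , β , inst p iβ e' , refl with proj₂ (proj₂ gath) p
    ... | L , q , sub with keep q hn ρ ok iβ e' e tr
    ... | χ , inst s i e'' , r = _ , coll⁺ M' (inst (sub s) i e'') , r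
    from : ∀ {n} → N ≤ n → {α : Tup n m} → Inj α → ∀ ρ → EnvOK α ρ env →
           ∀ {y} → y ∈ elems (⟦ coll M' ⟧ α) → y ∈ₛ elems (ev ρ (compr t r φ))
    from hn iα ρ ok y∈ with coll⁻ M' y∈
    ... | c , χ , γ , inst p iγ e , refl with proj₁ (proj₂ gath) p
    ... | c' , κ , ψ , L , s , q , B∈ with only q hn ρ ok (inst B∈ iγ e)
    ... | β , iβ , e' , f with elems≈ (≈-sym (sr hn iα ρ ok)) (∈⇒∈ₛ (els⁻ {φ = ψr} iα (inst s iβ e')))
    ... | x , x∈ , r = _ , ∈-evalC⁺ x∈ (proj₁ (f (≈-sym r))) , ≈-sym (proj₂ (f (≈-sym r)))

  mutual
    eval-rep : (t : Term S V) {b : ℕ} → Bt t b ≤ K → b₀ ≤ b → m ≤ b → (env : Vec (Form m) V) → EnvNm b env →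
               Rep (Bt t b) env (λ ρ → ev ρ t)
    eval-rep (var i) h b₀≤ m≤ env en = mkRep (env ! i) (en i) λ _ _ ρ ok → ok i
    eval-rep (dyn f ts) {b} h b₀≤ m≤ env en =
      let φs , _ , nφ , sp = args-rep ts (≤-trans (≤quad _) h) b₀≤ m≤ env en
          φ , nm , sp' = lookup-form h (≤-trans m≤ (≤Bts ts b)) (≤-trans b₀≤ (≤Bts ts b)) f φs nφ
      in mkRep φ nm λ hn iα ρ ok → sp' hn iα (loc≈ (sp hn iα ρ ok))
    eval-rep (edge s t) h b₀≤ m≤ env en =
      let S' = eval-rep s (ˡ≤K h) b₀≤ m≤ env en ; T' = eval-rep t (ʳ≤K h) b₀≤ m≤ env en
          u , e = edge-bool (form S') (form T')
      in mkRep (boolF u) (Nm-boolF u) λ hn {α} iα ρ ok →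
           subst (_≈ _) (sym (e iα (spec S' hn iα ρ ok) (spec T' hn iα ρ ok))) (⟦boolF⟧ u α)
    eval-rep tt h b₀≤ m≤ env en = mkRep (boolF true) (Nm-boolF true) λ _ {α} _ _ _ → ⟦boolF⟧ true α
    eval-rep ff h b₀≤ m≤ env en = mkRep (boolF false) (Nm-boolF false) λ _ {α} _ _ _ → ⟦boolF⟧ false α
    eval-rep (and s t) h b₀≤ m≤ env en = connective-rep _∧_ s t h b₀≤ m≤ env en
    eval-rep (or s t)  h b₀≤ m≤ env en = connective-rep _∨_ s t h b₀≤ m≤ env en
    eval-rep (neg s) {b} h b₀≤ m≤ env en =
      let S' = eval-rep s h b₀≤ m≤ env en
          u , f = truthy-bool (≤-trans m≤ (≤-trans (≤Bt s b) h)) (form S') (Nm-mono h _ (nm S'))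
      in bool-rep (not u , λ hn iα ρ ok → cong not (f hn iα (spec S' hn iα ρ ok)))
    eval-rep (eq s t) {b} h b₀≤ m≤ env en =
      let S' = eval-rep s (ˡ≤K h) b₀≤ m≤ env en ; T' = eval-rep t (ʳ≤K h) b₀≤ m≤ env en
          m≤K = ≤-trans m≤ (≤-trans (≤Bt s b) (ˡ≤K h))
          u , f = eq-bool m≤K (form S') (form T') (Nm-mono (ˡ≤K h) _ (nm S')) (Nm-mono (ʳ≤K h) _ (nm T'))
      in bool-rep (u , λ hn iα ρ ok → trans (eqHF-cong (spec S' hn iα ρ ok) (spec T' hn iα ρ ok)) (f hn iα))
    eval-rep (mem s t) {b} h b₀≤ m≤ env en =
      let h' = ≤-trans (≤quad _) h
          S' = eval-rep s (ˡ≤K h') b₀≤ m≤ env en ; T' = eval-rep t (ʳ≤K h') b₀≤ m≤ env en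
          u , f = mem-bool h (≤-trans m≤ (≤-trans (≤Bt s b) (m≤m+n _ _))) (form S') (form T')
                    (Nm-mono (m≤m+n _ _) _ (nm S')) (Nm-mono (m≤n+m _ _) _ (nm T'))
      in bool-rep (u , λ hn iα ρ ok → trans (iff⇒≡
           (λ e → ∈ₛ⇒mem (∈ₛ-resp (≈-sym (spec S' hn iα ρ ok))
                    (let z , z∈ , q = mem⇒∈ₛ {ys = elems (ev ρ t)} e
                         w , w∈ , q' = elems≈ (spec T' hn iα ρ ok) (∈⇒∈ₛ z∈) in w , w∈ , ≈-trans q q')))
           (λ e → ∈ₛ⇒mem (∈ₛ-resp (spec S' hn iα ρ ok)
                    (let z , z∈ , q = mem⇒∈ₛ {ys = elems (⟦ form T' ⟧ _)} e
                         w , w∈ , q' = elems≈ (≈-sym (spec T' hn iα ρ ok)) (∈⇒∈ₛ z∈) in w , w∈ , ≈-trans q q'))))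
           (f hn iα))
    eval-rep empty h b₀≤ m≤ env en = mkRep (boolF false) (Nm-boolF false) λ _ {α} _ _ _ → ⟦boolF⟧ false α
    eval-rep atoms h b₀≤ m≤ env en =
      mkRep atomsF (clo z≤n Inj-[] λ { (here refl) → s≤s z≤n , Inj-[] , at }) λ _ {α} _ _ _ → ⟦atomsF⟧ α
    eval-rep (bigUnion t) {b} h b₀≤ m≤ env en =
      let T' = eval-rep t (≤-trans (≤quad _) h) b₀≤ m≤ env en
          ψ , nψ , sp = bigUnion-form h (≤-trans m≤ (≤Bt t b)) (form T') (nm T')
      in mkRep ψ nψ λ hn iα ρ ok → ≈-trans (bigUnion-cong (spec T' hn iα ρ ok)) (sp hn iα)
    eval-rep (theUnique t) {b} h b₀≤ m≤ env en =
      let T' = eval-rep t (≤-trans (≤quad _) h) b₀≤ m≤ env en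
          ψ , nψ , sp = unique-form h (≤-trans m≤ (≤Bt t b)) S (form T') (nm T')
      in mkRep ψ nψ λ {n} hn iα ρ ok → sp hn (complete-graph n) (st n) iα (spec T' hn iα ρ ok)
    eval-rep {m = m} (pair s t) {b} h b₀≤ m≤ env en =
      let S' = eval-rep s (ˡ≤K h) b₀≤ m≤ env en ; T' = eval-rep t (ʳ≤K h) b₀≤ m≤ env en
          m≤B = ≤-trans m≤ (≤-trans (≤Bt s b) (m≤m+n _ _))
          M : List (El Form m)
          M = el idV (form S') ∷ el idV (form T') ∷ []
      in mkRep (coll M) (Nm-coll m≤B ≤-refl λ
           { (here refl) → m≤B , Inj-id , Nm-mono (m≤m+n _ _) _ (nm S')
           ; (there (here refl)) → m≤B , Inj-id , Nm-mono (m≤n+m _ _) _ (nm T') })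
         λ hn {α} iα ρ ok → set≈
           (λ { (here refl) → _ , coll⁺ M (inst (here refl) iα (⟨id⟩ α)) , spec S' hn iα ρ ok
              ; (there (here refl)) → _ , coll⁺ M (inst (there (here refl)) iα (⟨id⟩ α)) , spec T' hn iα ρ ok })
           (λ y∈ → case coll⁻ M y∈ of λ
              { (_ , _ , β , inst (here refl) _ e , refl) → _ , here refl ,
                  subst (λ δ → ⟦ form S' ⟧ δ ≈ _) (trans (sym e) (⟨id⟩ β)) (≈-sym (spec S' hn iα ρ ok))
              ; (_ , _ , β , inst (there (here refl)) _ e , refl) → _ , there (here refl) ,
                  subst (λ δ → ⟦ form T' ⟧ δ ≈ _) (trans (sym e) (⟨id⟩ β)) (≈-sym (spec T' hn iα ρ ok)) })
    eval-rep (compr t r φ) {b} h b₀≤ m≤ env en =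
      let b₁ = Bt r b
          2b₁≤ = ≤-trans (≤Bt t (b₁ + b₁)) (ˡ≤K h)
          b≤2b₁ = ≤-trans (≤Bt r b) (m≤m+n b₁ b₁)
      in compr-rep {t = t} {r} {φ} 2b₁≤ (≤-trans m≤ (≤Bt r b)) (≤Bt r b) en
           (eval-rep r (≤-trans (m≤m+n b₁ b₁) 2b₁≤) b₀≤ m≤ env en)
           (≤-trans (≤Bt t (b₁ + b₁)) (m≤m+n _ _)) h
           (λ c≤ env' en' → weaken (m≤m+n _ _) (eval-rep t (ˡ≤K h) (≤-trans b₀≤ b≤2b₁) c≤ env' en'))
           (λ c≤ env' en' → weaken (m≤n+m _ _) (eval-rep φ (ʳ≤K h) (≤-trans b₀≤ b≤2b₁) c≤ env' en'))

    connective-rep : (_⊛_ : Bool → Bool → Bool) (s t : Term S V) {b : ℕ} → Bt s b + Bt t b ≤ K → b₀ ≤ b → m ≤ b →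
      (env : Vec (Form m) V) → EnvNm b env → Rep (Bt s b + Bt t b) env (λ ρ → toHF (truthy (ev ρ s) ⊛ truthy (ev ρ t)))
    connective-rep _⊛_ s t {b} h b₀≤ m≤ env en =
      let S' = eval-rep s (ˡ≤K h) b₀≤ m≤ env en ; T' = eval-rep t (ʳ≤K h) b₀≤ m≤ env en
          m≤K = ≤-trans m≤ (≤-trans (≤Bt s b) (ˡ≤K h))
          u , f = truthy-bool m≤K (form S') (Nm-mono (ˡ≤K h) _ (nm S'))
          v , g = truthy-bool m≤K (form T') (Nm-mono (ʳ≤K h) _ (nm T'))
      in bool-rep (u ⊛ v , λ hn iα ρ ok → cong₂ _⊛_ (f hn iα (spec S' hn iα ρ ok)) (g hn iα (spec T' hn iα ρ ok)))

    args-rep : ∀ {l} (ts : Vec (Term S V) l) {b : ℕ} → Bts ts b ≤ K → b₀ ≤ b → m ≤ b → (env : Vec (Form m) V) →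
               EnvNm b env → ArgsRep l (Bts ts b) env (λ ρ → evs ρ ts)
    args-rep []       h b₀≤ m≤ env en = [] , refl , (λ ()) , λ _ _ _ _ → ≈ᵃ-refl []
    args-rep (t ∷ ts) h b₀≤ m≤ env en =
      let T' = eval-rep t (ˡ≤K h) b₀≤ m≤ env en
          φs , lφ , nφ , sp = args-rep ts (ʳ≤K h) b₀≤ m≤ env en
      in form T' ∷ φs , cong suc lφ ,
         (λ { (here refl) → Nm-mono (m≤m+n _ _) _ (nm T') ; (there q) → Nm-mono (m≤n+m _ _) _ (nφ q) }) ,
         λ hn iα ρ ok → ∷≈ᵃ (spec T' hn iα ρ ok) (sp hn iα ρ ok)

    weaken : ∀ {B'} {env : Vec (Form m) V} {F : ∀ {n} → Vec (HF n) V → HF n} → B ≤ B' → Rep B env F → Rep B' env F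
    weaken le (mkRep φ p sp) = mkRep φ (Nm-mono le φ p) sp

  -- Symbolic execution of rules

  UMatch : Update S n → UpdF (Sig.k S) c → Tup n c → Set
  UMatch u w β = proj₁ u ≈ˡ locOf w β × proj₂ u ≈ valOf w β

  record RuleRep (B : ℕ) (env : Vec (Form m) V) (F : ∀ {n} → Vec (HF n) V → List (Update S n)) : Set where
    constructor mkRuleRep
    field
      upds : List (El (UpdF (Sig.k S)) m)
      good : Good B (NmU a B) upds
      fwd : ∀ {n} → N ≤ n → {α : Tup n m} → Inj α → ∀ ρ → EnvOK α ρ env → ∀ {u} → u ∈ F ρ →
            Σ ℕ λ c → Σ (UpdF (Sig.k S) c) λ w → ∃[ β ] (Inst upds α w β × UMatch u w β)
      bwd : ∀ {n} → N ≤ n → {α : Tup n m} → Inj α → ∀ ρ → EnvOK α ρ env →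
            ∀ {c} {w : UpdF (Sig.k S) c} {β} → Inst upds α w β → ∃[ u ] (u ∈ F ρ × UMatch u w β)
  open RuleRep

  weakenR : ∀ {B'} {env : Vec (Form m) V} {F : ∀ {n} → Vec (HF n) V → List (Update S n)} → B ≤ B' →
            RuleRep B env F → RuleRep B' env F
  weakenR le (mkRuleRep U g f h) = mkRuleRep U (Good-mono le (λ {_} {u} → NmU-mono {u = u} le) g) f h

  ++-rep : {env : Vec (Form m) V} {F G : ∀ {n} → Vec (HF n) V → List (Update S n)} →
           RuleRep B env F → RuleRep B env G → RuleRep B env (λ ρ → F ρ ++ G ρ)
  ++-rep {F = F} {G} (mkRuleRep U g f h) (mkRuleRep U' g' f' h') = mkRuleRep (U ++ U') (Good-++ {L = U} g g')
    (λ hn iα ρ ok p → case ∈-++⁻ (F ρ) p of λ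
      { (inj₁ q) → let c , w , β , r , s = f hn iα ρ ok q in c , w , β , Inst-++ˡ r , s
      ; (inj₂ q) → let c , w , β , r , s = f' hn iα ρ ok q in c , w , β , Inst-++ʳ U r , s })
    (λ hn iα ρ ok p → case Inst-++⁻ U p of λ
      { (inj₁ q) → let u , r , s = h hn iα ρ ok q in u , ∈-++⁺ˡ r , s
      ; (inj₂ q) → let u , r , s = h' hn iα ρ ok q in u , ∈-++⁺ʳ (F ρ) r , s })

  -- The body is executed once per element form of the range, in the context of that element;
  -- grafting returns the updates to the outer context and lets the bound element range over all its
  -- instances.
  forAll-rep : ∀ {b b₁} {env : Vec (Form m) V} {r R} → b₁ + b₁ ≤ K → m ≤ b₁ → b ≤ b₁ → EnvNm b env →
    Rep b₁ env (λ ρ → ev ρ r) →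
    (∀ {c} → c ≤ b₁ + b₁ → (env' : Vec (Form c) (suc V)) → EnvNm (b₁ + b₁) env' → RuleRep B env' (λ ρ → ex ρ R)) →
    RuleRep B env (λ ρ → ex ρ (forAll r R))
  forAll-rep {m} {V} {B} {b} {b₁} {env} {r} {R} 2b₁≤ m≤ b≤ env-nm (mkRep ψr nr sr) T =
    mkRuleRep (proj₁ gath)
      (λ p → let _ , _ , _ , L , _ , q , s = proj₁ (proj₂ gath) p in good-L q s)
      to from
    where
    record Q {c} (κ : Tup c m) (ψ : Form c) (L : List (El (UpdF (Sig.k S)) m)) : Set where
      field
        good-L : Good B (NmU a B) L
        fwd-L : ∀ {n} → N ≤ n → {α : Tup n m} → ∀ ρ → EnvOK α ρ env → ∀ {β} → Inj β → β ⟨ κ ⟩ ≡ α →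
                ∀ {x} → x ≈ ⟦ ψ ⟧ β → ∀ {u} → u ∈ ex (x ∷ ρ) R →
                Σ ℕ λ c → Σ (UpdF (Sig.k S) c) λ w → ∃[ γ ] (Inst L α w γ × UMatch u w γ)
        bwd-L : ∀ {n} → N ≤ n → {α : Tup n m} → ∀ ρ → EnvOK α ρ env →
                ∀ {c'} {w : UpdF (Sig.k S) c'} {γ} → Inst L α w γ →
                ∃[ β ] (Inj β × β ⟨ κ ⟩ ≡ α × (∀ {x} → x ≈ ⟦ ψ ⟧ β → ∃[ u ] (u ∈ ex (x ∷ ρ) R × UMatch u w γ)))
    open Q
    per : ∀ {c} {κ : Tup c m} {ψ} → el κ ψ ∈ els ψr → Σ (List (El (UpdF (Sig.k S)) m)) (Q κ ψ)
    per {c} {κ} {ψ} p = graftU κ (upds Tr) , record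
      { good-L = Good-graftU {P = NmU a B} iκ (good Tr)
      ; fwd-L = λ hn ρ ok iβ e q u∈ →
          let c' , w , γ , i , s = fwd Tr hn iβ _ (ev-ren e ok q) u∈ in c' , w , γ , graftU⁺ e i , s
      ; bwd-L = λ hn ρ ok i →
          let β , iβ , e , i' = graftU⁻ {P = NmU a B} {L = upds Tr} (good Tr) i
          in β , iβ , e , λ q → bwd Tr hn iβ _ (ev-ren e ok q) i' }
      where
      gd = els-bound m≤ nr p
      iκ = proj₁ (proj₂ gd)
      Tr = T (proj₁ gd) (ψ ∷ V.map (ren κ) env)
        (EnvNm-ren iκ (≤-trans b≤ (m≤m+n b₁ b₁)) env-nm (Nm-mono (m≤m+n b₁ b₁) ψ (proj₂ (proj₂ gd))))
    gath = gather {X = Form} {UpdF (Sig.k S)} {Q} (els ψr) per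
    to : ∀ {n} → N ≤ n → {α : Tup n m} → Inj α → ∀ ρ → EnvOK α ρ env → ∀ {u} → u ∈ ex ρ (forAll r R) →
         Σ ℕ λ c → Σ (UpdF (Sig.k S) c) λ w → ∃[ β ] (Inst (proj₁ gath) α w β × UMatch u w β)
    to hn iα ρ ok u∈ with ∈-execF⁻ (elems (ev ρ r)) u∈
    ... | x , x∈ , u∈x with elems≈ (sr hn iα ρ ok) (∈⇒∈ₛ x∈)
    ... | x' , x'∈ , e with els⁺ 2b₁≤ hn m≤ nr ≤-refl iα x'∈
    ... | c , ψ , β , inst p iβ e' , refl with proj₂ (proj₂ gath) p
    ... | L , q , sub with fwd-L q hn ρ ok iβ e' e u∈x
    ... | c' , w , γ , inst s i e'' , mt = c' , w , γ , inst (sub s) i e'' , mt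
    from : ∀ {n} → N ≤ n → {α : Tup n m} → Inj α → ∀ ρ → EnvOK α ρ env →
           ∀ {c} {w : UpdF (Sig.k S) c} {β} → Inst (proj₁ gath) α w β → ∃[ u ] (u ∈ ex ρ (forAll r R) × UMatch u w β)
    from hn iα ρ ok (inst p iγ e) with proj₁ (proj₂ gath) p
    ... | c' , κ , ψ , L , s , q , B∈ with bwd-L q hn ρ ok (inst B∈ iγ e)
    ... | β , iβ , e' , f with elems≈ (≈-sym (sr hn iα ρ ok)) (∈⇒∈ₛ (els⁻ {φ = ψr} iα (inst s iβ e')))
    ... | x , x∈ , t = let u , u∈ , mt = f (≈-sym t) in u , ∈-execF⁺ x∈ u∈ , mt

  exec-rep : (R : Rule S V) {b : ℕ} → Br R b ≤ K → b₀ ≤ b → m ≤ b → (env : Vec (Form m) V) → EnvNm b env →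
             RuleRep (Br R b) env (λ ρ → ex ρ R)
  exec-rep skip h b₀≤ m≤ env en = mkRuleRep [] (λ ()) (λ { _ _ _ _ () }) (λ { _ _ _ _ (inst () _ _) })
  exec-rep {m = m} (upd f ts t) {b} h b₀≤ m≤ env en =
    let φs , lφ , nφ , sp = args-rep ts (ˡ≤K h) b₀≤ m≤ env en
        T' = eval-rep t (ʳ≤K h) b₀≤ m≤ env en
        w = upF f φs (form T')
        mt : ∀ {n} → N ≤ n → {α : Tup n m} → Inj α → ∀ ρ → EnvOK α ρ env → UMatch ((f , evs ρ ts) , ev ρ t) w α
        mt hn iα ρ ok = loc≈ (sp hn iα ρ ok) , spec T' hn iα ρ ok
    in mkRuleRep (el idV w ∷ [])
         (λ { (here refl) → ≤-trans m≤ (≤-trans (≤Bts ts b) (m≤m+n _ _)) , Inj-id ,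
              subst (_≤ a) (sym lφ) (ar≤ f) , (λ q → Nm-mono (m≤m+n _ _) _ (nφ q)) , Nm-mono (m≤n+m _ _) _ (nm T') })
         (λ { hn {α} iα ρ ok (here refl) → m , w , α , inst (here refl) iα (⟨id⟩ α) , mt hn iα ρ ok })
         (λ { hn {α} iα ρ ok {β = β} (inst (here refl) _ e) → _ , here refl ,
              subst (UMatch _ w) (trans (sym e) (⟨id⟩ β)) (mt hn iα ρ ok) })
  exec-rep (ite φ R R') {b} h b₀≤ m≤ env en = cases _ (proj₂ test)
    where
    Φ = eval-rep φ (ˡ≤K h) b₀≤ m≤ env en
    test = truthy-bool (≤-trans m≤ (≤-trans (≤Bt φ b) (ˡ≤K h))) (form Φ) (Nm-mono (ˡ≤K h) _ (nm Φ))
    cases : ∀ s → (∀ {n} → N ≤ n → {α : Tup n _} → Inj α → ∀ {x} → x ≈ ⟦ form Φ ⟧ α → truthy x ≡ s) →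
            RuleRep (Br (ite φ R R') b) env (λ ρ → ex ρ (ite φ R R'))
    branch : ∀ {R₀} → RuleRep (Br (ite φ R R') b) env (λ ρ → ex ρ R₀) →
      (∀ {n} → N ≤ n → {α : Tup n _} → Inj α → ∀ ρ → EnvOK α ρ env → ex ρ R₀ ≡ ex ρ (ite φ R R')) →
      RuleRep (Br (ite φ R R') b) env (λ ρ → ex ρ (ite φ R R'))
    branch X same = mkRuleRep (upds X) (good X)
      (λ hn iα ρ ok p → fwd X hn iα ρ ok (subst (_ ∈_) (sym (same hn iα ρ ok)) p))
      (λ hn iα ρ ok p → let u , q , s = bwd X hn iα ρ ok p in u , subst (u ∈_) (same hn iα ρ ok) q , s)
    cases true g = branch {R}
      (weakenR (≤-trans (m≤m+n _ (Br R' b)) (m≤n+m _ (Bt φ b))) (exec-rep R (ˡ≤K (ʳ≤K {Bt φ b} h)) b₀≤ m≤ env en))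
      λ hn iα ρ ok → cong (λ s → if s then ex ρ R else ex ρ R') (sym (g hn iα (spec Φ hn iα ρ ok)))
    cases false g = branch {R'}
      (weakenR (≤-trans (m≤n+m _ (Br R b)) (m≤n+m _ (Bt φ b))) (exec-rep R' (ʳ≤K {Br R b} (ʳ≤K {Bt φ b} h)) b₀≤ m≤ env en))
      λ hn iα ρ ok → cong (λ s → if s then ex ρ R else ex ρ R') (sym (g hn iα (spec Φ hn iα ρ ok)))
  exec-rep (par R R') h b₀≤ m≤ env en =
    ++-rep (weakenR (m≤m+n _ _) (exec-rep R (ˡ≤K h) b₀≤ m≤ env en)) (weakenR (m≤n+m _ _) (exec-rep R' (ʳ≤K h) b₀≤ m≤ env en))
  exec-rep (forAll r R) {b} h b₀≤ m≤ env en =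
    let b₁ = Bt r b
        2b₁≤ = ≤-trans (≤Br R (b₁ + b₁)) h
        b≤2b₁ = ≤-trans (≤Bt r b) (m≤m+n b₁ b₁)
    in forAll-rep {r = r} {R} 2b₁≤ (≤-trans m≤ (≤Bt r b)) (≤Bt r b) en
         (eval-rep r (≤-trans (m≤m+n b₁ b₁) 2b₁≤) b₀≤ m≤ env en)
         (λ c≤ env' en' → exec-rep R h (≤-trans b₀≤ b≤2b₁) c≤ env' en')

-- One step of the run on symbolic states

pick : {A : Set} {P P' : A → Set} (M : List A) → (∀ {x} → x ∈ M → P x ⊎ P' x) →
       Σ (List A) λ M' → (∀ {x} → x ∈ M' → x ∈ M × P x) × (∀ {x} → x ∈ M → x ∈ M' ⊎ P' x)
pick [] h = [] , (λ ()) , λ ()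
pick (x ∷ M) h with h (here refl) | pick M (h ∘ there)
... | inj₁ p | M' , f , g = x ∷ M' ,
  (λ { (here refl) → here refl , p ; (there q) → let r , s = f q in there r , s }) ,
  λ { (here refl) → inj₁ (here refl) ; (there q) → case g q of λ { (inj₁ r) → inj₁ (there r) ; (inj₂ r) → inj₂ r } }
... | inj₂ p | M' , f , g = M' , (λ q → let r , s = f q in there r , s) ,
  λ { (here refl) → inj₂ p ; (there q) → g q }

allB⁻ : {A : Set} {p : A → Bool} {xs : List A} → allB p xs ≡ true → ∀ {x} → x ∈ xs → p x ≡ true
allB⁻ {p = p} {x ∷ xs} h (here refl) = proj₁ (∧-true h)
allB⁻ {p = p} {x ∷ xs} h (there q)   = allB⁻ (proj₂ (∧-true {p x} h)) q

allB⁺ : {A : Set} {p : A → Bool} {xs : List A} → (∀ {x} → x ∈ xs → p x ≡ true) → allB p xs ≡ true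
allB⁺ {xs = []}     h = refl
allB⁺ {xs = x ∷ xs} h = true-∧ (h (here refl)) (allB⁺ (h ∘ there))

consistent⁻ : {U : List (UpdK k n)} → consistent U ≡ true → ∀ {u u'} → u ∈ U → u' ∈ U →
              proj₁ u ≈ˡ proj₁ u' → proj₂ u ≈ proj₂ u'
consistent⁻ {U = U} h {u} {u'} p q (eqvˡ e) with allB⁻ (allB⁻ h p) q
... | r rewrite e = eqv r

consistent⁺ : {U : List (UpdK k n)} → (∀ {u u'} → u ∈ U → u' ∈ U → proj₁ u ≈ˡ proj₁ u' → proj₂ u ≈ proj₂ u') →
              consistent U ≡ true
consistent⁺ {U = U} h = allB⁺ λ {u} p → allB⁺ λ {u'} q → impl _ refl (λ e → holds (h p q (eqvˡ e)))
  where
  impl : ∀ {a c} b → a ≡ b → (a ≡ true → c ≡ true) → not a ∨ c ≡ true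
  impl true  refl f = f refl
  impl false refl f = refl

first-match : (l : LocK k n) (U st : List (UpdK k n)) →
  (∃[ u ] (u ∈ U × l ≈ˡ proj₁ u × lookupSt l (U ++ st) ≡ proj₂ u)) ⊎
  ((∀ {u} → u ∈ U → ¬ l ≈ˡ proj₁ u) × lookupSt l (U ++ st) ≡ lookupSt l st)
first-match l [] st = inj₂ ((λ ()) , refl)
first-match l ((l' , v) ∷ U) st with eqLoc l l' in e
... | true = inj₁ ((l' , v) , here refl , eqvˡ e , refl)
... | false with first-match l U st
... | inj₁ (u , p , q , r) = inj₁ (u , there p , q , r)
... | inj₂ (p , q) = inj₂ ((λ { (here refl) (eqvˡ r) → false≢true e r ; (there s) → p s }) , q)

game-args : ∀ {b} → quad b ≤ n → quad b ≤ n' → {m₁ m₂ : ℕ} (φs : List (Form m₁)) (ψs : List (Form m₂)) →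
  AllNm b φs → AllNm b ψs → {γ : Tup n m} {γ' : Tup n' m} → Same γ γ' →
  ∀ {α₁ α₁' α₂ α₂'} → Linked γ γ' α₁ α₁' → Linked γ γ' α₂ α₂' →
  values φs α₁ ≈ᵃ values ψs α₂ → values φs α₁' ≈ᵃ values ψs α₂'
game-args hn hn' []       []       p q s l₁ l₂ e = eqvᵃ refl
game-args hn hn' []       (_ ∷ _)  p q s l₁ l₂ (eqvᵃ ())
game-args hn hn' (_ ∷ _)  []       p q s l₁ l₂ (eqvᵃ ())
game-args hn hn' (φ ∷ φs) (ψ ∷ ψs) p q s l₁ l₂ e = let e₁ , e₂ = ≈ᵃ∷ e in
  ∷≈ᵃ (game hn hn' φ ψ (p (here refl)) (q (here refl)) s l₁ l₂ e₁)
      (game-args hn hn' φs ψs (p ∘ there) (q ∘ there) s l₁ l₂ e₂)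

game-loc : ∀ {a b} → quad b ≤ n → quad b ≤ n' → {m₁ m₂ : ℕ} (u : UpdF k m₁) (w : UpdF k m₂) →
  NmU a b u → NmU a b w → {γ : Tup n m} {γ' : Tup n' m} → Same γ γ' →
  ∀ {α₁ α₁' α₂ α₂'} → Linked γ γ' α₁ α₁' → Linked γ γ' α₂ α₂' →
  locOf u α₁ ≈ˡ locOf w α₂ → locOf u α₁' ≈ˡ locOf w α₂'
game-loc hn hn' u w p q s l₁ l₂ e with ≈loc e
... | refl , e' = loc≈ (game-args hn hn' (args u) (args w) (proj₁ (proj₂ p)) (proj₁ (proj₂ q)) s l₁ l₂ e')

module StepRep {S : Sig} (Π : Rule S 0) (K N : ℕ) (hN : quad K ≤ N) (hK : suc K ≤ N)
  (a : ℕ) (ar≤ : ∀ f → arity S f ≤ a)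
  (b₀ : ℕ) (Γ : List (El (UpdF (Sig.k S)) 0)) (goodΓ : Good b₀ (NmU a b₀) Γ)
  (st : ∀ n → State S n) (tr : ∀ {n} → N ≤ n → Tracks (st n) Γ)
  (hB : Bounds.Br Π b₀ ≤ K) where

  open EvalRep K N hN hK a ar≤ b₀ Γ goodΓ st tr
  open Ops K N hN hK
  open Bounds {S}

  private
    B = Br Π b₀

    rr : RuleRep B [] (λ ρ → ex ρ Π)
    rr = exec-rep Π hB ≤-refl z≤n [] (λ ())

    U : ∀ n → List (Update S n)
    U n = ex [] Π

    Ψ = RuleRep.upds rr

    goodΨ : Good B (NmU a B) Ψ
    goodΨ = RuleRep.good rr

    b₀≤K : b₀ ≤ K
    b₀≤K = ≤-trans (≤Br Π b₀) hB

    nmK : {u : UpdF (Sig.k S) c} → NmU a B u → NmU a K u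
    nmK {u = u} = NmU-mono {u = u} hB

    nmK₀ : {u : UpdF (Sig.k S) c} → NmU a b₀ u → NmU a K u
    nmK₀ {u = u} = NmU-mono {u = u} b₀≤K

    small : c ≤ K → m ≤ K → N ≤ n → c + m ≤ n
    small p q hn = ≤-trans (+-mono-≤ p q) (≤-trans (2≤quad K) (≤-trans hN hn))

    to-U : N ≤ n → ∀ {c} {κ : Tup c 0} {w : UpdF (Sig.k S) c} {β} → el κ w ∈ Ψ → Inj β →
           ∃[ u ] (u ∈ U n × UMatch u w β)
    to-U hn p i = RuleRep.bwd rr hn {[]} Inj-[] [] (λ ()) (inst p i ([]-unique _ _))

    from-U : N ≤ n → ∀ {u} → u ∈ U n → Σ ℕ λ c → Σ (Tup c 0) λ κ → Σ (UpdF (Sig.k S) c) λ w → ∃[ β ]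
             (el κ w ∈ Ψ × Inj β × UMatch u w β)
    from-U hn p with RuleRep.fwd rr hn {[]} Inj-[] [] (λ ()) p
    ... | c , w , β , inst {κ} q i _ , mt = c , κ , w , β , q , i , mt

    -- The instances behind two updates over `n'` are copied to `n` with the same joint pattern.
    -- Equality of locations travels one way by `game-loc`, and equality of the values comes back by
    -- `game`.
    consistent-transfer : N ≤ n → N ≤ n' → consistent (U n) ≡ true → consistent (U n') ≡ true
    consistent-transfer {n} {n'} hn hn' h = consistent⁺ λ p q e → go p q e
      where
      go : ∀ {u u'} → u ∈ U n' → u' ∈ U n' → proj₁ u ≈ˡ proj₁ u' → proj₂ u ≈ proj₂ u'
      go p q e with from-U hn' p | from-U hn' q
      ... | c₁ , κ₁ , w₁ , β₁' , p₁ , i₁ , l₁ , v₁ | c₂ , κ₂ , w₂ , β₂' , p₂ , i₂ , l₂ , v₂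
        with extend {γ = []} {γ' = []} (mkSame (λ ()) (λ ())) β₁' (small (≤-trans (proj₁ (goodΨ p₁)) hB) z≤n hn)
      ... | β₁ , s₁
        with extend (Linked-Same s₁ (Linked-ˡ β₁' β₁)) β₂' (small (≤-trans (proj₁ (goodΨ p₂)) hB) (≤-trans (proj₁ (goodΨ p₁)) hB) hn)
      ... | β₂ , s₂ with to-U hn p₁ (Linked-Inj s₂ (Linked-ʳ β₂' β₂ Linked-self) i₁)
                       | to-U hn p₂ (Linked-Inj s₂ (Linked-ˡ β₂' β₂) i₂)
      ... | x , x∈ , lx , vx | y , y∈ , ly , vy =
        ≈-trans v₁ (≈-trans (game (≤-trans hN hn) (≤-trans hN hn') (val w₁) (val w₂)
            (proj₂ (proj₂ n₁)) (proj₂ (proj₂ n₂)) (Same-sym s₂) k₁ k₂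
            (≈-trans (≈-sym vx) (≈-trans (consistent⁻ h x∈ y∈ (≈ˡ-trans lx (≈ˡ-trans le (≈ˡ-sym ly)))) vy)))
          (≈-sym v₂))
        where
        n₁ = nmK {u = w₁} (proj₂ (proj₂ (goodΨ p₁)))
        n₂ = nmK {u = w₂} (proj₂ (proj₂ (goodΨ p₂)))
        k₁ = Linked-sym (Linked-ʳ β₂' β₂ (Linked-self {γ = β₁'} {β₁}))
        k₂ = Linked-sym (Linked-ˡ {γ = β₁'} {β₁} β₂' β₂)
        le = game-loc (≤-trans hN hn') (≤-trans hN hn) w₁ w₂ n₁ n₂ s₂ (Linked-sym k₁) (Linked-sym k₂)
               (≈ˡ-trans (≈ˡ-sym l₁) (≈ˡ-trans e l₂))

    Overwritten : El (UpdF (Sig.k S)) 0 → Set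
    Overwritten (el {c} κ u) = ∀ {n} → N ≤ n → {β : Tup n c} → Inj β → ∃[ u' ] (u' ∈ U n × locOf u β ≈ˡ proj₁ u')

    Kept : El (UpdF (Sig.k S)) 0 → Set
    Kept (el {c} κ u) = ∀ {n} → N ≤ n → {β : Tup n c} → Inj β → ∀ {u'} → u' ∈ U n → ¬ locOf u β ≈ˡ proj₁ u'

    overwrite-transfer : {u : UpdF (Sig.k S) c} → c ≤ K → NmU a K u → N ≤ n → N ≤ n' →
      {β : Tup n c} {β' : Tup n' c} → Inj β → Inj β' →
      ∃[ u' ] (u' ∈ U n × locOf u β ≈ˡ proj₁ u') → ∃[ u' ] (u' ∈ U n' × locOf u β' ≈ˡ proj₁ u')
    overwrite-transfer {u = u} c≤ nu hn hn' {β} {β'} i i' (x , x∈ , e) with from-U hn x∈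
    ... | c₂ , κ₂ , w , δ , p , j , l , v with extend (Inj⇒Same i i') δ (small (≤-trans (proj₁ (goodΨ p)) hB) c≤ hn')
    ... | δ' , s with to-U hn' p (Linked-Inj s (Linked-ˡ δ δ') j)
    ... | y , y∈ , ly , vy = y , y∈ , ≈ˡ-trans
      (game-loc (≤-trans hN hn) (≤-trans hN hn') u w nu (nmK {u = w} (proj₂ (proj₂ (goodΨ p)))) s
        (Linked-ʳ δ δ' Linked-self) (Linked-ˡ δ δ') (≈ˡ-trans e l))
      (≈ˡ-sym ly)

    overwritten? : ∀ {A} → A ∈ Γ → Kept A ⊎ Overwritten A
    -- The old state is given as empty: the only question is whether some update hits the location
    -- of the canonical instance, whose answer holds for all instances.
    overwritten? {el {c} κ u} p with first-match (locOf u β₀) (U N) []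
      where
      β₀ : Tup N c
      β₀ = canon (≤-trans (≤-trans (proj₁ (goodΓ p)) b₀≤K) K≤N)
    ... | inj₁ (x , x∈ , e , _) = inj₂ λ hn i →
      overwrite-transfer {u = u} (≤-trans (proj₁ (goodΓ p)) b₀≤K) (nmK₀ {u = u} (proj₂ (proj₂ (goodΓ p)))) ≤-refl hn (Inj-canon (≤-trans (≤-trans (proj₁ (goodΓ p)) b₀≤K) K≤N)) i (x , x∈ , e)
    ... | inj₂ (h , _) = inj₁ λ hn i x∈ e →
      let y , y∈ , r = overwrite-transfer {u = u} (≤-trans (proj₁ (goodΓ p)) b₀≤K) (nmK₀ {u = u} (proj₂ (proj₂ (goodΓ p)))) hn ≤-refl i (Inj-canon (≤-trans (≤-trans (proj₁ (goodΓ p)) b₀≤K) K≤N)) (_ , x∈ , e)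
      in h y∈ r

    NonE Emp : El (UpdF (Sig.k S)) 0 → Set
    NonE (el {c} κ u) = ∀ {n} → N ≤ n → {β : Tup n c} → Inj β → ¬ valOf u β ≈ emptyS
    Emp  (el {c} κ u) = ∀ {n} → N ≤ n → {β : Tup n c} → Inj β → valOf u β ≈ emptyS

    empty? : ∀ {A} → A ∈ Ψ → NonE A ⊎ Emp A
    empty? {el {c} κ u} p = cases _ (proj₂ test)
      where
      test = eq-bool (≤-trans (proj₁ (goodΨ p)) hB) (val u) (boolF false)
               (proj₂ (proj₂ (nmK {u = u} (proj₂ (proj₂ (goodΨ p)))))) (Nm-boolF false)
      cases : ∀ t → (∀ {n} → N ≤ n → {β : Tup n c} → Inj β → eqHF (valOf u β) emptyS ≡ t) →
              NonE (el κ u) ⊎ Emp (el κ u)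
      cases true  h = inj₂ λ hn i → eqv (h hn i)
      cases false h = inj₁ λ hn i (eqv e) → false≢true (h hn i) e

    st' : ∀ n → State S n
    st' n = step S (complete-graph n) Π (st n)

    -- A conflict leaves the state as it is. Otherwise the new entries are the updates with a
    -- nonempty value and the old entries that no update hits; updates to ∅ are not listed, but they
    -- still delete what they overwrite.
    step-cases : ∀ t → (∀ {n} → N ≤ n → consistent (U n) ≡ t) →
      Σ (List (El (UpdF (Sig.k S)) 0)) λ Γ' → Good B (NmU a B) Γ' × (∀ {n} → N ≤ n → Tracks (st' n) Γ')
    step-cases false h = Γ , Good-mono (≤Br Π b₀) (λ {_} {u} → NmU-mono {u = u} (≤Br Π b₀)) goodΓ ,
      λ {n} hn → subst (λ t → Tracks (if t then U n ++ st n else st n) Γ) (sym (h hn)) (tr hn)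
    step-cases true h = Ψ' ++ Γ' , Good-++ {L = Ψ'} (λ p → goodΨ (proj₁ (proj₁ (proj₂ pΨ) p)))
        (λ p → Good-mono (≤Br Π b₀) (λ {_} {u} → NmU-mono {u = u} (≤Br Π b₀)) goodΓ (proj₁ (proj₁ (proj₂ pΓ) p))) ,
      λ {n} hn → subst (λ t → Tracks (if t then U n ++ st n else st n) (Ψ' ++ Γ')) (sym (h hn)) (tracks hn)
      where
      pΨ = pick {P = NonE} {Emp} Ψ empty?
      pΓ = pick {P = Kept} {Overwritten} Γ overwritten?
      Ψ' = proj₁ pΨ
      Γ' = proj₁ pΓ
      tracks : ∀ {n} → N ≤ n → Tracks (U n ++ st n) (Ψ' ++ Γ')
      sound (tracks {n} hn) {u = w} {β} i {l} e with Inst-++⁻ Ψ' i | first-match l (U n) (st n)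
      ... | inj₁ (inst p j _) | inj₁ (u , u∈ , e' , r) =
        let x , x∈ , lx , vx = to-U hn (proj₁ (proj₁ (proj₂ pΨ) p)) j
        in subst (_≈ valOf w β) (sym r)
             (≈-trans (consistent⁻ (h hn) u∈ x∈ (≈ˡ-trans (≈ˡ-sym e') (≈ˡ-trans e (≈ˡ-sym lx)))) vx)
      ... | inj₁ (inst p j _) | inj₂ (no-u , _) =
        let x , x∈ , lx , vx = to-U hn (proj₁ (proj₁ (proj₂ pΨ) p)) j in ⊥-elim (no-u x∈ (≈ˡ-trans e (≈ˡ-sym lx)))
      ... | inj₂ (inst p j _) | inj₁ (u , u∈ , e' , r) =
        ⊥-elim (proj₂ (proj₁ (proj₂ pΓ) p) hn j u∈ (≈ˡ-trans (≈ˡ-sym e) e'))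
      ... | inj₂ (inst p j e₀) | inj₂ (_ , r) =
        subst (_≈ valOf w β) (sym r) (sound (tr hn) (inst (proj₁ (proj₁ (proj₂ pΓ) p)) j e₀) e)
      complete (tracks {n} hn) l with first-match l (U n) (st n)
      ... | inj₁ (u , u∈ , e , r) with from-U hn u∈
      ... | c , κ , w , β , p , i , lw , vw with proj₂ (proj₂ pΨ) p
      ... | inj₁ q = inj₂ (c , w , β , inst (∈-++⁺ˡ q) i ([]-unique _ _) , ≈ˡ-trans e lw)
      ... | inj₂ em = inj₁ (subst (_≈ emptyS) (sym r) (≈-trans vw (em hn i)))
      complete (tracks {n} hn) l | inj₂ (no-u , r) with complete (tr hn) l
      ... | inj₁ e = inj₁ (subst (_≈ emptyS) (sym r) e)
      ... | inj₂ (c , w , β , inst p i e₀ , e) with proj₂ (proj₂ pΓ) p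
      ... | inj₁ q = inj₂ (c , w , β , inst (∈-++⁺ʳ Ψ' q) i e₀ , e)
      ... | inj₂ ow = let x , x∈ , lx = ow hn i in ⊥-elim (no-u x∈ (≈ˡ-trans e lx))
      nonempty (tracks {n} hn) i with Inst-++⁻ Ψ' i
      ... | inj₁ (inst p j _) = proj₂ (proj₁ (proj₂ pΨ) p) hn j
      ... | inj₂ (inst p j e) = nonempty (tr hn) (inst (proj₁ (proj₁ (proj₂ pΓ) p)) j e)

  step-rep : Σ (List (El (UpdF (Sig.k S)) 0)) λ Γ' → Good B (NmU a B) Γ' ×
    (∀ {n} → N ≤ n → Tracks (step S (complete-graph n) Π (st n)) Γ')
  step-rep = step-cases (consistent (U N)) λ hn → iff⇒≡ (consistent-transfer hn ≤-refl) (consistent-transfer ≤-refl hn)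

-- Patterns under renaming and the pruning of elements

≡⇒≈ˡ : {l l' : LocK k n} → l ≡ l' → l ≈ˡ l'
≡⇒≈ˡ refl = ≈ˡ-refl _

ren-ren : (σ : Tup n m) (τ : Tup m k) (φ : Form k) → ren σ (ren τ φ) ≡ ren (σ ⟨ τ ⟩) φ
ren-ren σ τ (at i)    = cong at (sym (lookup-⟨⟩ σ τ i))
ren-ren σ τ (clo θ L) = cong (λ δ → clo δ L) (⟨⟩-assoc σ τ θ)

Same-refl : (γ : Tup n m) → Same γ γ
Same-refl γ = mkSame (λ _ _ e → e) (λ _ _ e → e)

Same-∷ : {γ : Tup n m} {γ' : Tup n' m} {b : Fin n} {b' : Fin n'} → Same γ γ' →
         (∀ i → γ ! i ≢ b) → (∀ i → γ' ! i ≢ b') → Same (b ∷ γ) (b' ∷ γ')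
Same-∷ s h h' = mkSame
  (λ { zero zero _ → refl ; zero (suc j) e → ⊥-elim (h j (sym e)) ; (suc j) zero e → ⊥-elim (h j e)
     ; (suc i) (suc j) → same→ s i j })
  (λ { zero zero _ → refl ; zero (suc j) e → ⊥-elim (h' j (sym e)) ; (suc j) zero e → ⊥-elim (h' j e)
     ; (suc i) (suc j) → same← s i j })

Same-⟨⟩ : {γ : Tup n m} {γ' : Tup n' m} → Same γ γ' → (θ : Tup m k) → Same (γ ⟨ θ ⟩) (γ' ⟨ θ ⟩)
Same-⟨⟩ s θ = Linked-Same s (Linked-⟨⟩ Linked-self θ)

Same-Inj : {γ : Tup n m} {γ' : Tup n' m} → Same γ γ' → Inj γ → Inj γ'
Same-Inj s = Linked-Inj s Linked-self

-- Here `θ` need not be injective, as `thins` concatenates the atoms of several forms, so `Nm-ren`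
-- does not apply. Injectivity of the composed selection depends only on the pattern.
Nm-ren-same : ∀ {b} {θ : Tup m k} {ι : Tup n k} {φ : Form k} → Same θ ι → Nm b (ren θ φ) → Nm b (ren ι φ)
Nm-ren-same {φ = at i} s at = at
Nm-ren-same {φ = clo σ L} s (clo k≤ i g) = clo k≤ (Same-Inj (Same-⟨⟩ s σ) i) g

Same-trans : {γ : Tup n m} {γ' : Tup n' m} {γ'' : Tup k m} → Same γ γ' → Same γ' γ'' → Same γ γ''
Same-trans s t = mkSame (λ i j e → same→ t i j (same→ s i j e)) (λ i j e → same← s i j (same← t i j e))

Same-inj⟨⟩ : {β : Tup n c} → Inj β → (σ : Tup c k) → Same σ (β ⟨ σ ⟩)
Same-inj⟨⟩ {β = β} iβ σ = mkSame
  (λ i j e → trans (lookup-⟨⟩ β σ i) (trans (cong (β !_) e) (sym (lookup-⟨⟩ β σ j))))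
  (λ i j e → inj iβ _ _ (trans (sym (lookup-⟨⟩ β σ i)) (trans e (lookup-⟨⟩ β σ j))))

-- The counterpart of `leaf` for a `σ` that may repeat positions.
realise : {σ : Tup c k} {δ : Tup n k} → Same σ δ → c + k ≤ n → ∃[ β ] (Inj β × β ⟨ σ ⟩ ≡ δ)
realise {σ = σ} s le with extend s idV le
... | β , s' = β , Linked-Inj s' (Linked-ˡ idV β) Inj-id ,
  Linked-≡ s' (Linked-⟨⟩ (Linked-ˡ idV β) σ) (Linked-ʳ idV β Linked-self) (id⟨⟩ σ)

opaque
  unfolding _⟨_⟩

  ⟨⟩-++ : (α : Tup n m) (θ : Tup m k) (κ : Tup m l) → α ⟨ θ V.++ κ ⟩ ≡ α ⟨ θ ⟩ V.++ α ⟨ κ ⟩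
  ⟨⟩-++ α θ κ = V.map-++ (α !_) θ κ

-- Only the atoms κ of the context and the atoms θ used by the body matter in an element.
record Pruned {c k l : ℕ} (κ : Tup c k) (θ : Tup c l) : Set where
  field
    ι    : Tup (l + k) l
    same : Same θ ι
    fwd  : ∀ {n} → (l + k) + (l + k) ≤ n → {β : Tup n c} → Inj β →
           ∃[ γ ] (Inj γ × γ ⟨ inrV l k ⟩ ≡ β ⟨ κ ⟩ × γ ⟨ ι ⟩ ≡ β ⟨ θ ⟩)
    bwd  : ∀ {n} → c + (l + k) ≤ n → {γ : Tup n (l + k)} → Inj γ →
           ∃[ β ] (Inj β × β ⟨ κ ⟩ ≡ γ ⟨ inrV l k ⟩ × γ ⟨ ι ⟩ ≡ β ⟨ θ ⟩)

-- The joint pattern of `θ` and `κ` fits into `l + k` positions with `κ` placed last; `ι` is the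
-- copy of `θ` there. Any instance over one context is then realised over the other with the same
-- relevant atoms.
prune : (κ : Tup c k) → Inj κ → (θ : Tup c l) → Pruned κ θ
prune {c} {k} {l} κ iκ θ with extend (Inj⇒Same iκ (Inj-inrV {l} {k})) θ ≤-refl
... | ι , s = record
  { ι = ι
  ; same = Linked-Same s (Linked-ˡ θ ι)
  ; fwd = λ le {β} iβ →
      let γ , iγ , e = realise (Same-trans (Same-sym s) (Same-inj⟨⟩ iβ (θ V.++ κ))) le
          e₁ , e₂ = split γ β e
      in γ , iγ , e₂ , e₁
  ; bwd = λ le {γ} iγ →
      let β , iβ , e = realise (Same-trans s (Same-inj⟨⟩ iγ (ι V.++ inrV l k))) le
          e₁ , e₂ = split γ β (sym e)
      in β , iβ , sym e₂ , e₁
  }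
  where
  split : ∀ {n} (γ : Tup n (l + k)) (β : Tup n c) → γ ⟨ ι V.++ inrV l k ⟩ ≡ β ⟨ θ V.++ κ ⟩ →
          γ ⟨ ι ⟩ ≡ β ⟨ θ ⟩ × γ ⟨ inrV l k ⟩ ≡ β ⟨ κ ⟩
  split γ β e = V.++-injective _ _ (trans (sym (⟨⟩-++ γ ι _)) (trans e (⟨⟩-++ β θ κ)))

-- Reducing the contexts of forms whose instances are active

module Normalise (K N : ℕ) (hN : quad K ≤ N) (hK : suc K ≤ N) (d s : ℕ) (hs : K * s ≤ N)
  (ar : ℕ) (hb : suc ar * suc d + (suc d + d) ≤ K)
  (Act : HF N → Set)
  (Act-∈ : ∀ {x y} → Act x → y ∈ elems x → Act y)
  (Act-resp : ∀ {x y} → x ≈ y → Act x → Act y)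
  (Act-bound : ∀ {k} → d < k → k ≤ K → (F : Fin (s ^ k) → HF N) → (∀ i → Act (F i)) →
               (∀ i j → i ≢ j → ¬ F i ≈ F j) → ⊥) where

  open World K N hN hK

  private
    -- An element needs the at most `suc d` atoms that it names and the at most `d` of its set,
    -- which makes `e`; it is `suc d` because an atom names one even if `d` is zero. An update
    -- consists of a value and at most `ar` arguments, each naming at most `suc d` atoms; adding `e`
    -- to their number makes `b'` bound the forms inside as well.
    e b' : ℕ
    e = suc d + d
    b' = suc ar * suc d + e

    e≤b' : e ≤ b'
    e≤b' = m≤n+m e (suc ar * suc d)

    he : e ≤ K
    he = ≤-trans e≤b' hb

  obj : List (El Form k) → Tup n k → HF n
  obj L γ = set (⟦ L ⟧* γ)

  ActL : List (El Form k) → Set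
  ActL {k} L = {γ : Tup N k} → Inj γ → Act (obj L γ)

  ActF : Form c → Set
  ActF {c} φ = {β : Tup N c} → Inj β → Act (⟦ φ ⟧ β)

  ActF⇒ActL : c ≤ K → k ≤ K → {θ : Tup c k} {L : List (El Form k)} → Inj θ → ActF (clo θ L) → ActL L
  ActF⇒ActL c≤ k≤ {θ} {L} iθ h {γ} iγ =
    let β , iβ , e = leaf θ γ iθ iγ (≤-trans (+-mono-≤ c≤ k≤) (≤-trans (2≤quad K) hN))
    in subst (λ δ → Act (obj L δ)) e (h iβ)

  ActL⇒ActF : {L : List (El Form k)} {κ : Tup c k} {φ : Form c} → Inj κ → ActL L → el κ φ ∈ L → ActF φ
  ActL⇒ActF iκ h p iβ = Act-∈ (h (Inj-⟨⟩ iβ iκ)) (inst⁺ (inst p iβ refl))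

  Droppable : List (El Form k) → Fin k → Set
  Droppable {k} L i = ∀ {n} → N ≤ n → {γ : Tup n k} {a : Fin n} → Inj γ → (∀ j → γ ! j ≢ a) →
                      obj L γ ≈ obj L (γ V.[ i ]≔ a)

  Sensitive : List (El Form k) → Fin k → Set
  Sensitive {k} L i = {γ : Tup N k} {a : Fin N} → Inj γ → (∀ j → γ ! j ≢ a) →
                      ¬ obj L γ ≈ obj L (γ V.[ i ]≔ a)

  -- With the fresh atom as an additional position, the effect of the replacement is an equation
  -- between two forms in a context of `suc k` positions, and so has one truth value for all tuples
  -- and sizes.
  droppable? : k ≤ K → (L : List (El Form k)) → Good K (Nm K) L → (i : Fin k) → Droppable L i ⊎ Sensitive L i
  droppable? {k} k≤ L g i = cases _ (λ hn iα → uni-eq φ ψ nφ nψ hn ≤-refl iα (Inj-canon (≤-trans (s≤s k≤) hK)))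
    where
    old new : Tup (suc k) k
    old = V.tabulate suc
    new = old V.[ i ]≔ zero
    φ ψ : Form (suc k)
    φ = clo old L
    ψ = clo new L
    old-inj : Inj old
    old-inj = mkInj λ x y q → F.suc-injective (trans (sym (lookup-tab suc x)) (trans q (lookup-tab suc y)))
    zero∉ : ∀ j → old ! j ≢ zero
    zero∉ j q = case trans (sym (lookup-tab suc j)) q of λ ()
    nφ : Nm K φ
    nφ = clo k≤ old-inj g
    nψ : Nm K ψ
    nψ = clo k≤ (update-inj i old-inj zero∉) g
    ⟨old⟩ : ∀ {n} (a : Fin n) (γ : Tup n k) → (a ∷ γ) ⟨ old ⟩ ≡ γ
    ⟨old⟩ a γ = vec-ext λ j → trans (lookup-⟨⟩ (a ∷ γ) old j) (cong ((a ∷ γ) !_) (lookup-tab suc j))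
    ⟨new⟩ : ∀ {n} (a : Fin n) (γ : Tup n k) → (a ∷ γ) ⟨ new ⟩ ≡ γ V.[ i ]≔ a
    ⟨new⟩ a γ = vec-ext λ j → trans (lookup-⟨⟩ (a ∷ γ) new j) (go j (j F.≟ i))
      where
      go : ∀ j → Dec (j ≡ i) → (a ∷ γ) ! (new ! j) ≡ (γ V.[ i ]≔ a) ! j
      go j (yes refl) = trans (cong ((a ∷ γ) !_) (V.lookup∘updateAt j old)) (sym (V.lookup∘updateAt j γ))
      go j (no j≢) = trans (cong ((a ∷ γ) !_) (trans (V.lookup∘updateAt′ j i j≢ old) (lookup-tab suc j)))
                       (sym (V.lookup∘updateAt′ j i j≢ γ))
    cases : ∀ t → (∀ {n} → N ≤ n → {α : Tup n (suc k)} → Inj α → eqHF (⟦ φ ⟧ α) (⟦ ψ ⟧ α) ≡ t) →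
            Droppable L i ⊎ Sensitive L i
    cases true h = inj₁ λ hn {γ} {a} iγ a∉ →
      subst₂ (λ x y → obj L x ≈ obj L y) (⟨old⟩ a γ) (⟨new⟩ a γ) (eqv (h hn (∷-Inj iγ a∉)))
    cases false h = inj₂ λ {γ} {a} iγ a∉ q → false≢true (h ≤-refl (∷-Inj iγ a∉))
      (holds (subst₂ (λ x y → obj L x ≈ obj L y) (sym (⟨old⟩ a γ)) (sym (⟨new⟩ a γ)) q))

  -- Otherwise moving one coordinate of γ out of the range of γ' would not change the object.
  sensitive-range : k ≤ K → (L : List (El Form k)) → Good K (Nm K) L → (∀ i → Sensitive L i) →
    {γ γ' : Tup N k} → Inj γ → (i : Fin k) → (∀ j → γ' ! j ≢ γ ! i) → ¬ obj L γ ≈ obj L γ'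
  sensitive-range {suc k} k≤ L g sens {γ} {γ'} iγ i γi∉γ' q = sens i iγ a∉γ
    (≈-trans q (≈-sym (subst₂ _≈_ (⟦clo-id⟧ L _) (⟦clo-id⟧ L γ')
      (game hN hN (clo idV L) (clo idV L) (clo k≤ Inj-id g) (clo k≤ Inj-id g) sm lγ lγ'
        (subst₂ _≈_ (sym (⟦clo-id⟧ L γ)) (sym (⟦clo-id⟧ L γ')) q)))))
    where
    fr = fresh (γ V.++ γ') (≤-trans (s≤s (+-mono-≤ k≤ k≤)) (≤-trans
      (+-mono-≤ (≤-trans (s≤s z≤n) k≤) (≤-refl {K + K})) (≤-trans (+-mono-≤ (≤-refl {K}) (m≤n+m (K + K) K)) hN)))
    a = proj₁ fr
    a∉γ : ∀ j → γ ! j ≢ a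
    a∉γ j r = proj₂ fr (j F.↑ˡ suc k) (trans (V.lookup-++ˡ γ γ' j) r)
    a∉γ' : ∀ j → γ' ! j ≢ a
    a∉γ' j r = proj₂ fr (suc k F.↑ʳ j) (trans (V.lookup-++ʳ γ γ' j) r)
    others : Tup (suc k) k
    others = V.tabulate (F.punchIn i)
    rest : Tup N (suc k + k)
    rest = γ' V.++ γ ⟨ others ⟩
    ∉rest : ∀ {b} → (∀ j → γ' ! j ≢ b) → (∀ j → j ≢ i → γ ! j ≢ b) → ∀ j → rest ! j ≢ b
    ∉rest h h' j r with F.splitAt (suc k) j | V.lookup-splitAt (suc k) γ' (γ ⟨ others ⟩) j
    ... | inj₁ x | r' = h x (trans (sym r') r)
    ... | inj₂ x | r' = h' (F.punchIn i x) (F.punchInᵢ≢i i x)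
      (trans (sym (trans r' (trans (lookup-⟨⟩ γ others x) (cong (γ !_) (lookup-tab _ x))))) r)
    sm : Same (γ ! i ∷ rest) (a ∷ rest)
    sm = Same-∷ (Same-refl rest) (∉rest γi∉γ' λ j j≢ r → j≢ (inj iγ _ _ r)) (∉rest a∉γ' λ j _ → a∉γ j)
    lγ' : Linked (γ ! i ∷ rest) (a ∷ rest) γ' γ'
    lγ' = mkLinked λ j → suc (j F.↑ˡ k) , sym (V.lookup-++ˡ γ' _ j) , sym (V.lookup-++ˡ γ' _ j)
    lγ : Linked (γ ! i ∷ rest) (a ∷ rest) γ (γ V.[ i ]≔ a)
    lγ = mkLinked λ j → go j (i F.≟ j)
      where
      go : ∀ j → Dec (i ≡ j) → ∃[ x ] (γ ! j ≡ (γ ! i ∷ rest) ! x ×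
                                        (γ V.[ i ]≔ a) ! j ≡ (a ∷ rest) ! x)
      go j (yes refl) = zero , refl , V.lookup∘updateAt j γ
      go j (no i≢) = suc (suc k F.↑ʳ F.punchOut i≢) , eq₁ , trans (V.lookup∘updateAt′ j i (i≢ ∘ sym) γ) eq₁
        where
        eq₁ : γ ! j ≡ rest ! (suc k F.↑ʳ F.punchOut i≢)
        eq₁ = sym (trans (V.lookup-++ʳ γ' _ (F.punchOut i≢)) (trans (lookup-⟨⟩ γ others _)
                (cong (γ !_) (trans (lookup-tab (F.punchIn i) (F.punchOut i≢)) (F.punchIn-punchOut i≢)))))

  -- Coordinate `i` is chosen within the `i`-th of `k` disjoint blocks of `s` atoms, which yields
  -- `s ^ k` injective tuples. If two of them differ at `i`, the atom of one at `i` does not occur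
  -- in the other at all, so by `sensitive-range` their objects differ: too many active objects.
  all-sensitive⇒⊥ : d < k → k ≤ K → (L : List (El Form k)) → Good K (Nm K) L → ActL L → (∀ i → Sensitive L i) → ⊥
  all-sensitive⇒⊥ {k} d<k k≤ L g act sens = Act-bound d<k k≤ (λ x → obj L (γ x)) (λ x → act (iγ x)) distinct
    where
    ks≤N : k * s ≤ N
    ks≤N = ≤-trans (*-monoˡ-≤ s k≤) hs
    pt : Fin (s ^ k) → Fin k → Fin N
    pt x i = F.inject≤ (F.combine i (F.finToFun x i)) ks≤N
    γ : Fin (s ^ k) → Tup N k
    γ x = V.tabulate (pt x)
    pt-inj : ∀ x y i j → (γ x) ! i ≡ (γ y) ! j → F.combine i (F.finToFun x i) ≡ F.combine j (F.finToFun y j)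
    pt-inj x y i j q = F.inject≤-injective ks≤N ks≤N _ _
      (trans (sym (lookup-tab (pt x) i)) (trans q (lookup-tab (pt y) j)))
    iγ : ∀ x → Inj (γ x)
    iγ x = mkInj λ i j q → F.combine-injectiveˡ i _ j _ (pt-inj x x i j q)
    distinct : ∀ x y → x ≢ y → ¬ obj L (γ x) ≈ obj L (γ y)
    distinct x y x≢y with F.any? (λ i → ¬? (F.finToFun x i F.≟ F.finToFun y i))
    ... | yes (i , ne) = sensitive-range k≤ L g sens (iγ x) i λ j q →
      let r = pt-inj y x j i q ; j≡i = F.combine-injectiveˡ j _ i _ r in
      ne (trans (sym (F.combine-injectiveʳ j _ i _ r)) (cong (F.finToFun y) j≡i))
    ... | no ¬any = ⊥-elim (x≢y (trans (sym (F.funToFin-finToFin {k} {s} x)) (trans (funToFin-cong _ _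
          (λ i → decidable-stable (_ F.≟ _) λ ne → ¬any (i , ne))) (F.funToFin-finToFin {k} {s} y))))
      where
      funToFin-cong : ∀ {k} (f g : Fin k → Fin s) → (∀ i → f i ≡ g i) → F.funToFin f ≡ F.funToFin g
      funToFin-cong {zero}  f g h = refl
      funToFin-cong {suc k} f g h = cong₂ F.combine (h zero) (funToFin-cong _ _ (h ∘ suc))

  punchV : Fin (suc k) → Tup (suc k) k
  punchV i = V.tabulate (F.punchIn i)

  Inj-punchV : (i : Fin (suc k)) → Inj (punchV i)
  Inj-punchV i = mkInj λ x y q →
    F.punchIn-injective i x y (trans (sym (lookup-tab (F.punchIn i) x)) (trans q (lookup-tab (F.punchIn i) y)))

  drop-same : {L : List (El Form (suc k))} (i : Fin (suc k)) → Droppable L i → N ≤ n →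
    {γ β : Tup n (suc k)} → Inj γ → Inj β → β ⟨ punchV i ⟩ ≡ γ ⟨ punchV i ⟩ → obj L γ ≈ obj L β
  drop-same {L = L} i dr hn {γ} {β} iγ iβ q = go (γ ! i F.≟ β ! i)
    where
    away : ∀ j → i ≢ j → β ! j ≡ γ ! j
    away j i≢ = subst (λ x → β ! x ≡ γ ! x) (F.punchIn-punchOut i≢)
      (subst (λ x → β ! x ≡ γ ! x) (lookup-tab (F.punchIn i) (F.punchOut i≢))
        (trans (sym (lookup-⟨⟩ β (punchV i) (F.punchOut i≢)))
          (trans (cong (λ v → v ! (F.punchOut i≢)) q) (lookup-⟨⟩ γ (punchV i) (F.punchOut i≢)))))
    go : Dec (γ ! i ≡ β ! i) → obj L γ ≈ obj L β
    go (yes r) = ≡⇒≈ (cong (obj L) (vec-ext λ j → h j (i F.≟ j)))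
      where
      h : ∀ j → Dec (i ≡ j) → γ ! j ≡ β ! j
      h j (yes refl) = r
      h j (no i≢)    = sym (away j i≢)
    go (no r) = ≈-trans (dr hn iγ (λ j → a∉ j (i F.≟ j)))
                  (≡⇒≈ (cong (obj L) (vec-ext λ j → h j (i F.≟ j))))
      where
      a∉ : ∀ j → Dec (i ≡ j) → γ ! j ≢ β ! i
      a∉ j (yes refl) q' = r q'
      a∉ j (no i≢)    q' = i≢ (sym (inj iβ _ _ (trans (away j i≢) q')))
      h : ∀ j → Dec (i ≡ j) → (γ V.[ i ]≔ β ! i) ! j ≡ β ! j
      h j (yes refl) = V.lookup∘updateAt j γ
      h j (no i≢)    = trans (V.lookup∘updateAt′ j i (i≢ ∘ sym) γ) (sym (away j i≢))

  -- The graft is the union of the objects over all values of the dropped coordinate, and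
  -- droppability makes these objects equal.
  drop-obj : {L : List (El Form (suc k))} → Good K (Nm K) L → (i : Fin (suc k)) → Droppable L i → N ≤ n →
    {γ : Tup n (suc k)} → Inj γ → obj L γ ≈ obj (graft (punchV i) L) (γ ⟨ punchV i ⟩)
  drop-obj {L = L} g i dr hn {γ} iγ = set≈
    (λ x∈ → case inst⁻ x∈ of λ { (_ , φ , β , p , refl) → ∈⇒∈ₛ (inst⁺ (graft⁺ {κ = punchV i} refl p)) })
    (λ x∈ → case inst⁻ x∈ of λ { (_ , φ , β , p , refl) →
      let β' , iβ' , q , r = graft⁻ {P = Nm K} {L = L} g p
      in elems≈ (≈-sym (drop-same {L = L} i dr hn iγ iβ' q)) (∈⇒∈ₛ (inst⁺ r)) })

  search : {A B : Fin k → Set} → (∀ i → A i ⊎ B i) → (∃[ i ] A i) ⊎ (∀ i → B i)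
  search {zero}  h = inj₂ λ ()
  search {suc k} h with h zero | search (h ∘ suc)
  ... | inj₁ x | _            = inj₁ (zero , x)
  ... | inj₂ _ | inj₁ (i , x) = inj₁ (suc i , x)
  ... | inj₂ y | inj₂ ys      = inj₂ λ { zero → y ; (suc i) → ys i }

  record Shrunk (P : ∀ {c} → Form c → Set) {k : ℕ} (L : List (El Form k)) : Set where
    field
      {size'} : ℕ
      θ  : Tup k size'
      L' : List (El Form size')
      size≤ : size' ≤ d
      θ-inj : Inj θ
      good : Good K P L'
      agree : ∀ {n} → N ≤ n → {γ : Tup n k} → Inj γ → obj L γ ≈ obj L' (γ ⟨ θ ⟩)

  -- Positions are dropped until at most `d` remain; as long as there are more, not all can be
  -- sensitive. Only selections change, never the element forms, so any property `P` of these
  -- survives, in particular normality.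
  shrink : {P : ∀ {c} → Form c → Set} → (∀ {c} {φ : Form c} → P φ → Nm K φ) →
    ∀ {k} (L : List (El Form k)) → k ≤ K → Good K P L → ActL L → Shrunk P L
  shrink {P} P⇒ {k} L k≤ g act with k ≤? d
  ... | yes k≤d = record
    { θ = idV ; L' = L ; size≤ = k≤d ; θ-inj = Inj-id ; good = g
    ; agree = λ hn {γ} _ → ≡⇒≈ (cong (obj L) (sym (⟨id⟩ γ))) }
  shrink {P} P⇒ {zero} L k≤ g act | no k≰d = ⊥-elim (k≰d z≤n)
  shrink {P} P⇒ {suc k} L k≤ g act | no k≰d with search (droppable? k≤ L (Good-mono ≤-refl P⇒ g))
  ... | inj₂ sens = ⊥-elim (all-sensitive⇒⊥ (≰⇒> k≰d) k≤ L (Good-mono ≤-refl P⇒ g) act sens)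
  ... | inj₁ (i , dr) = record
    { θ = punchV i ⟨ R.θ ⟩ ; L' = R.L' ; size≤ = R.size≤ ; θ-inj = Inj-⟨⟩ (Inj-punchV i) R.θ-inj ; good = R.good
    ; agree = λ hn {γ} iγ → ≈-trans (drop-obj gK i dr hn iγ)
        (subst (λ δ → _ ≈ obj R.L' δ) (sym (⟨⟩-assoc γ (punchV i) R.θ)) (R.agree hn (Inj-⟨⟩ iγ (Inj-punchV i)))) }
    where
    gK = Good-mono ≤-refl P⇒ g
    act' : ActL (graft (punchV i) L)
    act' {γ} iγ =
      let β , iβ , q = leaf (punchV i) γ (Inj-punchV i) iγ
            (≤-trans (+-mono-≤ k≤ (≤-trans (n≤1+n k) k≤)) (≤-trans (2≤quad K) hN))
      in Act-resp (subst (λ δ → obj L β ≈ obj (graft (punchV i) L) δ) q (drop-obj gK i dr ≤-refl iβ)) (act iβ)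
    module R = Shrunk (shrink {P} P⇒ (graft (punchV i) L) (≤-trans (n≤1+n k) k≤)
                 (Good-graft {P = P} (Inj-punchV i) g) act')

  record Thin {c : ℕ} (b : ℕ) (φ : Form c) : Set where
    field
      {width} : ℕ
      width≤  : width ≤ b
      atoms-used : Tup c width
      core    : Form width
      is-ren  : φ ≡ ren atoms-used core
  open Thin

  NF : Form c → Set
  NF φ = Thin (suc d) φ × Nm e φ

  NF⇒Nm : {φ : Form c} → NF φ → Nm K φ
  NF⇒Nm (_ , p) = Nm-mono he _ p

  module _ {k} (L : List (El Form k)) (k≤ : k ≤ d) (g : Good K NF L) where

    record PruneEl {c} (κ : Tup c k) (φ : Form c) (M : List (El Form k)) : Set where
      field
        good-M : Good e (Nm e) M
        fwd-M  : ∀ {n} → N ≤ n → {β : Tup n c} → Inj β →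
                 Σ ℕ λ c' → Σ (Form c') λ χ → ∃[ δ ] (Inst M (β ⟨ κ ⟩) χ δ × ⟦ φ ⟧ β ≡ ⟦ χ ⟧ δ)
        bwd-M  : ∀ {n} → N ≤ n → {γ : Tup n k} → ∀ {c'} {χ : Form c'} {δ} → Inst M γ χ δ →
                 ∃[ β ] (Inj β × β ⟨ κ ⟩ ≡ γ × ⟦ φ ⟧ β ≡ ⟦ χ ⟧ δ)
    open PruneEl

    -- The element names at most `suc d` atoms and shares `k` with its set; every other position of
    -- its context is idle and is discarded.
    prune-el : ∀ {c} {κ : Tup c k} {φ} → el κ φ ∈ L → Σ (List (El Form k)) (PruneEl κ φ)
    prune-el {c} {κ} {φ} p with g p
    ... | c≤ , iκ , record { width = l ; width≤ = l≤ ; atoms-used = θ ; core = x₀ ; is-ren = refl } , nφ =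
      el (inrV l k) (ren ι x₀) ∷ [] , record
        { good-M = λ { (here refl) → l+k≤ , Inj-inrV {l} , Nm-ren-same same nφ }
        ; fwd-M = λ hn {β} iβ → let γ , iγ , q , r = fwd (≤-trans (+-mono-≤ l+k≤K l+k≤K) (≤-trans (2≤quad K) (≤-trans hN hn))) iβ
            in _ , ren ι x₀ , γ , inst (here refl) iγ q , trans (⟦ren⟧ θ x₀ β) (trans (cong ⟦ x₀ ⟧ (sym r)) (sym (⟦ren⟧ ι x₀ γ)))
        ; bwd-M = λ { hn {δ = δ} (inst (here refl) iδ refl) →
            let β , iβ , q , r = bwd (≤-trans (+-mono-≤ c≤ l+k≤K) (≤-trans (2≤quad K) (≤-trans hN hn))) iδ
            in β , iβ , q , trans (⟦ren⟧ θ x₀ β) (trans (cong ⟦ x₀ ⟧ (sym r)) (sym (⟦ren⟧ ι x₀ δ))) } }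
      where
      open Pruned (prune κ iκ θ)
      l+k≤ : l + k ≤ e
      l+k≤ = +-mono-≤ l≤ k≤
      l+k≤K = ≤-trans l+k≤ he

    private gath = gather {Q = PruneEl} L prune-el

    pruned : List (El Form k)
    pruned = proj₁ gath

    pruned-good : Good e (Nm e) pruned
    pruned-good p = let _ , _ , _ , _ , _ , q , r = proj₁ (proj₂ gath) p in good-M q r

    pruned-obj : ∀ {n} → N ≤ n → (γ : Tup n k) → obj L γ ≈ obj pruned γ
    pruned-obj hn γ = set≈ to from
      where
      to : ∀ {x} → x ∈ ⟦ L ⟧* γ → x ∈ₛ ⟦ pruned ⟧* γ
      to x∈ with inst⁻ {L = L} {γ} x∈
      ... | c , φ , β , inst p i refl , refl with proj₂ (proj₂ gath) p
      ... | M , q , sub with fwd-M q hn i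
      ... | c' , χ , δ , inst r j e' , v = subst (_∈ₛ _) (sym v) (∈⇒∈ₛ (inst⁺ (inst (sub r) j e')))
      from : ∀ {x} → x ∈ ⟦ pruned ⟧* γ → x ∈ₛ ⟦ L ⟧* γ
      from x∈ with inst⁻ {L = pruned} {γ} x∈
      ... | c' , χ , δ , inst p i e' , refl with proj₁ (proj₂ gath) p
      ... | c , κ , φ , M , p' , q , r with bwd-M q hn (inst r i e')
      ... | β , iβ , e'' , v = subst (_∈ₛ _) v (∈⇒∈ₛ (inst⁺ (inst p' iβ e'')))

  record Normal {c : ℕ} (φ : Form c) : Set where
    field
      form'  : Form c
      normal : NF form'
      equal  : ∀ {n} → N ≤ n → {β : Tup n c} → Inj β → ⟦ φ ⟧ β ≈ ⟦ form' ⟧ β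
  open Normal

  normalise : (φ : Form c) → c ≤ K → Nm K φ → ActF φ → Normal φ
  normalise φ₀ = Form-ind (λ {c} φ → c ≤ K → Nm K φ → ActF φ → Normal φ) atom-case set-case φ₀
    where
    atom-case : ∀ {c} (i : Fin c) → c ≤ K → Nm K (at i) → ActF (at i) → Normal (at i)
    atom-case i _ _ _ = record
      { form' = at i
      ; normal = record { width≤ = s≤s z≤n ; atoms-used = i ∷ [] ; core = at zero ; is-ren = refl } , at
      ; equal = λ _ _ → ≈-refl _ }
    set-case : ∀ {c k} (θ : Tup c k) L →
      (∀ {c' κ} {φ : Form c'} → el κ φ ∈ L → c' ≤ K → Nm K φ → ActF φ → Normal φ) →
      c ≤ K → Nm K (clo θ L) → ActF (clo θ L) → Normal (clo θ L)
    set-case {c} {k} θ L ih c≤ (clo k≤ iθ g) act = record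
      { form' = clo (θ ⟨ R.θ ⟩) L₃
      ; normal = record { width≤ = ≤-trans R.size≤ (n≤1+n d) ; atoms-used = θ ⟨ R.θ ⟩ ; core = clo idV L₃
                        ; is-ren = cong (λ δ → clo δ L₃) (sym (⟨id⟩ _)) } ,
                 clo (≤-trans R.size≤ (m≤n+m d (suc d))) (Inj-⟨⟩ iθ R.θ-inj) (pruned-good R.L' R.size≤ R.good)
      ; equal = λ hn {β} iβ → ≈-trans (L≈L₁ hn (β ⟨ θ ⟩)) (≈-trans (R.agree hn (Inj-⟨⟩ iβ iθ))
          (≈-trans (pruned-obj R.L' R.size≤ R.good hn _)
            (≡⇒≈ (cong (obj L₃) (sym (⟨⟩-assoc β θ R.θ)))))) }
      where
      actL : ActL L
      actL = ActF⇒ActL c≤ k≤ {θ} {L} iθ act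
      Q : ∀ {c'} → Tup c' k → Form c' → List (El Form k) → Set
      Q {c'} κ φ M = Σ (Normal φ) λ ν → M ≡ el κ (form' ν) ∷ [] × c' ≤ K × Inj κ
      gath = gather {Q = Q} L λ {c'} {κ} {φ} p →
        let c'≤ , iκ , nφ = g p ; ν = ih p c'≤ nφ (ActL⇒ActF {L = L} {κ} {φ} iκ actL p) in _ , ν , refl , c'≤ , iκ
      L₁ = proj₁ gath
      good₁ : Good K NF L₁
      good₁ p with proj₁ (proj₂ gath) p
      ... | _ , _ , _ , _ , _ , (ν , refl , c'≤ , iκ) , here refl = c'≤ , iκ , normal ν
      L≈L₁ : ∀ {n} → N ≤ n → (γ : Tup n k) → obj L γ ≈ obj L₁ γ
      L≈L₁ hn γ = set≈ to from
        where
        to : ∀ {x} → x ∈ ⟦ L ⟧* γ → x ∈ₛ ⟦ L₁ ⟧* γ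
        to x∈ with inst⁻ {L = L} {γ} x∈
        ... | _ , φ , β , inst p i e' , refl with proj₂ (proj₂ gath) p
        ... | _ , (ν , refl , _) , sub = _ , inst⁺ (inst (sub (here refl)) i e') , equal ν hn i
        from : ∀ {x} → x ∈ ⟦ L₁ ⟧* γ → x ∈ₛ ⟦ L ⟧* γ
        from x∈ with inst⁻ {L = L₁} {γ} x∈
        ... | _ , χ , δ , inst p i e' , refl with proj₁ (proj₂ gath) p
        ... | _ , _ , _ , _ , p' , (ν , refl , _) , here refl = _ , inst⁺ (inst p' i e') , ≈-sym (equal ν hn i)
      act₁ : ActL L₁
      act₁ {γ} iγ = Act-resp (L≈L₁ ≤-refl γ) (actL iγ)
      module R = Shrunk (shrink {NF} NF⇒Nm L₁ k≤ good₁ act₁)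
      L₃ = pruned R.L' R.size≤ R.good

  inlV : ∀ m k → Tup (m + k) m
  inlV m k = V.tabulate (_↑ˡ k)

  ⟨inl⟩ : {A : Set} (α : Vec A m) (β : Vec A k) → (α V.++ β) ⟨ inlV m k ⟩ ≡ α
  ⟨inl⟩ {k = k} α β = vec-ext λ i → trans (lookup-⟨⟩ (α V.++ β) (inlV _ k) i)
    (trans (cong ((α V.++ β) !_) (lookup-tab (_↑ˡ k) i)) (V.lookup-++ˡ α β i))

  opaque
    unfolding inrV
    ⟨inr⟩ : {A : Set} (α : Vec A m) (β : Vec A k) → (α V.++ β) ⟨ inrV m k ⟩ ≡ β
    ⟨inr⟩ {m = m} {k = k} α β = vec-ext λ i → trans (lookup-⟨⟩ (α V.++ β) (inrV m k) i)
      (trans (cong ((α V.++ β) !_) (lookup-tab (m ↑ʳ_) i)) (V.lookup-++ʳ α β i))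

  record Thins {c : ℕ} (b : ℕ) (φs : List (Form c)) : Set where
    field
      {width} : ℕ
      width≤  : width ≤ length φs * b
      atoms-used : Tup c width
      cores   : List (Form width)
      are-ren : φs ≡ map (ren atoms-used) cores

  thins : ∀ {b} (φs : List (Form c)) → (∀ {φ} → φ ∈ φs → Thin b φ) → Thins b φs
  thins [] h = record { width≤ = z≤n ; atoms-used = [] ; cores = [] ; are-ren = refl }
  thins (φ ∷ φs) h with h (here refl) | thins φs (h ∘ there)
  ... | record { width = l ; width≤ = l≤ ; atoms-used = θ ; core = x ; is-ren = refl }
      | record { width = l' ; width≤ = l'≤ ; atoms-used = θ' ; cores = xs ; are-ren = refl } = record
    { width≤ = +-mono-≤ l≤ l'≤ ; atoms-used = θ V.++ θ'
    ; cores = ren (inlV l l') x ∷ map (ren (inrV l l')) xs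
    ; are-ren = cong₂ _∷_ (sym (trans (ren-ren _ _ x) (cong (λ σ → ren σ x) (⟨inl⟩ θ θ'))))
        (sym (trans (sym (map-∘ xs)) (map-cong (λ y → trans (ren-ren _ _ y) (cong (λ σ → ren σ y) (⟨inr⟩ θ θ'))) xs))) }

  record NormalU {κ c : ℕ} (u : UpdF κ c) : Set where
    field
      u'      : UpdF κ c
      len     : length (args u') ≤ ar
      normals : ∀ {φ} → φ ∈ val u' ∷ args u' → NF φ
      locs    : ∀ {n} → N ≤ n → {β : Tup n c} → Inj β → locOf u β ≈ˡ locOf u' β
      vals    : ∀ {n} → N ≤ n → {β : Tup n c} → Inj β → valOf u β ≈ valOf u' β

  normaliseU : {κ : ℕ} (u : UpdF κ c) → c ≤ K → NmU ar K u → (∀ {φ} → φ ∈ val u ∷ args u → ActF φ) → NormalU u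
  normaliseU {c} (upF f φs φ) c≤ (len , nφs , nφ) act = record
    { u' = upF f (proj₁ as) (form' v)
    ; len = subst (_≤ ar) (sym (proj₁ (proj₂ as))) len
    ; normals = λ { (here refl) → normal v ; (there p) → proj₁ (proj₂ (proj₂ as)) p }
    ; locs = λ hn iβ → loc≈ (proj₂ (proj₂ (proj₂ as)) hn iβ)
    ; vals = λ hn iβ → equal v hn iβ }
    where
    v = normalise φ c≤ nφ (act (here refl))
    all : (φs : List (Form c)) → AllNm K φs → (∀ {φ} → φ ∈ φs → ActF φ) → Σ (List (Form c)) λ ψs →
      length ψs ≡ length φs × (∀ {ψ} → ψ ∈ ψs → NF ψ) ×
      (∀ {n} → N ≤ n → {β : Tup n c} → Inj β → values φs β ≈ᵃ values ψs β)
    all [] _ _ = [] , refl , (λ ()) , λ _ _ → ≈ᵃ-refl []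
    all (φ ∷ φs) p q =
      let ν = normalise φ c≤ (p (here refl)) (q (here refl)) ; ψs , l , h , k = all φs (p ∘ there) (q ∘ there)
      in form' ν ∷ ψs , cong suc l , (λ { (here refl) → normal ν ; (there r) → h r }) ,
         λ hn iβ → ∷≈ᵃ (equal ν hn iβ) (k hn iβ)
    as = all φs nφs (λ p → act (there p))

  module _ {κ : ℕ} (Γ : List (El (UpdF κ) 0)) (g : Good K (NmU ar K) Γ)
    (act : ∀ {c} {κ' : Tup c 0} {u} → el κ' u ∈ Γ → ∀ {φ} → φ ∈ val u ∷ args u → ActF φ) where

    record NormEl {c} (κ' : Tup c 0) (u : UpdF κ c) (M : List (El (UpdF κ) 0)) : Set where
      field
        good-M : Good b' (NmU ar b') M
        fwd-M  : ∀ {n} → N ≤ n → {β : Tup n c} → Inj β →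
                 Σ ℕ λ c' → Σ (UpdF κ c') λ w → ∃[ δ ] (Inst M [] w δ × locOf u β ≈ˡ locOf w δ × valOf u β ≈ valOf w δ)
        bwd-M  : ∀ {n} → N ≤ n → ∀ {c'} {w : UpdF κ c'} {δ : Tup n c'} → Inst M [] w δ →
                 ∃[ β ] (Inj β × locOf u β ≈ˡ locOf w δ × valOf u β ≈ valOf w δ)
    open NormEl

    norm-el : ∀ {c} {κ' : Tup c 0} {u} → el κ' u ∈ Γ → Σ (List (El (UpdF κ) 0)) (NormEl κ' u)
    norm-el {c} {κ'} {u} p with g p
    ... | c≤ , iκ , nu with normaliseU u c≤ nu (act p)
    ... | record { u' = upF f φs φ ; len = len ; normals = nf ; locs = locs ; vals = vals }
      with thins (φ ∷ φs) (λ q → proj₁ (nf q))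
    ... | record { width = l ; width≤ = l≤ ; atoms-used = θ ; cores = x ∷ xs ; are-ren = refl } =
      el (inrV l 0) w ∷ [] , record
        { good-M = λ { (here refl) → l+0≤ , Inj-[] ,
            subst (_≤ ar) (trans (length-map (ren θ) xs) (sym (length-map (ren ι) xs))) len ,
            (λ q → let y , y∈ , e' = ∈-map⁻ (ren ι) q in
              subst (Nm b') (sym e') (Nm-mono e≤b' _ (Nm-ren-same {θ = θ} {ι} {y} same (proj₂ (nf (there (∈-map⁺ (ren θ) y∈))))))) ,
            Nm-mono e≤b' _ (Nm-ren-same {θ = θ} {ι} {x} same (proj₂ (nf (here refl)))) }
        ; fwd-M = λ hn {β} iβ →
            let γ , iγ , _ , r = fwd (≤-trans (+-mono-≤ l+0≤K l+0≤K) (≤-trans (2≤quad K) (≤-trans hN hn))) iβ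
            in _ , w , γ , inst (here refl) iγ ([]-unique _ _) , ≈ˡ-trans (locs hn iβ) (same-loc r) , ≈-trans (vals hn iβ) (same-val r)
        ; bwd-M = λ { hn {δ = δ} (inst (here refl) iδ _) →
            let β , iβ , _ , r = bwd (≤-trans (+-mono-≤ c≤ l+0≤K) (≤-trans (2≤quad K) (≤-trans hN hn))) iδ
            in β , iβ , ≈ˡ-trans (locs hn iβ) (same-loc r) , ≈-trans (vals hn iβ) (same-val r) } }
      where
      open Pruned (prune κ' iκ θ)
      w : UpdF κ (l + 0)
      w = upF f (map (ren ι) xs) (ren ι x)
      l+0≤ : l + 0 ≤ b'
      l+0≤ = +-mono-≤ (≤-trans l≤ (*-monoˡ-≤ (suc d) (s≤s len))) z≤n
      l+0≤K = ≤-trans l+0≤ hb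
      same-loc : ∀ {n} {γ : Tup n (l + 0)} {β : Tup n c} → γ ⟨ ι ⟩ ≡ β ⟨ θ ⟩ →
                 locOf (upF f (map (ren θ) xs) (ren θ x)) β ≈ˡ locOf w γ
      same-loc {γ = γ} {β} r = ≡⇒≈ˡ (cong (f ,_) (trans (values-ren θ xs β)
        (trans (cong (values xs) (sym r)) (sym (values-ren ι xs γ)))))
      same-val : ∀ {n} {γ : Tup n (l + 0)} {β : Tup n c} → γ ⟨ ι ⟩ ≡ β ⟨ θ ⟩ → ⟦ ren θ x ⟧ β ≈ ⟦ ren ι x ⟧ γ
      same-val {γ = γ} {β} r = ≡⇒≈ (trans (⟦ren⟧ θ x β) (trans (cong ⟦ x ⟧ (sym r)) (sym (⟦ren⟧ ι x γ))))

    -- Activity was used over `N` alone, but the equalities obtained hold from `N` on, so the new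
    -- list tracks every state that `Γ` tracks there.
    normalise-state : Σ (List (El (UpdF κ) 0)) λ Γ' → Good b' (NmU ar b') Γ' ×
      (∀ {n} → N ≤ n → {st : List (UpdK κ n)} → Tracks st Γ → Tracks st Γ')
    normalise-state = proj₁ gath ,
      (λ p → let _ , _ , _ , _ , _ , q , r = proj₁ (proj₂ gath) p in good-M q r) ,
      λ hn tr → record
        { sound = λ p lw → let _ , _ , _ , q , ls , vs = back hn p in ≈-trans (sound tr q (≈ˡ-trans lw (≈ˡ-sym ls))) vs
        ; complete = λ l → case complete tr l of λ
            { (inj₁ r) → inj₁ r
            ; (inj₂ (c , u , β , inst p i _ , lu)) →
                let M , q , sub = proj₂ (proj₂ gath) p
                in case fwd-M q hn i of λ { (c' , w , δ , inst r j e' , ls , vs) →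
                     inj₂ (c' , w , δ , inst (sub r) j e' , ≈ˡ-trans lu ls) } }
        ; nonempty = λ p em → let _ , _ , _ , q , _ , vs = back hn p in nonempty tr q (≈-trans vs em) }
      where
      gath = gather {Q = NormEl} Γ norm-el
      back : ∀ {n} → N ≤ n → ∀ {c'} {w : UpdF κ c'} {δ : Tup n c'} → Inst (proj₁ gath) [] w δ →
             Σ ℕ λ c → Σ (UpdF κ c) λ u → ∃[ β ] (Inst Γ [] u β × locOf u β ≈ˡ locOf w δ × valOf u β ≈ valOf w δ)
      back hn (inst p i e') =
        let _ , _ , u , _ , p' , q , r = proj₁ (proj₂ gath) p
            β , iβ , ls , vs = bwd-M q hn (inst r i e')
        in _ , u , β , inst p' iβ ([]-unique _ _) , ls , vs

-- Active elements

tc-self : (x : HF n) → x ∈ tc x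
tc-self (atom a) = here refl
tc-self (set xs) = here refl

∈-tcL⁺ : {xs : List (HF n)} {x y : HF n} → x ∈ xs → y ∈ tc x → y ∈ tcL xs
∈-tcL⁺ (here refl) q = ∈-++⁺ˡ q
∈-tcL⁺ {xs = z ∷ _} (there p) q = ∈-++⁺ʳ (tc z) (∈-tcL⁺ p q)

∈-tcL⁻ : {xs : List (HF n)} {y : HF n} → y ∈ tcL xs → ∃[ x ] (x ∈ xs × y ∈ tc x)
∈-tcL⁻ {xs = x ∷ xs} p with ∈-++⁻ (tc x) p
... | inj₁ q = x , here refl , q
... | inj₂ q = let z , z∈ , r = ∈-tcL⁻ q in z , there z∈ , r

tc-elems : (z : HF n) → ∀ {x y} → x ∈ tc z → y ∈ elems x → y ∈ tc z
tc-elems = HF-ind (λ { a (here refl) () }) λ xs ih → λ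
  { (here refl) q → there (∈-tcL⁺ q (tc-self _))
  ; (there p) q → let z , z∈ , r = ∈-tcL⁻ p in there (∈-tcL⁺ z∈ (ih z∈ r q)) }

tc-cong : (z : HF n) → ∀ {z' x} → z ≈ z' → x ∈ tc z → x ∈ₛ tc z'
tc-cong = HF-ind {P = λ z → ∀ {z' x} → z ≈ z' → x ∈ tc z → x ∈ₛ tc z'}
  (λ { a {z'} e (here refl) → z' , tc-self z' , e })
  λ { xs ih {z'} e (here refl) → z' , tc-self z' , e
    ; xs ih {set ys} e (there p) →
        let z , z∈ , r = ∈-tcL⁻ p ; w , w∈ , e' = set≈→ e z∈ ; y , y∈ , e'' = ih z∈ e' r
        in y , there (∈-tcL⁺ w∈ y∈) , e''
    ; xs ih {atom a} (eqv ()) (there p) }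

active : List (UpdK k n) → List (HF n)
active st = concatMap tc (critical st)

∈-active⁺ : (st : List (UpdK k n)) {z x : HF n} → z ∈ₛ critical st → x ∈ tc z → x ∈ₛ active st
∈-active⁺ st (z' , z'∈ , e) p = let y , y∈ , e' = tc-cong _ e p in y , ∈-concat⁺′ y∈ (∈-map⁺ tc z'∈) , e'

∈-active⁻ : (st : List (UpdK k n)) {x : HF n} → x ∈ active st → ∃[ z ] (z ∈ critical st × x ∈ tc z)
∈-active⁻ st p with ∈-concat⁻′ (map tc (critical st)) p
... | _ , q , r with ∈-map⁻ tc r
... | z , z∈ , refl = z , z∈ , q

removeLoc⁻ : (l : LocK k n) (st : List (UpdK k n)) → ∀ {u} → u ∈ removeLoc l st → u ∈ st × ¬ l ≈ˡ proj₁ u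
removeLoc⁻ l ((l' , v) ∷ st) p with eqLoc l l' in e
... | true = let q , r = removeLoc⁻ l st p in there q , r
removeLoc⁻ l ((l' , v) ∷ st) (here refl) | false = here refl , λ (eqvˡ r) → false≢true e r
removeLoc⁻ l ((l' , v) ∷ st) (there p)   | false = let q , r = removeLoc⁻ l st p in there q , r

removeLoc⁺ : (l : LocK k n) (st : List (UpdK k n)) → ∀ {u} → u ∈ st → ¬ l ≈ˡ proj₁ u → u ∈ removeLoc l st
removeLoc⁺ l ((l' , v) ∷ st) p h with eqLoc l l' in e
removeLoc⁺ l ((l' , v) ∷ st) (here refl) h | true = ⊥-elim (h (eqvˡ e))
removeLoc⁺ l ((l' , v) ∷ st) (there p) h   | true = removeLoc⁺ l st p h
removeLoc⁺ l ((l' , v) ∷ st) (here refl) h | false = here refl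
removeLoc⁺ l ((l' , v) ∷ st) (there p) h   | false = there (removeLoc⁺ l st p h)

current⁻ : (st : List (UpdK k n)) → ∀ {l v} → (l , v) ∈ current st → lookupSt l st ≡ v
current⁻ ((l' , v') ∷ st) {l} {v} p with eqLoc l l' in e
current⁻ ((l' , v') ∷ st) (here refl) | true = refl
current⁻ ((l' , v') ∷ st) (there p)   | true =
  ⊥-elim (proj₂ (removeLoc⁻ l' (current st) p) (≈ˡ-sym (eqvˡ e)))
current⁻ ((l' , v') ∷ st) (here refl) | false = false≢true e (holdsˡ (≈ˡ-refl l'))
current⁻ ((l' , v') ∷ st) (there p)   | false = current⁻ st (proj₁ (removeLoc⁻ l' (current st) p))

current⁺ : (st : List (UpdK k n)) → ∀ {l} → ¬ lookupSt l st ≈ emptyS →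
           ∃[ l' ] ((l' , lookupSt l st) ∈ current st × l ≈ˡ l')
current⁺ [] h = ⊥-elim (h (≈-refl emptyS))
current⁺ ((l' , v') ∷ st) {l} h with eqLoc l l' in e
... | true  = l' , here refl , eqvˡ e
... | false = let l'' , p , q = current⁺ st h in
  l'' , there (removeLoc⁺ l' (current st) p λ r → false≢true e (holdsˡ (≈ˡ-trans q (≈ˡ-sym r)))) , q

crit : UpdK k n → List (HF n)
crit ((f , args) , v) = if eqHF v emptyS then [] else v ∷ args

∈-critical⁺ : (st : List (UpdK k n)) → ∀ {l v x} → (l , v) ∈ current st → ¬ v ≈ emptyS → x ∈ v ∷ proj₂ l → x ∈ critical st
∈-critical⁺ {n = n} st {l} {v} p h q = there (there (there (∈-++⁺ʳ (map atom (allFin n)) (∈-concat⁺′ (lem q) (∈-map⁺ _ p)))))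
  where
  lem : ∀ {x} → x ∈ v ∷ proj₂ l → x ∈ crit (l , v)
  lem q with eqHF v emptyS in e
  ... | true  = ⊥-elim (h (eqv e))
  ... | false = q

data Critical {k n : ℕ} (st : List (UpdK k n)) : HF n → Set where
  c-empty : Critical st emptyS
  c-true  : Critical st trueS
  c-atoms : Critical st atomSet
  c-atom  : ∀ a → Critical st (atom a)
  c-upd   : ∀ {l v x} → (l , v) ∈ current st → ¬ v ≈ emptyS → x ∈ v ∷ proj₂ l → Critical st x

∈-critical⁻ : (st : List (UpdK k n)) → ∀ {x} → x ∈ critical st → Critical st x
∈-critical⁻ st (here refl) = c-empty
∈-critical⁻ st (there (here refl)) = c-true
∈-critical⁻ st (there (there (here refl))) = c-atoms
∈-critical⁻ {n = n} st (there (there (there p))) with ∈-++⁻ (map atom (allFin n)) p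
... | inj₁ q = let a , _ , e = ∈-map⁻ atom q in subst (Critical st) (sym e) (c-atom a)
... | inj₂ q with ∈-concat⁻′ (map _ (current st)) q
... | _ , r , s with ∈-map⁻ _ s
... | (l , v) , t , refl = lem r refl
  where
  lem : ∀ {x} → x ∈ crit (l , v) → ∀ {y} → x ≡ y → Critical st y
  lem r refl with eqHF v emptyS in e
  ... | false = c-upd t (λ (eqv e') → false≢true e e') r

value-∈ : {xs ys : List (HF n)} → xs ≈ᵃ ys → ∀ {x} → x ∈ xs → x ∈ₛ ys
value-∈ {xs = x ∷ xs} {y ∷ ys} p (here refl) = y , here refl , proj₁ (≈ᵃ∷ p)
value-∈ {xs = x ∷ xs} {y ∷ ys} p (there q)   = let z , z∈ , e = value-∈ (proj₂ (≈ᵃ∷ p)) q in z , there z∈ , e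
value-∈ {xs = x ∷ xs} {[]} (eqvᵃ ()) q

module _ {k n : ℕ} {st : List (UpdK k n)} {Γ : List (El (UpdF k) 0)} (tr : Tracks st Γ) where

  -- As its value is not ∅, the entry occurs in `current` and contributes its value and arguments.
  -- This is what makes the forms of a symbolic state active and subject to `normalise`.
  upd-critical : ∀ {c} {u : UpdF k c} {β} → Inst Γ [] u β → ∀ {φ} → φ ∈ val u ∷ args u → ⟦ φ ⟧ β ∈ₛ critical st
  upd-critical {u = u} {β} p {φ} q with current⁺ st {locOf u β} (λ e → nonempty tr p (≈-trans (≈-sym v≈) e))
    where v≈ = sound tr p (≈ˡ-refl (locOf u β))
  ... | l' , r , e with sound tr p (≈ˡ-refl (locOf u β)) | ≈loc e
  ... | v≈ | refl , as = lem q
    where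
    v≉ : ¬ lookupSt (locOf u β) st ≈ emptyS
    v≉ e' = nonempty tr p (≈-trans (≈-sym v≈) e')
    lem : ∀ {φ} → φ ∈ val u ∷ args u → ⟦ φ ⟧ β ∈ₛ critical st
    lem (here refl) = _ , ∈-critical⁺ st r v≉ (here refl) , ≈-sym v≈
    lem (there s)   = let y , y∈ , e' = value-∈ as (∈-map⁺ (λ φ → ⟦ φ ⟧ β) s) in y , ∈-critical⁺ st r v≉ (there y∈) , e'

  critical-upd : ∀ {l v x} → (l , v) ∈ current st → ¬ v ≈ emptyS → x ∈ v ∷ proj₂ l →
    Σ ℕ λ c → Σ (UpdF k c) λ u → ∃[ β ] (Inst Γ [] u β × ∃[ φ ] (φ ∈ val u ∷ args u × x ≈ ⟦ φ ⟧ β))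
  critical-upd {l} {v} p h q with current⁻ st p | complete tr l
  ... | refl | inj₁ e = ⊥-elim (h e)
  ... | refl | inj₂ (c , u , β , i , e) = c , u , β , i , lem q
    where
    lem : ∀ {x} → x ∈ lookupSt l st ∷ proj₂ l → ∃[ φ ] (φ ∈ val u ∷ args u × x ≈ ⟦ φ ⟧ β)
    lem (here refl) = val u , here refl , sound tr i e
    lem (there r) with value-∈ (proj₂ (≈loc e)) r
    ... | y , y∈ , e' with ∈-map⁻ _ y∈
    ... | φ , φ∈ , refl = φ , there φ∈ , e'

-- The active elements as instances of closed forms

mutual
  -- Subforms are put into the empty context, forgetting the set in which they occur. Given enough
  -- atoms nothing is added by this, since `leaf` extends every injective tuple for a subform to one
  -- for the whole form.
  subF : Form c → List (El Form 0)
  subF (at i)    = el [] (at i) ∷ []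
  subF (clo θ L) = el [] (clo θ L) ∷ subL L

  subL : List (El Form k) → List (El Form 0)
  subL []           = []
  subL (el κ φ ∷ L) = subF φ ++ subL L

∈-subL⁺ : {L : List (El Form k)} {κ : Tup c k} {φ : Form c} {A : El Form 0} → el κ φ ∈ L → A ∈ subF φ → A ∈ subL L
∈-subL⁺ (here refl) q = ∈-++⁺ˡ q
∈-subL⁺ {L = el κ' φ' ∷ L} (there p) q = ∈-++⁺ʳ (subF φ') (∈-subL⁺ p q)

∈-subL⁻ : {L : List (El Form k)} {A : El Form 0} → A ∈ subL L →
          Σ ℕ λ c → Σ (Tup c k) λ κ → Σ (Form c) λ φ → el κ φ ∈ L × A ∈ subF φ
∈-subL⁻ {L = el κ φ ∷ L} p with ∈-++⁻ (subF φ) p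
... | inj₁ q = _ , κ , φ , here refl , q
... | inj₂ q with ∈-subL⁻ {L = L} q
... | c , κ' , φ' , r , s = c , κ' , φ' , there r , s

subF-good : ∀ {b} (φ : Form c) → c ≤ b → Nm b φ → Good b (Nm b) (subF φ)
subF-good {b = b} = Form-ind (λ {c} φ → c ≤ b → Nm b φ → Good b (Nm b) (subF φ))
  (λ { i c≤ p (here refl) → c≤ , Inj-[] , p })
  λ { θ L ih c≤ p (here refl) → c≤ , Inj-[] , p
    ; θ L ih c≤ (clo _ _ g) (there q) → let c' , κ , φ' , r , s = ∈-subL⁻ {L = L} q ; c'≤ , _ , nφ = g r in ih r c'≤ nφ s }

subF⁻ : (φ : Form c) (β : Tup n c) → Inj β → ∀ {x} → x ∈ tc (⟦ φ ⟧ β) →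
        Σ ℕ λ d → Σ (Form d) λ χ → ∃[ δ ] (Inst (subF φ) [] χ δ × x ≡ ⟦ χ ⟧ δ)
subF⁻ {n = n} = Form-ind (λ {c} φ → (β : Tup n c) → Inj β → ∀ {x} → x ∈ tc (⟦ φ ⟧ β) →
        Σ ℕ λ d → Σ (Form d) λ χ → ∃[ δ ] (Inst (subF φ) [] χ δ × x ≡ ⟦ χ ⟧ δ))
  (λ { i β iβ (here refl) → _ , at i , β , inst (here refl) iβ ([]-unique _ _) , refl })
  λ { θ L ih β iβ (here refl) → _ , clo θ L , β , inst (here refl) iβ ([]-unique _ _) , refl
    ; θ L ih β iβ (there p) → lem θ L ih β (∈-tcL⁻ p) }
  where
  lem : ∀ {m k} (θ : Tup m k) L → (∀ {c κ} {φ : Form c} → el κ φ ∈ L → (β : Tup n c) → Inj β → ∀ {x} → x ∈ tc (⟦ φ ⟧ β) →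
          Σ ℕ λ d → Σ (Form d) λ χ → ∃[ δ ] (Inst (subF φ) [] χ δ × x ≡ ⟦ χ ⟧ δ)) → (β : Tup n m) →
        ∀ {x} → ∃[ z ] (z ∈ ⟦ L ⟧* (β ⟨ θ ⟩) × x ∈ tc z) →
        Σ ℕ λ d → Σ (Form d) λ χ → ∃[ δ ] (Inst (subF (clo θ L)) [] χ δ × x ≡ ⟦ χ ⟧ δ)
  lem θ L ih β (z , z∈ , q) with inst⁻ {L = L} {β ⟨ θ ⟩} z∈
  ... | c , φ , β' , inst r iβ' _ , refl with ih r β' iβ' q
  ... | d , χ , δ , inst s i e , e' = d , χ , δ , inst (there (∈-subL⁺ r s)) i e , e'

subF⁺ : ∀ {b} → b + b ≤ n → (φ : Form c) → c ≤ b → Nm b φ → ∀ {d} {χ : Form d} {δ : Tup n d} → Inst (subF φ) [] χ δ →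
        ∃[ β ] (Inj β × ⟦ χ ⟧ δ ∈ tc (⟦ φ ⟧ β))
subF⁺ {n} {b = b} hn = Form-ind
  (λ {c} φ → c ≤ b → Nm b φ → ∀ {d} {χ : Form d} {δ : Tup n d} → Inst (subF φ) [] χ δ → ∃[ β ] (Inj β × ⟦ χ ⟧ δ ∈ tc (⟦ φ ⟧ β)))
  (λ { i c≤ p {δ = δ} (inst (here refl) iδ _) → δ , iδ , tc-self _ })
  λ { θ L ih c≤ p {δ = δ} (inst (here refl) iδ _) → δ , iδ , tc-self _
    ; θ L ih c≤ (clo k≤ iθ g) {χ = χ} {δ} (inst (there q) iδ e) →
        let c' , κ , φ' , r , s = ∈-subL⁻ {L = L} q
            c'≤ , iκ , nφ = g r
            β' , iβ' , t = ih r c'≤ nφ (inst s iδ e)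
            β , iβ , e' = leaf θ (β' ⟨ κ ⟩) iθ (Inj-⟨⟩ iβ' iκ) (≤-trans (+-mono-≤ c≤ k≤) hn)
        in β , iβ , there (∈-tcL⁺ (inst⁺ (inst r iβ' (sym e'))) t) }

updForms : El (UpdF k) 0 → List (El Form 0)
updForms (el κ u) = map (el κ) (val u ∷ args u)

criticalF : List (El (UpdF k) 0) → List (El Form 0)
criticalF Γ = el {c = 0} [] (boolF false) ∷ el {c = 0} [] (boolF true) ∷ el {c = 0} [] atomsF ∷ el {c = 1} [] (at zero) ∷
  concatMap updForms Γ

criticalF-upd⁻ : {Γ : List (El (UpdF k) 0)} {κ : Tup c 0} {φ : Form c} →
  el κ φ ∈ concatMap updForms Γ →
  Σ (UpdF k c) λ u → el κ u ∈ Γ × φ ∈ val u ∷ args u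
criticalF-upd⁻ {Γ = el κ u ∷ Γ} p with ∈-++⁻ (map (el κ) (val u ∷ args u)) p
... | inj₂ q = let u' , r , s = criticalF-upd⁻ q in u' , there r , s
... | inj₁ q with ∈-map⁻ (el κ) q
... | φ , r , refl = u , here refl , r

criticalF-upd⁺ : {Γ : List (El (UpdF k) 0)} {κ : Tup c 0} {u : UpdF k c} {φ : Form c} → el κ u ∈ Γ →
  φ ∈ val u ∷ args u → el κ φ ∈ criticalF Γ
criticalF-upd⁺ {Γ = Γ} p q = there (there (there (there (∈-concat⁺′ (∈-map⁺ (el _) q) (∈-map⁺ _ p)))))

criticalF-good : ∀ {a b} → 1 ≤ b → (Γ : List (El (UpdF k) 0)) → Good b (NmU a b) Γ → Good b (Nm b) (criticalF Γ)
criticalF-good 1≤b Γ g (here refl) = z≤n , Inj-[] , Nm-boolF false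
criticalF-good 1≤b Γ g (there (here refl)) = z≤n , Inj-[] , Nm-boolF true
criticalF-good 1≤b Γ g (there (there (here refl))) = z≤n , Inj-[] , clo z≤n Inj-[] λ { (here refl) → 1≤b , Inj-[] , at }
criticalF-good 1≤b Γ g (there (there (there (here refl)))) = 1≤b , Inj-[] , at
criticalF-good 1≤b Γ g (there (there (there (there p)))) with criticalF-upd⁻ {Γ = Γ} p
... | u , q , r with g q
... | c≤ , _ , _ , nas , nv = c≤ , Inj-[] , (case r of λ { (here refl) → nv ; (there s) → nas s })

module _ {k n : ℕ} {st : List (UpdK k n)} {Γ : List (El (UpdF k) 0)} (tr : Tracks st Γ) where

  criticalF⁺ : ∀ {c} {φ : Form c} {β : Tup n c} → Inst (criticalF Γ) [] φ β → ⟦ φ ⟧ β ∈ₛ critical st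
  criticalF⁺ (inst (here refl) _ _) = ∈⇒∈ₛ (here refl)
  criticalF⁺ {β = β} (inst (there (here refl)) _ _) = _ , there (here refl) , ≈-sym (⟦boolF⟧ true β)
  criticalF⁺ {β = β} (inst (there (there (here refl))) _ _) = _ , there (there (here refl)) , ≈-sym (⟦atomsF⟧ β)
  criticalF⁺ (inst (there (there (there (here refl)))) _ _) =
    ∈⇒∈ₛ (there (there (there (∈-++⁺ˡ (∈-map⁺ atom (∈-allFin _))))))
  criticalF⁺ (inst (there (there (there (there p)))) i _) = let u , q , r = criticalF-upd⁻ {Γ = Γ} p in
    upd-critical tr (inst q i ([]-unique _ _)) r

  criticalF⁻ : ∀ {x} → x ∈ critical st → Σ ℕ λ c → Σ (Form c) λ φ → ∃[ β ] (Inst (criticalF Γ) [] φ β × x ≈ ⟦ φ ⟧ β)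
  criticalF⁻ p with ∈-critical⁻ st p
  ... | c-empty = 0 , boolF false , [] , inst (here refl) Inj-[] ([]-unique _ _) , ≈-refl _
  ... | c-true = 0 , boolF true , [] , inst (there (here refl)) Inj-[] ([]-unique _ _) , ⟦boolF⟧ true []
  ... | c-atoms = 0 , atomsF , [] , inst (there (there (here refl))) Inj-[] ([]-unique _ _) , ⟦atomsF⟧ []
  ... | c-atom a = 1 , at zero , a ∷ [] ,
    inst (there (there (there (here refl)))) (mkInj λ { zero zero _ → refl }) ([]-unique _ _) , ≈-refl _
  ... | c-upd q h r with critical-upd tr q h r
  ... | c , u , β , inst s i _ , φ , φ∈ , e = c , φ , β , inst (criticalF-upd⁺ s φ∈) i ([]-unique _ _) , e

activeF : List (El (UpdF k) 0) → List (El Form 0)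
activeF Γ = subL (criticalF Γ)

activeF-good : ∀ {a b} → 1 ≤ b → (Γ : List (El (UpdF k) 0)) → Good b (NmU a b) Γ → Good b (Nm b) (activeF Γ)
activeF-good 1≤b Γ g p with ∈-subL⁻ {L = criticalF Γ} p
... | _ , _ , φ , q , r = let c≤ , _ , nφ = criticalF-good 1≤b Γ g q in subF-good φ c≤ nφ r

module _ {k n a b : ℕ} {st : List (UpdK k n)} {Γ : List (El (UpdF k) 0)} (tr : Tracks st Γ)
  (1≤b : 1 ≤ b) (g : Good b (NmU a b) Γ) (hn : b + b ≤ n) where

  activeF⁺ : ∀ {d} {χ : Form d} {δ : Tup n d} → Inst (activeF Γ) [] χ δ → ⟦ χ ⟧ δ ∈ₛ active st
  activeF⁺ (inst p i e) with ∈-subL⁻ {L = criticalF Γ} p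
  ... | c , κ , φ , q , r with criticalF-good 1≤b Γ g q
  ... | c≤ , _ , nφ with subF⁺ hn φ c≤ nφ (inst r i e)
  ... | β , iβ , t = ∈-active⁺ st (criticalF⁺ tr (inst q iβ ([]-unique _ _))) t

  activeF⁻ : ∀ {x} → x ∈ active st → Σ ℕ λ d → Σ (Form d) λ χ → ∃[ δ ] (Inst (activeF Γ) [] χ δ × x ≈ ⟦ χ ⟧ δ)
  activeF⁻ p with ∈-active⁻ st p
  ... | z , z∈ , q with criticalF⁻ tr z∈
  ... | c , φ , β , inst r i _ , e with tc-cong z e q
  ... | y , y∈ , e' with subF⁻ φ β i y∈
  ... | d , χ , δ , inst s i' e'' , refl = d , χ , δ , inst (∈-subL⁺ r s) i' e'' , e'

pigeonhole-distinct : (xs : List (HF n)) {l : ℕ} (F : Fin l → HF n) → (∀ i → F i ∈ₛ xs) →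
  (∀ i j → i ≢ j → ¬ F i ≈ F j) → l ≤ length xs
pigeonhole-distinct xs {l} F inside dist with l ≤? length xs
... | yes p = p
... | no ¬p with F.pigeonhole (≰⇒> ¬p) (λ i → index (proj₁ (proj₂ (inside i))))
... | i , j , i<j , e = ⊥-elim (dist i j (F.<⇒≢ i<j)
  (≈-trans (proj₂ (proj₂ (inside i))) (≈-trans (≡⇒≈ same-elem) (≈-sym (proj₂ (proj₂ (inside j)))))))
  where
  same-elem : proj₁ (inside i) ≡ proj₁ (inside j)
  same-elem = trans (lookup-index (proj₁ (proj₂ (inside i))))
    (trans (cong (Data.List.lookup xs) e) (sym (lookup-index (proj₁ (proj₂ (inside j))))))

-- The symbolic run

Kₙ : ℕ → Graph
Kₙ n = record { size = n ; edges = complete-graph n }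

module Run {S : Sig} (Π : Rule S 0) (a : ℕ) (ar≤ : ∀ f → arity S f ≤ a) (d s b₀ K N : ℕ)
  (b₀-def : suc a * suc d + (suc d + d) ≡ b₀) (hB : Bounds.Br Π b₀ ≤ K) (hq : quad b₀ ≤ K)
  (hN : quad K ≤ N) (hK : suc K ≤ N) (hs : K * s ≤ N) where

  state : ℕ → ∀ n → State S n
  state j n = run S (Kₙ n) Π j

  b₀≤K : b₀ ≤ K
  b₀≤K = ≤-trans (≤quad b₀) hq

  Symbolic : (∀ n → State S n) → Set
  Symbolic st = Σ (List (El (UpdF (Sig.k S)) 0)) λ Γ → Good b₀ (NmU a b₀) Γ × (∀ {n} → N ≤ n → Tracks (st n) Γ)

  module _ (st : State S N) (few : ∀ {k} → d < k → length (dedup (active st)) < s ^ k)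
    (Γ : List (El (UpdF (Sig.k S)) 0)) (g : Good K (NmU a K) Γ) (tr : Tracks st Γ) where

    Act : HF N → Set
    Act x = x ∈ₛ active st

    Act-∈ : ∀ {x y} → Act x → y ∈ elems x → Act y
    Act-∈ (x' , x'∈ , e) y∈ =
      let y' , y'∈ , e' = elems≈ e (∈⇒∈ₛ y∈) ; z , z∈ , p = ∈-active⁻ st x'∈
      in ∈ₛ-resp e' (∈-active⁺ st (∈⇒∈ₛ z∈) (tc-elems z p y'∈))

    Act-bound : ∀ {k} → d < k → k ≤ K → (F : Fin (s ^ k) → HF N) → (∀ i → Act (F i)) →
                (∀ i j → i ≢ j → ¬ F i ≈ F j) → ⊥
    Act-bound d<k _ F inside dist = <⇒≱ (few d<k) (pigeonhole-distinct (dedup (active st)) F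
      (λ i → let x , x∈ , e = inside i in ∈ₛ-resp e (dedup⊇ x∈)) dist)

    reduce : Σ (List (El (UpdF (Sig.k S)) 0)) λ Γ' → Good b₀ (NmU a b₀) Γ' ×
      (∀ {n} → N ≤ n → {st : List (UpdK (Sig.k S) n)} → Tracks st Γ → Tracks st Γ')
    reduce = subst (λ b → Σ (List (El (UpdF (Sig.k S)) 0)) λ Γ' → Good b (NmU a b) Γ' ×
        (∀ {n} → N ≤ n → {st : List (UpdK (Sig.k S) n)} → Tracks st Γ → Tracks st Γ')) b₀-def
      (Normalise.normalise-state K N hN hK d s hs a (subst (_≤ K) (sym b₀-def) b₀≤K) Act Act-∈ (λ e → ∈ₛ-resp (≈-sym e)) Act-bound Γ g
      λ p q iβ → ∈-active⁺ st (upd-critical tr (inst p iβ ([]-unique _ _)) q) (tc-self _))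

  next : (st st' : ∀ n → State S n) → (∀ n → step S (complete-graph n) Π (st n) ≡ st' n) →
    (∀ {k} → d < k → length (dedup (active (st' N))) < s ^ k) →
    (Σ (List (El (UpdF (Sig.k S)) 0)) λ Γ → Good (Bounds.Br Π b₀) (NmU a (Bounds.Br Π b₀)) Γ ×
      (∀ {n} → N ≤ n → Tracks (step S (complete-graph n) Π (st n)) Γ)) → Symbolic st'
  next st st' e few (Γ , g , tr) =
    let Γ' , g' , tr'' = reduce (st' N) few Γ (Good-mono hB (λ {_} {u} → NmU-mono {u = u} hB) g) (tr' ≤-refl)
    in Γ' , g' , λ hn → tr'' hn (tr' hn)
    where
    tr' : ∀ {n} → N ≤ n → Tracks (st' n) Γ
    tr' {n} hn = subst (λ x → Tracks x Γ) (e n) (tr hn)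

  symbolic-step : (st st' : ∀ n → State S n) → (∀ n → step S (complete-graph n) Π (st n) ≡ st' n) →
    (∀ {k} → d < k → length (dedup (active (st' N))) < s ^ k) → Symbolic st → Symbolic st'
  symbolic-step st st' e few (Γ , g , tr) = next st st' e few (StepRep.step-rep Π K N hN hK a ar≤ b₀ Γ g st tr hB)

  -- Each step starts again from the bound `b₀`, so `K` and `N` serve for any number of steps.
  symbolic-run : (M : ℕ) → (∀ j → j ≤ M → ∀ {k} → d < k → activeCount (state j N) < s ^ k) →
                 ∀ j → j ≤ M → Symbolic (state j)
  symbolic-run M few zero _ = [] , (λ ()) , λ _ → record
    { sound = λ { (inst () _ _) } ; complete = λ _ → inj₁ (≈-refl _) ; nonempty = λ { (inst () _ _) } }
  symbolic-run M few (suc j) j<M =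
    symbolic-step (state j) (state (suc j)) (λ n → refl) (few (suc j) j<M) (symbolic-run M few j (≤-trans (n≤1+n j) j<M))

  lookup-bool : (st : ∀ n → State S n) → Symbolic st → (f : Dyn (Sig.k S)) → Σ Bool λ t → ∀ {n} → N ≤ n →
                truthy (lookupSt (f , []) (st n)) ≡ t
  lookup-bool st (Γ , g , tr) f = t , λ hn → h hn Inj-[] (sp hn {[]} Inj-[] (≈ˡ-refl _))
    where
    open EvalRep K N hN hK a ar≤ b₀ Γ g st tr
    φ-nm-sp = lookup-form {m = 0} {b = b₀} hq z≤n ≤-refl f [] (λ ())
    φ = proj₁ φ-nm-sp
    sp = proj₂ (proj₂ φ-nm-sp)
    test = truthy-bool z≤n φ (Nm-mono hq φ (proj₁ (proj₂ φ-nm-sp)))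
    t = proj₁ test
    h = proj₂ test

-- Counting instances

Card : (HF n → Set) → ℕ → Set
Card P c = ∃[ ds ] (length ds ≡ c × Distinct ds × (∀ {x} → x ∈ ds → P x) × (∀ {x} → P x → x ∈ₛ ds))

Distinct-lookup : {ds : List (HF n)} → Distinct ds → ∀ i j → i ≢ j →
                  ¬ Data.List.lookup ds i ≈ Data.List.lookup ds j
Distinct-lookup (h ∷ p) zero    zero    i≢j e = i≢j refl
Distinct-lookup (h ∷ p) zero    (suc j) i≢j e = h (∈-lookup j) e
Distinct-lookup (h ∷ p) (suc i) zero    i≢j e = h (∈-lookup i) (≈-sym e)
Distinct-lookup (h ∷ p) (suc i) (suc j) i≢j e = Distinct-lookup p i j (i≢j ∘ cong suc) e

Card-≤ : {P : HF n → Set} {c c' : ℕ} → Card P c → Card P c' → c ≤ c'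
Card-≤ (ds , refl , dist , in₁ , _) (ds' , refl , _ , _ , cov) =
  pigeonhole-distinct ds' (Data.List.lookup ds) (λ i → cov (in₁ (∈-lookup i))) (Distinct-lookup dist)

Card-unique : {P : HF n → Set} {c c' : ℕ} → Card P c → Card P c' → c ≡ c'
Card-unique p q = ≤-antisym (Card-≤ p q) (Card-≤ q p)

Card-dedup : (xs : List (HF n)) → Card (_∈ₛ xs) (length (dedup xs))
Card-dedup xs = dedup xs , refl , dedup-distinct xs , (λ p → ∈⇒∈ₛ (dedup⊆ p)) ,
  λ (y , y∈ , e) → ∈ₛ-resp e (dedup⊇ y∈)

Card-cong : {P Q : HF n → Set} {c : ℕ} → (∀ {x} → P x → Q x) → (∀ {x} → Q x → P x) → Card P c → Card Q c
Card-cong f g (ds , l , dist , i , cov) = ds , l , dist , (λ p → f (i p)) , λ q → cov (g q)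

Card-⊎ : {P Q : HF n → Set} {c c' : ℕ} → (∀ {x y} → P x → Q y → ¬ x ≈ y) → Card P c → Card Q c' →
         Card (λ x → P x ⊎ Q x) (c + c')
Card-⊎ {P = P} {Q} disj (ds , refl , dist , i , cov) (ds' , refl , dist' , i' , cov') =
  ds ++ ds' , length-++ ds , both ds dist i , (λ p → case ∈-++⁻ ds p of λ { (inj₁ q) → inj₁ (i q) ; (inj₂ q) → inj₂ (i' q) }) ,
  λ { (inj₁ p) → let y , y∈ , e = cov p in y , ∈-++⁺ˡ y∈ , e ; (inj₂ p) → let y , y∈ , e = cov' p in y , ∈-++⁺ʳ ds y∈ , e }
  where
  both : ∀ xs → Distinct xs → (∀ {x} → x ∈ xs → P x) → Distinct (xs ++ ds')
  both []       _       _ = dist'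
  both (x ∷ xs) (h ∷ d) j =
    (λ p → case ∈-++⁻ xs p of λ { (inj₁ q) → h q ; (inj₂ q) → disj (j (here refl)) (i' q) }) ∷ both xs d (j ∘ there)

-- A relation instead of a function, since one object may be given by several forms; compatibility
-- with `≈` in both directions makes it a bijection between the classes.
Card-map : {P : HF n → Set} {Q : HF n' → Set} (R : HF n → HF n' → Set) →
  (∀ {x} → P x → ∃[ y ] (Q y × R x y)) → (∀ {y} → Q y → ∃[ x ] (P x × R x y)) →
  (∀ {x x' y y'} → R x y → R x' y' → x ≈ x' → y ≈ y') → (∀ {x x' y y'} → R x y → R x' y' → y ≈ y' → x ≈ x') →
  ∀ {c} → Card P c → Card Q c
Card-map {n} {n'} {P} {Q} R f g fwd bwd (ds , refl , dist , i , cov) =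
  let es , l , d , q , r = image ds dist i in es , l , d , q , λ {y} qy →
    let x , px , rxy = g qy ; x' , x'∈ , e = cov px ; y' , y'∈ , rxy' = r x'∈
    in y' , y'∈ , fwd rxy rxy' e
  where
  image : ∀ ds → Distinct ds → (∀ {x} → x ∈ ds → P x) → Σ (List (HF n')) λ es → length es ≡ length ds × Distinct es ×
          (∀ {y} → y ∈ es → Q y) × (∀ {x} → x ∈ ds → ∃[ y ] (y ∈ es × R x y))
  image ds d i = let es , l , d' , q , r , _ = go ds d i in es , l , d' , q , r
    where
    go : ∀ ds → Distinct ds → (∀ {x} → x ∈ ds → P x) → Σ (List (HF n')) λ es → length es ≡ length ds × Distinct es ×
         (∀ {y} → y ∈ es → Q y) × (∀ {x} → x ∈ ds → ∃[ y ] (y ∈ es × R x y)) × (∀ {y} → y ∈ es → ∃[ x ] (x ∈ ds × R x y))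
    go []       _       _ = [] , refl , [] , (λ ()) , (λ ()) , λ ()
    go (x ∷ xs) (h ∷ d) i with f (i (here refl)) | go xs d (i ∘ there)
    ... | y , qy , rxy | es , l , d' , q , r , r' = y ∷ es , cong suc l ,
      (λ y'∈ e → let x' , x'∈ , rx' = r' y'∈ in h x'∈ (bwd rxy rx' e)) ∷ d' ,
      (λ { (here refl) → qy ; (there p) → q p }) ,
      (λ { (here refl) → y , here refl , rxy ; (there p) → let y' , y'∈ , s = r p in y' , there y'∈ , s }) ,
      λ { (here refl) → x , here refl , rxy ; (there p) → let x' , x'∈ , s = r' p in x' , there x'∈ , s }

-- s is a sequence whose (f+1)-st differences vanish and whose lower differences are nonnegative.
IsPoly : ℕ → (ℕ → ℕ) → Set
IsPoly zero    s = ∀ e → s (suc e) ≡ s e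
IsPoly (suc f) s = Σ (ℕ → ℕ) λ t → IsPoly f t × (∀ e → s (suc e) ≡ s e + t e)

IsPoly-shift : ∀ f {s} → IsPoly f s → IsPoly f (s ∘ suc)
IsPoly-shift zero    h           = h ∘ suc
IsPoly-shift (suc f) (t , p , h) = t ∘ suc , IsPoly-shift f p , h ∘ suc

¬¬-bind : {A B : Set} → ¬ ¬ A → (A → ¬ ¬ B) → ¬ ¬ B
¬¬-bind a f k = a λ x → f x k

¬¬-em : (A : Set) → ¬ ¬ (A ⊎ ¬ A)
¬¬-em A k = k (inj₂ λ a → k (inj₁ a))

¬¬-all : {A : Set} {P : A → Set} (M : List A) → (∀ {x} → x ∈ M → ¬ ¬ P x) → ¬ ¬ (∀ {x} → x ∈ M → P x)
¬¬-all []      h k = k λ ()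
¬¬-all (x ∷ M) h k = h (here refl) λ p → ¬¬-all M (h ∘ there) λ q → k λ { (here refl) → p ; (there r) → q r }

-- The atoms below `m` in descending order, so that fixing atom `m` too is a cons. The bound is
-- irrelevant, which makes the tuple independent of its proof.
firsts : ∀ m {n} → .(m ≤ n) → Tup n m
firsts zero    _ = []
firsts (suc m) p = F.fromℕ< p ∷ firsts m (≤-trans (n≤1+n m) p)

firsts-below : ∀ m {n} .(p : m ≤ n) (i : Fin m) → F.toℕ ((firsts m p) ! i) < m
firsts-below (suc m) p zero    = s≤s (≤-reflexive (F.toℕ-fromℕ< p))
firsts-below (suc m) p (suc i) = m≤n⇒m≤1+n (firsts-below m (≤-trans (n≤1+n m) p) i)

Inj-firsts : ∀ m {n} .(p : m ≤ n) → Inj (firsts m p)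
Inj-firsts zero    p = Inj-[]
Inj-firsts (suc m) p = mkInj
  λ { zero zero _ → refl
    ; zero (suc j) e → ⊥-elim (<⇒≢ (firsts-below m (≤-trans (n≤1+n m) p) j) (trans (cong F.toℕ (sym e)) (F.toℕ-fromℕ< p)))
    ; (suc i) zero e → ⊥-elim (<⇒≢ (firsts-below m (≤-trans (n≤1+n m) p) i) (trans (cong F.toℕ e) (F.toℕ-fromℕ< p)))
    ; (suc i) (suc j) e → cong suc (inj (Inj-firsts m (≤-trans (n≤1+n m) p)) i j e) }

punchIn-below : ∀ {n} (z : Fin (suc n)) (a : Fin n) → F.toℕ a < F.toℕ z → F.toℕ (F.punchIn z a) ≡ F.toℕ a
punchIn-below (suc z) zero    _       = refl
punchIn-below (suc z) (suc a) (s≤s p) = cong suc (punchIn-below z a p)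

map-punchIn-firsts : ∀ m {n} (z : Fin (suc n)) .(p : m ≤ n) .(p' : m ≤ suc n) → m ≤ F.toℕ z →
                     V.map (F.punchIn z) (firsts m p) ≡ firsts m p'
map-punchIn-firsts zero    z p p' _  = refl
map-punchIn-firsts (suc m) z p p' le = cong₂ _∷_
  (F.toℕ-injective (trans (punchIn-below z _ (subst (_< F.toℕ z) (sym (F.toℕ-fromℕ< p)) le))
    (trans (F.toℕ-fromℕ< p) (sym (F.toℕ-fromℕ< p')))))
  (map-punchIn-firsts m z (≤-trans (n≤1+n m) p) (≤-trans (n≤1+n m) p') (≤-trans (n≤1+n m) le))

opaque
  unfolding _⟨_⟩

  map-⟨⟩ : {A B : Set} (f : A → B) (α : Vec A m) (θ : Tup m k) → V.map f (α ⟨ θ ⟩) ≡ V.map f α ⟨ θ ⟩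
  map-⟨⟩ f α []      = refl
  map-⟨⟩ f α (t ∷ θ) = cong₂ _∷_ (sym (V.lookup-map t f α)) (map-⟨⟩ f α θ)

  ⟨∷⟩ : {A : Set} (α : Vec A m) (i : Fin m) (θ : Tup m k) → α ⟨ i ∷ θ ⟩ ≡ α ! i ∷ α ⟨ θ ⟩
  ⟨∷⟩ α i θ = refl

-- Growth of the number of instances

In : List (El Form m) → Tup n m → HF n → Set
In Λ α x = Σ ℕ λ c → Σ (Form c) λ φ → ∃[ β ] (Inst Λ α φ β × x ≈ ⟦ φ ⟧ β)

module _ (K N : ℕ) (hN : quad K ≤ N) where

  private
    2K≤N : K + K ≤ N
    2K≤N = ≤-trans (2≤quad K) hN

  Avoid : List (El Form m) → Fin n → Tup n m → HF n → Set
  Avoid Λ z α x = Σ ℕ λ c → Σ (Form c) λ φ → ∃[ β ] (Inst Λ α φ β × (∀ i → β ! i ≢ z) × x ≈ ⟦ φ ⟧ β)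

  avoid-transfer : {Λ : List (El Form m)} → Good K (Nm K) Λ → {κ : Tup c m} {i : Fin c} {φ : Form c} → c ≤ K → Nm K φ →
    N ≤ n → N ≤ n' → {β : Tup n c} {β' : Tup n' c} → Inj β → Inj β' →
    Avoid Λ (β ! i) (β ⟨ κ ⟩) (⟦ φ ⟧ β) → Avoid Λ (β' ! i) (β' ⟨ κ ⟩) (⟦ φ ⟧ β')
  avoid-transfer {Λ = Λ} g {κ} {i} {φ} c≤ nφ hn hn' {β} {β'} iβ iβ' (c₂ , χ , δ , inst p iδ e , z∉ , q) with g p
  ... | c₂≤ , _ , nχ with extend (Inj⇒Same iβ iβ') δ (≤-trans (+-mono-≤ c₂≤ c≤) (≤-trans 2K≤N hn'))
  ... | δ' , s = c₂ , χ , δ' , inst p (Linked-Inj s lδ iδ) (Linked-≡ s (Linked-⟨⟩ lδ _) (Linked-⟨⟩ lβ κ) e) ,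
      (λ j r → z∉ j (Linked-cross (Same-sym s) (Linked-sym lδ) (Linked-sym lβ) j i r)) ,
      game (≤-trans hN hn) (≤-trans hN hn') φ χ nφ nχ s lβ lδ q
    where
    lδ = Linked-ˡ {γ = β} {β'} δ δ'
    lβ = Linked-ʳ δ δ' (Linked-self {γ = β} {β'})

  -- An instance through the atom `z` increases the count only if no instance avoiding `z` denotes
  -- the same object. By invariance under patterns this is settled for a whole symbolic element at
  -- once.
  Old New : List (El Form m) → El Form (suc m) → Set
  Old Λ (el {c} κ φ) = ∀ {n} → N ≤ n → ∀ {z α} {β : Tup n c} → Inj β → β ⟨ κ ⟩ ≡ z ∷ α → Avoid Λ z α (⟦ φ ⟧ β)
  New Λ (el {c} κ φ) = ∀ {n} → N ≤ n → ∀ {z α} {β : Tup n c} → Inj β → β ⟨ κ ⟩ ≡ z ∷ α → ¬ Avoid Λ z α (⟦ φ ⟧ β)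

  old-or-new : {Λ : List (El Form m)} → Good K (Nm K) Λ → (κ : Tup c (suc m)) (φ : Form c) → c ≤ K → Nm K φ →
               ¬ ¬ (New Λ (el κ φ) ⊎ Old Λ (el κ φ))
  old-or-new {c = c} {Λ} g (i ∷ κ) φ c≤ nφ = ¬¬-bind (¬¬-em (Avoid Λ (β₀ ! i) (β₀ ⟨ κ ⟩) (⟦ φ ⟧ β₀))) λ
    { (inj₁ av) k → k (inj₂ λ {n} hn {z} {α} {β} iβ e → case trans (sym (⟨∷⟩ β i κ)) e of λ
        { refl → avoid-transfer {Λ = Λ} g {κ} {i} {φ} c≤ nφ ≤-refl hn i₀ iβ av })
    ; (inj₂ ¬av) k → k (inj₁ λ {n} hn {z} {α} {β} iβ e av → case trans (sym (⟨∷⟩ β i κ)) e of λ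
        { refl → ¬av (avoid-transfer {Λ = Λ} g {κ} {i} {φ} c≤ nφ hn ≤-refl iβ i₀ av) }) }
    where
    c≤N = ≤-trans c≤ (≤-trans (≤quad K) hN)
    β₀ : Tup N c
    β₀ = canon c≤N
    i₀ = Inj-canon c≤N

  -- One position `i` outside the context is made to hold the newly fixed atom, so the number of
  -- positions beyond the context drops by one.
  freeEl : El Form m → List (El Form (suc m))
  freeEl (el {c} κ φ) = map (λ i → el (i ∷ κ) φ) (filter (λ i → F.all? λ j → ¬? (κ ! j F.≟ i)) (allFin c))

  free : List (El Form m) → List (El Form (suc m))
  free = concatMap freeEl

  ∈-free⁻ : {Λ : List (El Form m)} {κ' : Tup c (suc m)} {φ : Form c} → el κ' φ ∈ free Λ →
            Σ (Fin c) λ i → Σ (Tup c m) λ κ → κ' ≡ i ∷ κ × el κ φ ∈ Λ × (∀ j → κ ! j ≢ i)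
  ∈-free⁻ {Λ = Λ} p with ∈-concat⁻′ (map freeEl Λ) p
  ... | _ , q , r with ∈-map⁻ freeEl r
  ... | el {c} κ φ , s , refl with ∈-map⁻ _ q
  ... | i , t , refl = i , κ , refl , s , proj₂ (∈-filter⁻ (λ i → F.all? λ j → ¬? (κ ! j F.≟ i)) {xs = allFin c} t)

  ∈-free⁺ : {Λ : List (El Form m)} {κ : Tup c m} {φ : Form c} {i : Fin c} → el κ φ ∈ Λ → (∀ j → κ ! j ≢ i) →
            el (i ∷ κ) φ ∈ free Λ
  ∈-free⁺ {κ = κ} {i = i} p h = ∈-concat⁺′
    (∈-map⁺ _ (∈-filter⁺ (λ i → F.all? λ j → ¬? (κ ! j F.≟ i)) (∈-allFin i) h)) (∈-map⁺ freeEl p)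

  Good-free : {Λ : List (El Form m)} → Good K (Nm K) Λ → Good K (Nm K) (free Λ)
  Good-free {Λ = Λ} g p with ∈-free⁻ {Λ = Λ} p
  ... | i , κ , refl , q , h = let c≤ , iκ , nφ = g q in c≤ , ∷-Inj iκ h , nφ

  count : (Λ : List (El Form m)) → .(m ≤ N) → ℕ → ℕ
  count {m} Λ p e = length (dedup (⟦ Λ ⟧* (firsts m (≤-trans p (m≤n+m N e)))))

  Card-In : (Λ : List (El Form m)) (α : Tup n m) → Card (In Λ α) (length (dedup (⟦ Λ ⟧* α)))
  Card-In Λ α = Card-cong
    (λ (y , y∈ , e) → let c , φ , β , p , e' = inst⁻ {L = Λ} {α} y∈ in c , φ , β , p , ≈-trans e (≡⇒≈ e'))
    (λ (c , φ , β , p , e) → _ , inst⁺ p , e) (Card-dedup _)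

  module _ (Λ : List (El Form m)) (g : Good K (Nm K) Λ) where

    -- Instances avoiding the atom z of Fin (suc n) are those over Fin n, embedded by punchIn z.
    Card-avoid : N ≤ n → (z : Fin (suc n)) (α : Tup n m) → ∀ {c} → Card (In Λ α) c →
                 Card (Avoid Λ z (V.map (F.punchIn z) α)) c
    Card-avoid {n} hn z α = Card-map R
      (λ (c , φ , β , p , e) → ⟦ φ ⟧ (π β) , (c , φ , π β , up p , avoids β , ≈-refl _) , (c , φ , β , p , e , ≈-refl _))
      (λ { (c , φ , β' , p , h , e) → let β , q = down β' h in
           ⟦ φ ⟧ β , (c , φ , β , back p q , ≈-refl _) , (c , φ , β , back p q , ≈-refl _ , subst (λ b → _ ≈ ⟦ φ ⟧ b) (sym q) e) })
      (λ { (c , φ , β , inst p _ _ , e₁ , e₂) (c' , χ , δ , inst q _ _ , e₁' , e₂') e →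
           ≈-trans e₂ (≈-trans (game hq hq' φ χ (proj₂ (proj₂ (g p))) (proj₂ (proj₂ (g q))) (same β δ) (lβ β δ) (lδ β δ)
             (≈-trans (≈-sym e₁) (≈-trans e e₁'))) (≈-sym e₂')) })
      (λ { (c , φ , β , inst p _ _ , e₁ , e₂) (c' , χ , δ , inst q _ _ , e₁' , e₂') e →
           ≈-trans e₁ (≈-trans (game hq' hq φ χ (proj₂ (proj₂ (g p))) (proj₂ (proj₂ (g q))) (Same-sym (same β δ))
             (Linked-sym (lβ β δ)) (Linked-sym (lδ β δ))
             (≈-trans (≈-sym e₂) (≈-trans e e₂'))) (≈-sym e₁')) })
      where
      hq : quad K ≤ n
      hq = ≤-trans hN hn
      hq' : quad K ≤ suc n
      hq' = ≤-trans hq (n≤1+n n)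
      π : ∀ {k} → Tup n k → Tup (suc n) k
      π = V.map (F.punchIn z)
      R : HF n → HF (suc n) → Set
      R x y = Σ ℕ λ c → Σ (Form c) λ φ → ∃[ β ] (Inst Λ α φ β × x ≈ ⟦ φ ⟧ β × y ≈ ⟦ φ ⟧ (π β))
      lookup-π : ∀ {k} (β : Tup n k) i → (π β) ! i ≡ F.punchIn z (β ! i)
      lookup-π β i = V.lookup-map i (F.punchIn z) β
      π-same : ∀ {k} (β : Tup n k) → Same β (π β)
      π-same β = mkSame (λ i j e → trans (lookup-π β i) (trans (cong (F.punchIn z) e) (sym (lookup-π β j))))
        (λ i j e → F.punchIn-injective z _ _ (trans (sym (lookup-π β i)) (trans e (lookup-π β j))))
      π-injective : ∀ {k} {β β' : Tup n k} → π β ≡ π β' → β ≡ β'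
      π-injective {β = β} {β'} e = vec-ext λ i → F.punchIn-injective z _ _
        (trans (sym (lookup-π β i)) (trans (cong (λ v → v ! i) e) (lookup-π β' i)))
      same : ∀ {k l} (β : Tup n k) (δ : Tup n l) → Same (β V.++ δ) (π β V.++ π δ)
      same β δ = subst (Same (β V.++ δ)) (V.map-++ (F.punchIn z) β δ) (π-same (β V.++ δ))
      lβ : ∀ {k l} (β : Tup n k) (δ : Tup n l) → Linked (β V.++ δ) (π β V.++ π δ) β (π β)
      lβ β δ = Linked-++ˡ (Linked-self {γ = β V.++ δ} {π β V.++ π δ})
      lδ : ∀ {k l} (β : Tup n k) (δ : Tup n l) → Linked (β V.++ δ) (π β V.++ π δ) δ (π δ)
      lδ β δ = Linked-++ʳ β (π β) Linked-self
      up : ∀ {c} {φ : Form c} {β : Tup n c} → Inst Λ α φ β → Inst Λ (π α) φ (π β)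
      up {β = β} (inst p i e) = inst p (Same-Inj (π-same β) i) (trans (sym (map-⟨⟩ (F.punchIn z) β _)) (cong π e))
      avoids : ∀ {k} (β : Tup n k) i → (π β) ! i ≢ z
      avoids β i e = F.punchInᵢ≢i z (β ! i) (trans (sym (lookup-π β i)) e)
      down : ∀ {k} (β' : Tup (suc n) k) → (∀ i → β' ! i ≢ z) → ∃[ β ] π β ≡ β'
      down []       h = [] , refl
      down (b ∷ β') h = let β , e = down β' (h ∘ suc) in
        F.punchOut (h zero ∘ sym) ∷ β , cong₂ _∷_ (F.punchIn-punchOut (h zero ∘ sym)) e
      back : ∀ {c} {φ : Form c} {β' : Tup (suc n) c} {β} → Inst Λ (π α) φ β' → π β ≡ β' → Inst Λ α φ β
      back {β = β} (inst p i e) refl = inst p (Same-Inj (Same-sym (π-same β)) i)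
        (π-injective (trans (map-⟨⟩ (F.punchIn z) β _) e))

    -- The first difference of the count is again a count. Over `n + 1` atoms, the instances
    -- avoiding `z` are worth those over `n`, and what remains are the new instances through `z`.
    -- The atom `z` is number `m`, so that the context with `z` in front is `firsts (suc m)`.
    count-suc : (p : suc m ≤ N) (M : List (El Form (suc m))) →
      (∀ {A} → A ∈ M → A ∈ free Λ × New Λ A) → (∀ {A} → A ∈ free Λ → A ∈ M ⊎ Old Λ A) →
      ∀ e → count Λ (≤-trans (n≤1+n m) p) (suc e) ≡ count Λ (≤-trans (n≤1+n m) p) e + count M p (suc e)
    count-suc p M only all e = Card-unique (Card-In Λ α⁺)
      (Card-cong join split (Card-⊎ disjoint
        (subst (λ δ → Card (Avoid Λ z δ) (length (dedup (⟦ Λ ⟧* α)))) α⁺-eq (Card-avoid hn z α (Card-In Λ α)))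
        (Card-In M (z ∷ α⁺))))
      where
      n₀ = e + N
      hn : N ≤ n₀
      hn = m≤n+m N e
      m≤n₀ : m ≤ n₀
      m≤n₀ = ≤-trans (≤-trans (n≤1+n m) p) hn
      z : Fin (suc n₀)
      z = F.fromℕ< (≤-trans p (m≤n+m N (suc e)))
      α = firsts m m≤n₀
      α⁺ = firsts m (≤-trans m≤n₀ (n≤1+n n₀))
      α⁺-eq : V.map (F.punchIn z) α ≡ α⁺
      α⁺-eq = map-punchIn-firsts m z m≤n₀ _ (≤-reflexive (sym (F.toℕ-fromℕ< (≤-trans p (m≤n+m N (suc e))))))
      z∉α⁺ : ∀ i → α⁺ ! i ≢ z
      z∉α⁺ i q = F.punchInᵢ≢i z (α ! i)
        (trans (sym (V.lookup-map i (F.punchIn z) α)) (trans (cong (λ v → v ! i) α⁺-eq) q))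
      join : ∀ {x} → Avoid Λ z α⁺ x ⊎ In M (z ∷ α⁺) x → In Λ α⁺ x
      join (inj₁ (c , φ , β , q , _ , e)) = c , φ , β , q , e
      join (inj₂ (c , φ , β , inst q i e' , e)) with ∈-free⁻ {Λ = Λ} (proj₁ (only q))
      ... | j , κ , refl , r , _ = c , φ , β , inst r i (proj₂ (V.∷-injective (trans (sym (⟨∷⟩ β j κ)) e'))) , e
      split : ∀ {x} → In Λ α⁺ x → Avoid Λ z α⁺ x ⊎ In M (z ∷ α⁺) x
      split (c , φ , β , inst {κ} q i e' , e) with find β z
      ... | inj₂ h = inj₁ (c , φ , β , inst q i e' , h , e)
      ... | inj₁ (j , ej) with all (∈-free⁺ {Λ = Λ} q λ x r → z∉α⁺ x
              (trans (cong (λ v → v ! x) (sym e')) (trans (lookup-⟨⟩ β κ x) (trans (cong (β !_) r) ej))))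
      ... | inj₁ r = inj₂ (c , φ , β , inst r i (trans (⟨∷⟩ β j κ) (cong₂ _∷_ ej e')) , e)
      ... | inj₂ old = let c' , χ , δ , s , h , e'' = old (≤-trans hn (n≤1+n n₀)) i (trans (⟨∷⟩ β j κ) (cong₂ _∷_ ej e'))
                       in inj₁ (c' , χ , δ , s , h , ≈-trans e e'')
      disjoint : ∀ {x y} → Avoid Λ z α⁺ x → In M (z ∷ α⁺) y → ¬ x ≈ y
      disjoint (c , φ , β , q , h , e) (c' , χ , δ , inst r i e' , e'') s =
        proj₂ (only r) (≤-trans hn (n≤1+n n₀)) i e' (c , φ , β , q , h , ≈-trans (≈-sym e'') (≈-trans (≈-sym s) e))

  -- Here `f` bounds the number of positions beyond the context. Taking the difference fixes one
  -- more atom and lowers `f`; when no position is left, no instance can involve a further atom and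
  -- the count is constant.
  count-poly : ∀ f (Λ : List (El Form m)) → Good K (Nm K) Λ → (∀ {c} {κ : Tup c m} {φ} → el κ φ ∈ Λ → c ≤ m + f) →
               (p : suc m + f ≤ N) .(p' : m ≤ N) → ¬ ¬ IsPoly f (count Λ p')
  count-poly {m} f Λ g bd p p' = ¬¬-bind (¬¬-all {P = λ A → New Λ A ⊎ Old Λ A} (free Λ) decide) (go f bd p)
    where
    decide : ∀ {A} → A ∈ free Λ → ¬ ¬ (New Λ A ⊎ Old Λ A)
    decide {el κ φ} q = let c≤ , _ , nφ = Good-free {Λ = Λ} g q in old-or-new g κ φ c≤ nφ
    go : ∀ f → (∀ {c} {κ : Tup c m} {φ} → el κ φ ∈ Λ → c ≤ m + f) → suc m + f ≤ N →
         (∀ {A} → A ∈ free Λ → New Λ A ⊎ Old Λ A) → ¬ ¬ IsPoly f (count Λ p')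
    go f bd p dec with pick (free Λ) dec
    go zero bd p dec | M , only , all = λ k → k λ e → trans (count-suc Λ g p₁ M only all e)
        (trans (cong (λ M → count Λ p' e + count M p₁ (suc e)) M≡[]) (+-identityʳ _))
      where
      p₁ : suc m ≤ N
      p₁ = ≤-trans (m≤m+n (suc m) 0) p
      no-free : ∀ {A} → A ∈ free Λ → ⊥
      no-free {el κ φ} q with ∈-free⁻ {Λ = Λ} q
      ... | i , κ' , refl , r , _ = <⇒≱ (F.injective⇒≤ (λ {x} {y} → inj (proj₁ (proj₂ (Good-free {Λ = Λ} g q))) x y))
              (≤-trans (bd r) (≤-reflexive (+-identityʳ m)))
      M≡[] : M ≡ []
      M≡[] = empty-list M λ q → no-free (proj₁ (only q))
        where
        empty-list : ∀ {A : Set} (M : List A) → (∀ {x} → x ∈ M → ⊥) → M ≡ []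
        empty-list []      h = refl
        empty-list (x ∷ M) h = ⊥-elim (h (here refl))
    go (suc f) bd p dec | M , only , all = ¬¬-bind
      (count-poly f M (λ q → Good-free {Λ = Λ} g (proj₁ (only q)))
        (λ q → case ∈-free⁻ {Λ = Λ} (proj₁ (only q)) of λ { (_ , _ , refl , r , _) → ≤-trans (bd r) (≤-reflexive (+-suc m f)) })
        (≤-trans (≤-reflexive (cong suc (sym (+-suc m f)))) p) p₁)
      λ poly k → k ((λ e → count M p₁ (suc e)) , IsPoly-shift f poly , λ e → count-suc Λ g p₁ M only all e)
      where
      p₁ : suc m ≤ N
      p₁ = ≤-trans (m≤m+n (suc m) (suc f)) p

-- The determinant of the complete graph

ev : ℕ → Bool
ev zero    = true
ev (suc n) = not (ev n)

trues : (Fin n → Bool) → ℕ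
trues {zero}  D = 0
trues {suc n} D = if D zero then suc (trues (D ∘ suc)) else trues (D ∘ suc)

trues-cong : {D D' : Fin n → Bool} → (∀ i → D i ≡ D' i) → trues D ≡ trues D'
trues-cong {zero}  h = refl
trues-cong {suc n} h = cong₂ (λ b t → if b then suc t else t) (h zero) (trues-cong (h ∘ suc))

trues-false : (D : Fin n → Bool) → (∀ i → D i ≡ false) → trues D ≡ 0
trues-false {zero}  D h = refl
trues-false {suc n} D h rewrite h zero = trues-false (D ∘ suc) (h ∘ suc)

suc-≟ : (i r : Fin n) → ⌊ suc i F.≟ suc r ⌋ ≡ ⌊ i F.≟ r ⌋
suc-≟ i r with i F.≟ r
... | yes _ = refl
... | no  _ = refl

trues-add : (D : Fin n → Bool) (r : Fin n) →
            trues (λ i → D i ∨ ⌊ i F.≟ r ⌋) ≡ (if D r then trues D else suc (trues D))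
trues-add {suc n} D zero with D zero
... | true  = cong suc (trues-cong λ i → ∨-identityʳ (D (suc i)))
... | false = cong suc (trues-cong λ i → ∨-identityʳ (D (suc i)))
trues-add {suc n} D (suc r) with D zero | D (suc r) | trans (trues-cong {D = λ i → D (suc i) ∨ ⌊ suc i F.≟ suc r ⌋}
  (λ i → cong (D (suc i) ∨_) (suc-≟ i r))) (trues-add (D ∘ suc) r)
... | true  | true  | e = cong suc e
... | true  | false | e = cong suc e
... | false | true  | e = e
... | false | false | e = e

sumZ2-cong : {f g : Fin n → Bool} → (∀ i → f i ≡ g i) → sumZ2 f ≡ sumZ2 g
sumZ2-cong {zero}  h = refl
sumZ2-cong {suc n} h = cong₂ _xor_ (h zero) (sumZ2-cong (h ∘ suc))

-- Only the parities of the two multiplicities matter: `not (ev t)` is `t` modulo 2, and the `xor`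
-- is the parity of `n - t`.
sumZ2-if : (D : Fin n → Bool) (x y : Bool) → sumZ2 (λ i → if D i then x else y) ≡
           (not (ev (trues D)) ∧ x) xor ((not (ev n) xor not (ev (trues D))) ∧ y)
sumZ2-if {zero}  D x y = refl
sumZ2-if {suc n} D x y with D zero | sumZ2-if (D ∘ suc) x y
... | true  | e = trans (cong (x xor_) e) (table (ev (trues (D ∘ suc))) (ev n) x y)
  where
  table : ∀ a b x y → x xor ((not a ∧ x) xor ((not b xor not a) ∧ y)) ≡
          (not (not a) ∧ x) xor ((not (not b) xor not (not a)) ∧ y)
  table true  true  true  y = refl
  table true  true  false y = refl
  table true  false true  y = refl
  table true  false false y = refl
  table false true  true  true  = refl
  table false true  true  false = refl
  table false true  false y = refl
  table false false true  y = refl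
  table false false false y = refl
... | false | e = trans (cong (y xor_) e) (table (ev (trues (D ∘ suc))) (ev n) x y)
  where
  table : ∀ a b x y → y xor ((not a ∧ x) xor ((not b xor not a) ∧ y)) ≡
          (not a ∧ x) xor ((not (not b) xor not a) ∧ y)
  table true  true  x true  = refl
  table true  true  x false = refl
  table true  false x true  = refl
  table true  false x false = refl
  table false true  true  true  = refl
  table false true  true  false = refl
  table false true  false true  = refl
  table false true  false false = refl
  table false false true  true  = refl
  table false false true  false = refl
  table false false false true  = refl
  table false false false false = refl

det-cong : ∀ n {M M' : Fin n → Fin n → Bool} → (∀ r c → M r c ≡ M' r c) → det n M ≡ det n M'
det-cong zero    h = refl
det-cong (suc n) h = sumZ2-cong λ j → cong₂ _∧_ (h zero j) (det-cong n λ r c → h (suc r) (F.punchIn j c))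

private module Z2 = CommutativeRing xor-∧-commutativeRing
private module Σ2 = Algebra.Properties.CommutativeMonoid.Sum Z2.+-commutativeMonoid

sumZ2-permute : (f : Fin n → Bool) (σ : Permutation′ n) → sumZ2 f ≡ sumZ2 (λ i → f (σ ⟨$⟩ʳ i))
sumZ2-permute f σ = trans (as-sum f) (trans (Σ2.sum-permute f σ) (sym (as-sum (λ i → f (σ ⟨$⟩ʳ i)))))
  where
  as-sum : ∀ {n} (f : Fin n → Bool) → sumZ2 f ≡ Σ2.sum f
  as-sum {zero}  f = refl
  as-sum {suc n} f = cong (f zero xor_) (as-sum (f ∘ suc))

-- Row r of the matrix vanishes exactly at column σ r, except that the rows in D are full.
blocked : (Fin n → Bool) → Permutation′ n → Fin n → Fin n → Bool
blocked D σ r c = D r ∨ not ⌊ (σ ⟨$⟩ʳ r) F.≟ c ⌋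

⌊≟⌋-true : {i j : Fin n} → i ≡ j → ⌊ i F.≟ j ⌋ ≡ true
⌊≟⌋-true {i = i} {j} e with i F.≟ j
... | yes _ = refl
... | no ¬e = ⊥-elim (¬e e)

⌊≟⌋-false : {i j : Fin n} → i ≢ j → ⌊ i F.≟ j ⌋ ≡ false
⌊≟⌋-false {i = i} {j} ¬e with i F.≟ j
... | yes e = ⊥-elim (¬e e)
... | no _  = refl

transpose-away : (i : Fin (suc n)) (r : Fin n) → suc r ≢ i → transpose zero i ⟨$⟩ʳ suc r ≡ suc r
transpose-away i r ne with suc r F.≟ i
... | yes e = ⊥-elim (ne e)
... | no _  = refl

-- After exchanging rows 0 and `i`, the permutation sends 0 to the deleted column `σ i`, so `remove`
-- yields a permutation for the minor. Row `i` has lost its zero with that column and therefore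
-- counts as full.
minor : (D : Fin (suc n) → Bool) (σ : Permutation′ (suc n)) (i : Fin (suc n)) (r c : Fin n) →
  blocked D σ (suc r) (F.punchIn (σ ⟨$⟩ʳ i) c) ≡
  blocked (λ r → D (suc r) ∨ ⌊ suc r F.≟ i ⌋) (remove zero (transpose zero i ∘ₚ σ)) r c
minor D σ i r c = by-cases (suc r F.≟ i)
  where
  x = remove zero (transpose zero i ∘ₚ σ) ⟨$⟩ʳ r
  by-cases : Dec (suc r ≡ i) → D (suc r) ∨ not ⌊ (σ ⟨$⟩ʳ suc r) F.≟ F.punchIn (σ ⟨$⟩ʳ i) c ⌋ ≡
             (D (suc r) ∨ ⌊ suc r F.≟ i ⌋) ∨ not ⌊ x F.≟ c ⌋
  by-cases (yes e) = trans
    (trans (cong (λ b → D (suc r) ∨ not b) (⌊≟⌋-false (λ e' → F.punchInᵢ≢i _ c (trans (sym e') (cong (σ ⟨$⟩ʳ_) e))))) (∨-zeroʳ _))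
    (sym (cong (_∨ not ⌊ x F.≟ c ⌋) (trans (cong (D (suc r) ∨_) (⌊≟⌋-true e)) (∨-zeroʳ (D (suc r))))))
  by-cases (no ne) = cong₂ (λ b b' → b ∨ not b')
    (sym (trans (cong (D (suc r) ∨_) (⌊≟⌋-false ne)) (∨-identityʳ _))) (same (x F.≟ c))
    where
    moved : σ ⟨$⟩ʳ suc r ≡ F.punchIn (σ ⟨$⟩ʳ i) x
    moved = trans (cong (σ ⟨$⟩ʳ_) (sym (transpose-away i r ne))) (punchIn-permute (transpose zero i ∘ₚ σ) zero r)
    same : Dec (x ≡ c) → ⌊ (σ ⟨$⟩ʳ suc r) F.≟ F.punchIn (σ ⟨$⟩ʳ i) c ⌋ ≡ ⌊ x F.≟ c ⌋
    same (yes e) = trans (⌊≟⌋-true (trans moved (cong (F.punchIn _) e))) (sym (⌊≟⌋-true e))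
    same (no ¬e) = trans (⌊≟⌋-false λ e' → ¬e (F.punchIn-injective _ _ _ (trans (sym moved) e'))) (sym (⌊≟⌋-false ¬e))

-- Two full rows are equal, giving 0. A single full row, added to the others, leaves unit vectors
-- and thus a permutation matrix, giving 1. Without full rows the matrix is I + J up to a
-- permutation of columns, with determinant 1 + n.
full-det : ℕ → ℕ → Bool
full-det n zero          = ev n
full-det n (suc zero)    = true
full-det n (suc (suc _)) = false

-- Expanding along row 0, the minor at column σ i is of the same shape, with row i now full as well (when i ≠ 0)
-- and its zero replaced by that of row 0.
det-blocked : ∀ n (D : Fin n → Bool) (σ : Permutation′ n) → det n (blocked D σ) ≡ full-det n (trues D)
det-blocked zero    D σ = refl
det-blocked (suc n) D σ = begin
  sumZ2 (λ j → blocked D σ zero j ∧ det n (λ r c → blocked D σ (suc r) (F.punchIn j c)))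
    ≡⟨ sumZ2-permute (λ j → blocked D σ zero j ∧ det n (λ r c → blocked D σ (suc r) (F.punchIn j c))) σ ⟩
  sumZ2 (λ i → blocked D σ zero (σ ⟨$⟩ʳ i) ∧ det n (λ r c → blocked D σ (suc r) (F.punchIn (σ ⟨$⟩ʳ i) c)))
    ≡⟨ sumZ2-cong (λ i → cong (blocked D σ zero (σ ⟨$⟩ʳ i) ∧_) (trans (det-cong n (minor D σ i))
        (det-blocked n (λ r → D (suc r) ∨ ⌊ suc r F.≟ i ⌋) (remove zero (transpose zero i ∘ₚ σ))))) ⟩
  sumZ2 (λ i → blocked D σ zero (σ ⟨$⟩ʳ i) ∧ full-det n (trues (λ r → D (suc r) ∨ ⌊ suc r F.≟ i ⌋)))
    ≡⟨ cong₂ _xor_ head-term (trans (sumZ2-cong tail-term) (sumZ2-if (D ∘ suc) _ _)) ⟩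
  (D zero ∧ full-det n t) xor ((not (ev t) ∧ full-det n t) xor ((not (ev n) xor not (ev t)) ∧ full-det n (suc t)))
    ≡⟨ table (D zero) t ⟩
  full-det (suc n) (trues D) ∎
  where
  open ≡-Reasoning
  t = trues (D ∘ suc)
  head-term : blocked D σ zero (σ ⟨$⟩ʳ zero) ∧ full-det n (trues (λ r → D (suc r) ∨ false)) ≡ D zero ∧ full-det n t
  head-term = cong₂ (λ b s → b ∧ full-det n s)
    (trans (cong (λ b → D zero ∨ not b) (⌊≟⌋-true refl)) (∨-identityʳ _)) (trues-cong λ r → ∨-identityʳ (D (suc r)))
  tail-term : ∀ r → blocked D σ zero (σ ⟨$⟩ʳ suc r) ∧ full-det n (trues (λ r' → D (suc r') ∨ ⌊ suc r' F.≟ suc r ⌋)) ≡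
              (if D (suc r) then full-det n t else full-det n (suc t))
  tail-term r = trans (cong₂ (λ b s → b ∧ full-det n s)
      (trans (cong (λ b → D zero ∨ not b) (⌊≟⌋-false λ e → case Injection.injective (↔⇒↣ σ) e of λ ())) (∨-zeroʳ (D zero)))
      (trans (trues-cong λ r' → cong (D (suc r') ∨_) (suc-≟ r' r)) (trues-add (D ∘ suc) r)))
    (pull (D (suc r)))
    where
    pull : ∀ b → full-det n (if b then t else suc t) ≡ (if b then full-det n t else full-det n (suc t))
    pull true  = refl
    pull false = refl
  vanish : ∀ a b → (not (not a) ∧ false) xor ((not b xor not (not a)) ∧ false) ≡ false
  vanish a b = cong₂ _xor_ (∧-zeroʳ (not (not a))) (∧-zeroʳ (not b xor not (not a)))
  table : ∀ b t → (b ∧ full-det n t) xor ((not (ev t) ∧ full-det n t) xor ((not (ev n) xor not (ev t)) ∧ full-det n (suc t)))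
          ≡ full-det (suc n) (if b then suc t else t)
  table true  zero with ev n
  ... | true  = refl
  ... | false = refl
  table false zero with ev n
  ... | true  = refl
  ... | false = refl
  table true  (suc zero) with ev n
  ... | true  = refl
  ... | false = refl
  table false (suc zero) with ev n
  ... | true  = refl
  ... | false = refl
  table true  (suc (suc t)) = vanish (not (ev t)) (ev n)
  table false (suc (suc t)) = vanish (not (ev t)) (ev n)

det-complete : ∀ n → det n (complete-graph n) ≡ ev n
det-complete n = trans (det-blocked n (λ _ → false) Perm.id) (cong (full-det n) (trues-false {n} (λ _ → false) (λ _ → refl)))

-- Polynomial bounds

bounded : (g : Fin k → ℕ) → ∃[ a ] (∀ i → g i ≤ a)
bounded {zero}  g = 0 , λ ()
bounded {suc k} g = let a , h = bounded (g ∘ suc) in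
  g zero + a , λ { zero → m≤m+n _ _ ; (suc i) → ≤-trans (h i) (m≤n+m _ _) }

max-arity : (S : Sig) → ∃[ a ] (∀ f → arity S f ≤ a)
max-arity S = let a , h = bounded (Sig.ar S) in a , λ { halt → z≤n ; output → z≤n ; (fn i) → h i }

evalPoly-mono : (q : Poly) {x y : ℕ} → x ≤ y → evalPoly q x ≤ evalPoly q y
evalPoly-mono []       le = z≤n
evalPoly-mono (c ∷ cs) le = +-mono-≤ (≤-refl {c}) (*-mono-≤ le (evalPoly-mono cs le))

evalPoly-≤ : (q : Poly) {x : ℕ} → 1 ≤ x → evalPoly q x ≤ sum q * x ^ length q
evalPoly-≤ []       h = z≤n
evalPoly-≤ (c ∷ cs) {x} h = begin
  c + x * evalPoly cs x                    ≤⟨ +-mono-≤ c≤ (*-mono-≤ (≤-refl {x}) (evalPoly-≤ cs h)) ⟩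
  c * X + x * (sum cs * x ^ length cs)     ≡⟨ cong (c * X +_) (trans (sym (*-assoc x (sum cs) (x ^ length cs))) (trans (cong (_* x ^ length cs) (*-comm x (sum cs))) (*-assoc (sum cs) x (x ^ length cs)))) ⟩
  c * X + sum cs * X                       ≡⟨ *-distribʳ-+ X c (sum cs) ⟨
  (c + sum cs) * X                         ∎
  where
  open ≤-Reasoning
  X = x ^ suc (length cs)
  c≤ : c ≤ c * X
  c≤ = ≤-trans (≤-reflexive (sym (*-identityʳ c))) (*-mono-≤ (≤-refl {c}) (pos (suc (length cs))))
    where
    pos : ∀ k → 1 ≤ x ^ k
    pos zero    = ≤-refl
    pos (suc k) = *-mono-≤ h (pos k)

IsPoly-cong : ∀ f {s t} → (∀ e → s e ≡ t e) → IsPoly f s → IsPoly f t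
IsPoly-cong zero    h p e       = trans (sym (h (suc e))) (trans (p e) (h e))
IsPoly-cong (suc f) h (u , p , r) = u , p , λ e → trans (sym (h (suc e))) (trans (r e) (cong (_+ u e) (h e)))

IsPoly-const : ∀ f c → IsPoly f (λ _ → c)
IsPoly-const zero    c = λ _ → refl
IsPoly-const (suc f) c = (λ _ → 0) , IsPoly-const f 0 , λ _ → sym (+-identityʳ c)

IsPoly-suc : ∀ f {s} → IsPoly f s → IsPoly (suc f) s
IsPoly-suc zero    p = (λ _ → 0) , (λ _ → refl) , λ e → trans (p e) (sym (+-identityʳ _))
IsPoly-suc (suc f) (t , p , h) = t , IsPoly-suc f p , h

IsPoly-lift : ∀ k f {s} → IsPoly f s → IsPoly (k + f) s
IsPoly-lift zero    f p = p
IsPoly-lift (suc k) f p = IsPoly-suc (k + f) (IsPoly-lift k f p)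

IsPoly-+ : ∀ f {s t} → IsPoly f s → IsPoly f t → IsPoly f (λ e → s e + t e)
IsPoly-+ zero    p q e = cong₂ _+_ (p e) (q e)
IsPoly-+ (suc f) {s} {t} (u , p , h) (v , q , g) = (λ e → u e + v e) , IsPoly-+ f p q ,
  λ e → trans (cong₂ _+_ (h e) (g e)) (shuffle (s e) (u e) (t e) (v e))
  where
  shuffle : ∀ a b c d → (a + b) + (c + d) ≡ (a + c) + (b + d)
  shuffle a b c d = trans (+-assoc a b (c + d)) (trans (cong (a +_) (trans (sym (+-assoc b c d))
    (trans (cong (_+ d) (+-comm b c)) (+-assoc c b d)))) (sym (+-assoc a c (b + d))))

-- The discrete product rule: the difference of `(e + N) * s e` is `s (suc e)` plus `e + N` times
-- the difference of `s`.
IsPoly-* : ∀ N f {s} → IsPoly f s → IsPoly (suc f) (λ e → (e + N) * s e)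
IsPoly-* N zero {s} p = s , p , λ e → trans (cong ((suc e + N) *_) (p e)) (+-comm (s e) _)
IsPoly-* N (suc f) {s} p@(t , q , h) = (λ e → s (suc e) + (e + N) * t e) ,
  IsPoly-+ (suc f) (IsPoly-shift (suc f) p) (IsPoly-* N f q) , λ e → begin
    s (suc e) + (e + N) * s (suc e)              ≡⟨ cong (λ x → s (suc e) + (e + N) * x) (h e) ⟩
    s (suc e) + (e + N) * (s e + t e)            ≡⟨ cong (s (suc e) +_) (*-distribˡ-+ (e + N) (s e) (t e)) ⟩
    s (suc e) + ((e + N) * s e + (e + N) * t e)  ≡⟨ +-assoc (s (suc e)) _ _ ⟨
    s (suc e) + (e + N) * s e + (e + N) * t e    ≡⟨ cong (_+ (e + N) * t e) (+-comm (s (suc e)) _) ⟩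
    (e + N) * s e + s (suc e) + (e + N) * t e    ≡⟨ +-assoc ((e + N) * s e) _ _ ⟩
    (e + N) * s e + (s (suc e) + (e + N) * t e)  ∎
  where open ≡-Reasoning

IsPoly-evalPoly : ∀ N (q : Poly) → IsPoly (length q) (λ e → evalPoly q (e + N))
IsPoly-evalPoly N []       = λ _ → refl
IsPoly-evalPoly N (c ∷ cs) =
  IsPoly-+ (suc (length cs)) (IsPoly-const (suc (length cs)) c) (IsPoly-* N (length cs) (IsPoly-evalPoly N cs))

Eventually≤ : (ℕ → ℕ) → (ℕ → ℕ) → Set
Eventually≤ s t = ∃[ E ] (∀ e → E ≤ e → s e ≤ t e)

Eventually< : (ℕ → ℕ) → (ℕ → ℕ) → Set
Eventually< s t = ∃[ E ] (∀ e → E ≤ e → s e < t e)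

from-on : (P : ℕ → Set) (E : ℕ) → P E → (∀ e → E ≤ e → P e → P (suc e)) → ∀ e → E ≤ e → P e
from-on P E base up zero    z≤n = base
from-on P E base up (suc e) le with E ≤? e
... | yes E≤e = up e E≤e (from-on P E base up e E≤e)
... | no  E≰e = subst P (≤-antisym le (≰⇒> E≰e)) base

-- By induction: the first differences are eventually ordered, and then once s and t are in that order they stay so.
compare-polys : ∀ f {s t} → IsPoly f s → IsPoly f t → ¬ ¬ (Eventually≤ s t ⊎ Eventually< t s)
compare-polys zero {s} {t} p q k with s 0 ≤? t 0
... | yes le = k (inj₁ (0 , from-on (λ e → s e ≤ t e) 0 le λ e _ h → subst₂ _≤_ (sym (p e)) (sym (q e)) h))
... | no nle = k (inj₂ (0 , from-on (λ e → t e < s e) 0 (≰⇒> nle) λ e _ h → subst₂ _<_ (sym (q e)) (sym (p e)) h))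
compare-polys (suc f) {s} {t} (a , p , h) (b , q , g) = ¬¬-bind (compare-polys f p q) λ
  { (inj₁ (E , a≤b)) → ¬¬-bind (¬¬-em (∃[ e ] (E ≤ e × s e ≤ t e))) λ
      { (inj₁ (e₀ , E≤ , le)) k → k (inj₁ (e₀ , from-on (λ e → s e ≤ t e) e₀ le λ e e₀≤ h' →
          subst₂ _≤_ (sym (h e)) (sym (g e)) (+-mono-≤ h' (a≤b e (≤-trans E≤ e₀≤)))))
      ; (inj₂ none) k → k (inj₂ (E , λ e E≤ → ≰⇒> λ le → none (e , E≤ , le))) }
  ; (inj₂ (E , b<a)) → ¬¬-bind (¬¬-em (∃[ e ] (E ≤ e × t e < s e))) λ
      { (inj₁ (e₀ , E≤ , lt)) k → k (inj₂ (e₀ , from-on (λ e → t e < s e) e₀ lt λ e e₀≤ h' →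
          subst₂ _<_ (sym (g e)) (sym (h e)) (+-mono-≤ h' (<⇒≤ (b<a e (≤-trans E≤ e₀≤))))))
      ; (inj₂ none) k → k (inj₁ (E , λ e E≤ → ≮⇒≥ λ lt → none (e , E≤ , lt))) } }

ev-double : ∀ x y → ev (x + x + y) ≡ ev y
ev-double zero    y = refl
ev-double (suc x) y = trans (cong (λ z → not (ev (z + y))) (+-suc x x))
  (trans (not-involutive _) (ev-double x y))

pow-* : ∀ d x y → (x * y) ^ d ≡ x ^ d * y ^ d
pow-* zero    x y = refl
pow-* (suc d) x y = begin
  x * y * (x * y) ^ d        ≡⟨ cong (x * y *_) (pow-* d x y) ⟩
  x * y * (x ^ d * y ^ d)    ≡⟨ *-assoc x y _ ⟩
  x * (y * (x ^ d * y ^ d))  ≡⟨ cong (x *_) (trans (sym (*-assoc y (x ^ d) (y ^ d))) (trans (cong (_* y ^ d) (*-comm y (x ^ d))) (*-assoc (x ^ d) y (y ^ d)))) ⟩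
  x * (x ^ d * (y * y ^ d))  ≡⟨ *-assoc x _ _ ⟨
  x * x ^ d * (y * y ^ d)    ∎
  where open ≡-Reasoning

-- From one even size to a large odd one

module Refutation {S : Sig} (Π : Rule S 0) (p q : Poly)
  (decides : ∀ G → Accepts S Π p q G ⇔ (det (size G) (edges G) ≡ true))
  (a : ℕ) (ar≤ : ∀ f → arity S f ≤ a) (d s b₀ K N : ℕ)
  (b₀-def : suc a * suc d + (suc d + d) ≡ b₀) (1≤b₀ : 1 ≤ b₀) (hB : Bounds.Br Π b₀ ≤ K) (hq : quad b₀ ≤ K)
  (hN : quad K ≤ N) (hK : suc K ≤ N) (hs : K * s ≤ N)
  (even-N : ∀ e → ev (e + N) ≡ ev e) (q<s^ : ∀ {k} → d < k → evalPoly q N < s ^ k) where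

  open Run Π a ar≤ d s b₀ K N b₀-def hB hq hN hK hs

  accepts : ∀ n → ev n ≡ true → Accepts S Π p q (Kₙ n)
  accepts n e = Equivalence.from (decides (Kₙ n)) (trans (det-complete n) e)

  acc = accepts N (even-N 0)

  M : ℕ
  M = proj₁ acc

  M≤ : M ≤ evalPoly p N
  M≤ = proj₁ (proj₂ acc)

  halted-M : halted (state M N) ≡ true
  halted-M = proj₁ (proj₂ (proj₂ acc))

  running : ∀ j → j < M → halted (state j N) ≡ false
  running = proj₁ (proj₂ (proj₂ (proj₂ acc)))

  space : ∀ j → j ≤ M → activeCount (state j N) ≤ evalPoly q N
  space = proj₁ (proj₂ (proj₂ (proj₂ (proj₂ acc))))

  output-M : truthy (outputVal (state M N)) ≡ true
  output-M = proj₂ (proj₂ (proj₂ (proj₂ (proj₂ acc))))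

  symbolic : ∀ j → j ≤ M → Symbolic (state j)
  symbolic = symbolic-run M λ j j≤M d<k → ≤-trans (s≤s (space j j≤M)) (q<s^ d<k)

  uniform : ∀ {j} → j ≤ M → (f : Dyn (Sig.k S)) → ∀ {n} → N ≤ n →
            truthy (lookupSt (f , []) (state j n)) ≡ truthy (lookupSt (f , []) (state j N))
  uniform {j} j≤M f hn = let t , h = lookup-bool (state j) (symbolic j j≤M) f in trans (h hn) (sym (h ≤-refl))

  -- Acceptance at this size comes with a halting step `M'` of its own. Halting is uniform up to
  -- step `M`, so `M'` equals `M`, and the space bound obtained covers all steps concerned.
  even-space : ∀ e → ev e ≡ true → ∀ j → j ≤ M → activeCount (state j (e + N)) ≤ evalPoly q (e + N)
  even-space e ev-e j j≤M with accepts (e + N) (trans (even-N e) ev-e)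
  ... | M' , _ , halted' , running' , space' , _ with <-cmp M' M
  ... | tri< M'<M _ _ = false≢true (running M' M'<M) (trans (sym (uniform (<⇒≤ M'<M) halt (m≤n+m N e))) halted')
  ... | tri≈ _ refl _ = space' j j≤M
  ... | tri> _ _ M<M' = false≢true (running' M M<M') (trans (uniform ≤-refl halt (m≤n+m N e)) halted-M)

  count-active : ∀ j (sy : Symbolic (state j)) e →
                 count K N hN (activeF (proj₁ sy)) z≤n e ≡ activeCount (state j (e + N))
  count-active j (Γ , g , tr) e = Card-unique
    (Card-In K N hN (activeF Γ) [])
    (Card-cong
      (λ (y , y∈ , r) → let c , φ , β , i , r' = activeF⁻ tr' 1≤b₀ g b≤n y∈ in c , φ , β , i , ≈-trans r r')
      (λ (c , φ , β , i , r) → ∈ₛ-resp r (activeF⁺ tr' 1≤b₀ g b≤n i))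
      (Card-dedup (active (state j (e + N)))))
    where
    tr' = tr (m≤n+m N e)
    b≤n : b₀ + b₀ ≤ e + N
    b≤n = ≤-trans (+-mono-≤ b₀≤K b₀≤K) (≤-trans (2≤quad K) (≤-trans hN (m≤n+m N e)))

  -- The count and the bound are both polynomial sequences, hence eventually ordered one way or the
  -- other. A large even size excludes the wrong order, and the right one then holds at odd sizes as
  -- well.
  eventually-space : ∀ j → j ≤ M → ¬ ¬ Eventually≤ (λ e → activeCount (state j (e + N))) (λ e → evalPoly q (e + N))
  eventually-space j j≤M = ¬¬-bind
    (count-poly K N hN K (activeF Γ) good (λ r → proj₁ (good r)) hK z≤n)
    λ poly → ¬¬-bind (compare-polys (length q + K)
        (IsPoly-lift (length q) K (IsPoly-cong K (count-active j sy) poly))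
        (subst (λ f → IsPoly f used) (+-comm K (length q)) (IsPoly-lift K (length q) (IsPoly-evalPoly N q))))
      resolve
    where
    sy = symbolic j j≤M
    used : ℕ → ℕ
    used e = evalPoly q (e + N)
    resolve : Eventually≤ (λ e → activeCount (state j (e + N))) used ⊎ Eventually< used (λ e → activeCount (state j (e + N))) →
              ¬ ¬ Eventually≤ (λ e → activeCount (state j (e + N))) used
    resolve (inj₁ le) k = k le
    resolve (inj₂ (E , lt)) k = <⇒≱ (lt (E + E) (m≤m+n E E))
      (even-space (E + E) (trans (cong ev (sym (+-identityʳ (E + E)))) (ev-double E 0)) j j≤M)
    Γ = proj₁ sy
    good : Good K (Nm K) (activeF Γ)
    good = Good-mono b₀≤K (λ {_} {φ} → Nm-mono b₀≤K φ) (activeF-good 1≤b₀ Γ (proj₁ (proj₂ sy)))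

  -- The threshold may differ from step to step, but only finitely many steps are involved, so the
  -- thresholds can be added.
  eventually-all : ∀ m → m ≤ suc M → ¬ ¬ (∃[ E ] (∀ j → j < m → ∀ e → E ≤ e → activeCount (state j (e + N)) ≤ evalPoly q (e + N)))
  eventually-all zero    _ k = k (0 , λ _ ())
  eventually-all (suc m) (s≤s m≤M) = ¬¬-bind (eventually-all m (m≤n⇒m≤1+n m≤M)) λ (E , h) →
    ¬¬-bind (eventually-space m m≤M) λ (E' , h') k → k (E + E' , λ j j≤m e le → go h h' j (j ≟ℕ m) j≤m e le)
    where
    go : ∀ {E E'} → (∀ j → j < m → ∀ e → E ≤ e → activeCount (state j (e + N)) ≤ evalPoly q (e + N)) →
         (∀ e → E' ≤ e → activeCount (state m (e + N)) ≤ evalPoly q (e + N)) →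
         ∀ j → Dec (j ≡ m) → j < suc m → ∀ e → E + E' ≤ e → activeCount (state j (e + N)) ≤ evalPoly q (e + N)
    go {E} {E'} h h' j (yes refl) _ e le = h' e (≤-trans (m≤n+m E' E) le)
    go {E} {E'} h h' j (no j≢m) (s≤s j≤m) e le = h j (≤∧≢⇒< j≤m j≢m) e (≤-trans (m≤m+n E E') le)

  contradictory : ⊥
  contradictory = eventually-all (suc M) ≤-refl λ (E , h) →
    -- Odd, and at least `E`.
    let e  = suc (E + E)
        hn = m≤n+m N e
        E≤ = ≤-trans (m≤m+n E E) (n≤1+n (E + E))
        odd = trans (even-N e) (cong not (trans (cong ev (sym (+-identityʳ (E + E)))) (ev-double E 0)))
    in false≢true (trans (det-complete (e + N)) odd) (Equivalence.to (decides (Kₙ (e + N)))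
         ( M , ≤-trans M≤ (evalPoly-mono p hn) , trans (uniform ≤-refl halt hn) halted-M
         , (λ j j<M → trans (uniform (<⇒≤ j<M) halt hn) (running j j<M))
         , (λ j j≤M → h j (s≤s j≤M) e E≤)
         , trans (uniform ≤-refl output hn) output-M ))

mainTheorem9 : ¬ InCPTime (λ G → det (size G) (edges G) ≡ true)
mainTheorem9 (S , Π , p , q , decides) = Refutation.contradictory Π p q decides a (proj₂ (max-arity S)) d s b₀ K N refl
  (s≤s z≤n) (≤quad _) (+-mono-≤ b₀≤Br (+-mono-≤ b₀≤Br (+-mono-≤ b₀≤Br b₀≤Br))) quad≤N K<N ≤-refl even-N q<s^
  where
  a d b₀ K x s N : ℕ
  a  = proj₁ (max-arity S)
  d  = length q
  b₀ = suc a * suc d + (suc d + d)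
  -- Determined by the program, the arities and the length of `q` alone, so that `s` may depend on
  -- it.
  K  = quad (Bounds.Br Π b₀)
  -- More than `sum q * K ^ d`, so that `s ^ suc d` exceeds the value of `q` at `K * s`. The second
  -- `suc` makes `x` at least 2, whence `s` is at least 4 and `quad K ≤ N`.
  x  = suc (suc (sum q * K ^ d))
  -- Doubled to make `N` even, so that the graph of size `N` is accepted.
  s  = x + x
  N  = K * s
  b₀≤Br : b₀ ≤ Bounds.Br Π b₀
  b₀≤Br = Bounds.≤Br Π b₀
  1≤K : 1 ≤ K
  1≤K = ≤-trans (≤-trans (s≤s z≤n) b₀≤Br) (≤quad (Bounds.Br Π b₀))
  quad≤N : quad K ≤ N
  quad≤N = ≤-trans (+-mono-≤ (≤-refl {K}) (+-mono-≤ (≤-refl {K}) (+-mono-≤ (≤-refl {K}) (m≤m+n K 0))))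
    (≤-trans (*-monoˡ-≤ K (+-mono-≤ {2} {x} {2} {x} (s≤s (s≤s z≤n)) (s≤s (s≤s z≤n)))) (≤-reflexive (*-comm s K)))
  K<N : suc K ≤ N
  K<N = ≤-trans (+-mono-≤ 1≤K (≤-refl {K})) (≤-trans (2≤quad K) quad≤N)
  even-N : ∀ e → ev (e + N) ≡ ev e
  even-N e = trans (cong ev (trans (+-comm e N) (cong (_+ e) (*-distribˡ-+ K x x)))) (ev-double (K * x) e)
  q<s^ : ∀ {k} → d < k → evalPoly q N < s ^ k
  q<s^ {k} d<k = begin-strict
    evalPoly q N             ≤⟨ evalPoly-≤ q (≤-trans 1≤K (≤-trans (n≤1+n K) K<N)) ⟩
    sum q * (K * s) ^ d      ≡⟨ cong (sum q *_) (pow-* d K s) ⟩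
    sum q * (K ^ d * s ^ d)  ≡⟨ *-assoc (sum q) (K ^ d) (s ^ d) ⟨
    sum q * K ^ d * s ^ d    <⟨ *-monoˡ-< (s ^ d) {{m^n≢0 s d}} (≤-trans (n≤1+n _) (m≤m+n x x)) ⟩
    s ^ suc d                ≤⟨ ^-monoʳ-≤ s d<k ⟩
    s ^ k                    ∎
    where open ≤-Reasoning
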